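{- Let $\vec{\sigma}=(\sigma_1,\sigma_2,\ldots)$ be a weighting sequence with mean $\alpha$, i.e. $\lim_{n\to\infty}\frac1n\sum_{k=1}^n\sigma_k=\alpha$. For $0<x<1$ consider the $\vec{\sigma}$-weighted Boltzmann measure $\mathbb{P}_{\vec{\sigma},x}$ on permutations, let $N$ be the size of the ground set of a random permutation, and let $x=x(\mu)$ be chosen so that $\mathbb{E}_{\vec{\sigma},x}(N)=\mu$. Let $X$ be the number of cycles of the random permutation. Then $\mathbb{E}_{\vec{\sigma},x}(X)=\mathbb{V}_{\vec{\sigma},x}(X)\sim\alpha\log\mu$ as $x\to1^-$ or $\mu\to\infty$.
   Context: A weighting sequence is a sequence $\vec{\sigma}=(\sigma_1,\sigma_2,\ldots)$ of nonnegative reals; the weight of $\pi\in S_n$ is $w_{\vec{\sigma}}(\pi)=\prod_i\sigma_i^{c_i(\pi)}$ with $c_i(\pi)$ the number of $i$-cycles of $\pi$. The $\vec{\sigma}$-weighted Boltzmann measure with parameter $x>0$ is the probability measure on $\bigcup_{k\ge0}S_k$ given by \[ \mathbb{P}_{\vec{\sigma},x}(\pi)=\frac{w_{\vec{\sigma}}(\pi)\,x^{|\pi|}/|\pi|!}{\exp\left(\sum_{k\ge1}\sigma_kx^k/k\right)}, \] where $|\pi|$ is the size of the ground set of $\pi$; $\mathbb{E}_{\vec{\sigma},x}$ and $\mathbb{V}_{\vec{\sigma},x}$ are expectation and variance under it.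
   Formalization: The asymptotic claim is stated for mean α > 0 only; for α = 0 the right side α log μ is identically 0 and the claim fails, e.g. σ = (1,0,0,…) has α = 0 and E(X) = x → 1. -}

module Defs where

open import Level using (_⊔_) renaming (suc to lsuc)
open import Data.Nat.Base as ℕ using (ℕ; zero; suc; NonZero; _!)
import Data.Nat.Properties as ℕ
open import Data.Nat.GeneralisedArithmetic using (fold)
open import Data.Fin.Base as Fin using (Fin; toℕ)
import Data.Fin.Properties as Fin
open import Data.Fin.Patterns using (0F)
open import Data.Fin.Permutation as Perm
  using (Permutation′; _⟨$⟩ʳ_; _⟨$⟩ˡ_; _∘ₚ_; lift₀; transpose; remove)
import Data.Fin.Permutation.Components as PC
open import Data.List.Base
  using (List; []; _∷_; [_]; map; length; filter; foldr; allFin; cartesianProductWith)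
open import Data.List.Properties using (length-++; length-map; length-tabulate)
open import Data.List.Membership.Propositional using (_∈_)
open import Data.List.Membership.Propositional.Properties
  using (∈-allFin; ∈-cartesianProductWith⁺)
open import Data.List.Relation.Unary.Any using (here)
open import Data.Product.Base using (Σ; ∃; _×_; _,_; proj₁; proj₂)
open import Data.Sum.Base using (_⊎_; inj₁; inj₂)
open import Data.Empty using (⊥-elim)
open import Function.Base using (_∘_)
open import Relation.Nullary using (¬_; Dec; yes; no)
open import Relation.Nullary.Decidable using (_×-dec_; _→-dec_; ¬?)
open import Relation.Binary.Core using (Rel)
open import Relation.Binary.Structures using (IsStrictPartialOrder)
open import Relation.Binary.PropositionalEquality as ≡ using (_≡_; _≢_)
open import Algebra.Bundles using (Semiring; CommutativeRing)
open import Algebra.Apartness.Bundles using (HeytingField; HeytingCommutativeRing)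

------------------------------------------------------------------------
-- Permutations and their cycles

iter : ∀ {n} → Permutation′ n → ℕ → Fin n → Fin n
iter π k j = fold j (π ⟨$⟩ʳ_) k

-- A cycle of π is represented by its least element.  The orbit of j is
-- { iter π k j | k < n }, so bounding k by n loses nothing.

IsCycleMin : ∀ {n} → Permutation′ n → Fin n → Set
IsCycleMin {n} π j = (k : Fin n) → j Fin.≤ iter π (toℕ k) j

isCycleMin? : ∀ {n} (π : Permutation′ n) (j : Fin n) → Dec (IsCycleMin π j)
isCycleMin? π j = Fin.all? λ k → j Fin.≤? iter π (toℕ k) j

-- The cycle through j has length i: i is the least positive integer
-- with πⁱ j = j.

CycleLength : ∀ {n} → Permutation′ n → Fin n → ℕ → Set
CycleLength π j i =
  1 ℕ.≤ i × iter π i j ≡ j ×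
  ((k : Fin i) → 1 ℕ.≤ toℕ k → iter π (toℕ k) j ≢ j)

cycleLength? : ∀ {n} (π : Permutation′ n) (j : Fin n) (i : ℕ) →
               Dec (CycleLength π j i)
cycleLength? π j i =
  (1 ℕ.≤? i) ×-dec (iter π i j Fin.≟ j) ×-dec
  Fin.all? λ k → (1 ℕ.≤? toℕ k) →-dec ¬? (iter π (toℕ k) j Fin.≟ j)

#cycles : ∀ {n} → Permutation′ n → ℕ
#cycles {n} π = length (filter (isCycleMin? π) (allFin n))

#cyclesOfLength : ∀ {n} → ℕ → Permutation′ n → ℕ
#cyclesOfLength {n} i π =
  length (filter (λ j → isCycleMin? π j ×-dec cycleLength? π j i) (allFin n))

-- All of Sₙ, without repetition: every element of Sₙ₊₁ is uniquely
-- (0 j) ∘ (0 ⊕ π) with 0 ≤ j ≤ n and π ∈ Sₙ.  (_∘ₚ_ applies its left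
-- argument first.)

perms : ∀ n → List (Permutation′ n)
perms zero    = [ Perm.id ]
perms (suc n) =
  cartesianProductWith (λ j π → lift₀ π ∘ₚ transpose 0F j) (allFin (suc n)) (perms n)

private
  length-product : ∀ {A B C : Set} (f : A → B → C) xs ys →
                   length (cartesianProductWith f xs ys) ≡ length xs ℕ.* length ys
  length-product f []       ys = ≡.refl
  length-product f (x ∷ xs) ys = ≡.trans (length-++ (map (f x) ys))
    (≡.cong₂ ℕ._+_ (length-map (f x) ys) (length-product f xs ys))

length-perms : ∀ n → length (perms n) ≡ n !
length-perms zero    = ≡.refl
length-perms (suc n) = ≡.trans (length-product _ (allFin (suc n)) (perms n))
  (≡.cong₂ ℕ._*_ (length-tabulate {n = suc n} (λ i → i)) (length-perms n))

perms-complete : ∀ n (π : Permutation′ n) → ∃ λ ρ → ρ ∈ perms n × ρ Perm.≈ π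
perms-complete zero    π = Perm.id , here ≡.refl , λ ()
perms-complete (suc n) π =
  lift₀ ρ ∘ₚ transpose 0F j , ∈-cartesianProductWith⁺ _ (∈-allFin j) ρ∈ , ρ≈π
  where
  j  = π ⟨$⟩ʳ 0F
  π₀ = π ∘ₚ transpose j 0F
  ih = perms-complete n (remove 0F π₀)
  ρ  = proj₁ ih
  ρ∈ = proj₁ (proj₂ ih)

  transpose-fst : ∀ {m} (i k : Fin m) → PC.transpose i k i ≡ k
  transpose-fst i k with i Fin.≟ i
  ... | yes _ = ≡.refl
  ... | no ¬p = ⊥-elim (¬p ≡.refl)

  ρ≈π : (lift₀ ρ ∘ₚ transpose 0F j) Perm.≈ π
  ρ≈π i = ≡.trans
    (≡.cong (PC.transpose 0F j)
      (≡.trans (Perm.lift₀-cong ρ _ (proj₂ (proj₂ ih)) i)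
               (Perm.lift₀-remove π₀ (transpose-fst j 0F) i)))
    (PC.transpose-inverse 0F j)

------------------------------------------------------------------------
-- The real numbers

record OrderedField c ℓ₁ ℓ₂ : Set (lsuc (c ⊔ ℓ₁ ⊔ ℓ₂)) where
  infix 4 _<_ _≤_ _⟶_
  field
    heytingField : HeytingField c ℓ₁ ℓ₂

  open HeytingField heytingField public
    renaming (refl to ≈-refl; sym to ≈-sym; trans to ≈-trans)

  field
    _<_                    : Rel Carrier ℓ₂
    <-isStrictPartialOrder : IsStrictPartialOrder _≈_ _<_
    #⇒<                    : ∀ {x y} → x # y → x < y ⊎ y < x
    <⇒#                    : ∀ {x y} → x < y → x # y
    +-monoˡ-<              : ∀ {x y} z → x < y → x + z < y + z
    *-pos                  : ∀ {x y} → 0# < x → 0# < y → 0# < x * y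

  module <-Order = IsStrictPartialOrder <-isStrictPartialOrder

  commutativeRing : CommutativeRing c ℓ₁
  commutativeRing =
    HeytingCommutativeRing.commutativeRing heytingCommutativeRing

  open import Algebra.Definitions.RawSemiring
    (Semiring.rawSemiring (CommutativeRing.semiring commutativeRing)) public
    using (_^_; sum; product) renaming (_×_ to _·_)

  fromℕ : ℕ → Carrier
  fromℕ n = n · 1#

  _≤_ : Rel Carrier ℓ₂
  x ≤ y = ¬ (y < x)

  -- | x - y | < ε
  Within : Carrier → Carrier → Carrier → Set ℓ₂
  Within ε x y = x < y + ε × y < x + ε

  IsCauchy : (ℕ → Carrier) → Set (c ⊔ ℓ₂)
  IsCauchy a = ∀ ε → 0# < ε →
    ∃ λ M → ∀ m n → M ℕ.≤ m → M ℕ.≤ n → Within ε (a m) (a n)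

  _⟶_ : (ℕ → Carrier) → Carrier → Set (c ⊔ ℓ₂)
  a ⟶ l = ∀ ε → 0# < ε → ∃ λ M → ∀ n → M ℕ.≤ n → Within ε (a n) l

-- ℝ is characterised axiomatically as a Cauchy-complete Archimedean
-- ordered field.  Classically such a field is unique up to isomorphism.
-- Excluded middle is not among the axioms, so they also hold of the
-- constructive (Bishop) reals.

record CompleteOrderedField c ℓ₁ ℓ₂ : Set (lsuc (c ⊔ ℓ₁ ⊔ ℓ₂)) where
  field
    orderedField : OrderedField c ℓ₁ ℓ₂

  open OrderedField orderedField public

  field
    archimedean : ∀ x → ∃ λ n → x < fromℕ n
    complete    : ∀ a → IsCauchy a → ∃ λ l → a ⟶ l

------------------------------------------------------------------------
-- Boltzmann measures

module Boltzmann {c ℓ₁ ℓ₂} (ℝ : CompleteOrderedField c ℓ₁ ℓ₂) where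

  open CompleteOrderedField ℝ public

  _⁻¹[_] : ∀ x → x # 0# → Carrier
  x ⁻¹[ x#0 ] = proj₁ (#⇒invertible x#0)

  private
    open CommutativeRing commutativeRing using (ring)
    open import Algebra.Properties.Ring ring using (-‿distribˡ-*; -‿involutive)
    open import Algebra.Apartness.Properties.HeytingCommutativeRing
      heytingCommutativeRing using (1#0)

    <-resp : ∀ {x x′ y y′} → x ≈ x′ → y ≈ y′ → x < y → x′ < y′
    <-resp p q = proj₂ <-Order.<-resp-≈ p ∘ proj₁ <-Order.<-resp-≈ q

  0<1 : 0# < 1#
  0<1 with #⇒< 1#0
  ... | inj₂ 0<1 = 0<1
  ... | inj₁ 1<0 = ⊥-elim (<-Order.irrefl ≈-refl (<-Order.trans 1<0 0<1′))
    where
    0<-1 : 0# < - 1#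
    0<-1 = <-resp (-‿inverseʳ 1#) (+-identityˡ _) (+-monoˡ-< (- 1#) 1<0)
    0<1′ : 0# < 1#
    0<1′ = <-resp ≈-refl
      (≈-trans (≈-sym (-‿distribˡ-* 1# (- 1#)))
        (≈-trans (-‿cong (*-identityˡ (- 1#))) (-‿involutive 1#)))
      (*-pos 0<-1 0<-1)

  fromℕ-pos : ∀ n → 0# < fromℕ (suc n)
  fromℕ-pos zero    = <-resp ≈-refl (≈-sym (+-identityʳ 1#)) 0<1
  fromℕ-pos (suc n) = <-Order.trans (fromℕ-pos n)
    (<-resp (+-identityˡ _) ≈-refl (+-monoˡ-< (fromℕ (suc n)) 0<1))

  fromℕ#0 : ∀ n .{{_ : NonZero n}} → fromℕ n # 0#
  fromℕ#0 (suc n) = #-sym (<⇒# (fromℕ-pos n))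

  1/ : ∀ n .{{_ : NonZero n}} → Carrier
  1/ n = fromℕ n ⁻¹[ fromℕ#0 n ]

  1/! : ℕ → Carrier
  1/! n = 1/ (n !) {{n ℕ.!≢0}}

  ∑< : ℕ → (ℕ → Carrier) → Carrier
  ∑< n a = sum {n} (λ i → a (toℕ i))

  HasSum : (ℕ → Carrier) → Carrier → Set (c ⊔ ℓ₂)
  HasSum a s = (λ n → ∑< n a) ⟶ s

  -- y = exp x
  IsExp : Carrier → Carrier → Set (c ⊔ ℓ₂)
  IsExp x y = HasSum (λ k → x ^ k * 1/! k) y

  -- y = log x
  IsLog : Carrier → Carrier → Set (c ⊔ ℓ₂)
  IsLog x y = IsExp y x

  -- σ k stands for σₖ with k ≥ 1; the value σ 0 is never used.

  IsWeighting : (ℕ → Carrier) → Set ℓ₂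
  IsWeighting σ = ∀ k → 0# ≤ σ (suc k)

  HasMean : (ℕ → Carrier) → Carrier → Set (c ⊔ ℓ₂)
  HasMean σ α = (λ n → 1/ (suc n) * ∑< (suc n) (λ k → σ (suc k))) ⟶ α

  weight : (ℕ → Carrier) → ∀ {n} → Permutation′ n → Carrier
  weight σ {n} π =
    product {n} (λ i → σ (suc (toℕ i)) ^ #cyclesOfLength (suc (toℕ i)) π)

  -- The sample space ⋃ₖ Sₖ.
  Ω : Set
  Ω = Σ ℕ Permutation′

  -- The sum over Ω is taken as ∑ₙ ∑_{π ∈ Sₙ}; it is only used for
  -- non-negative summands, for which the order is immaterial.
  IsExpectation : (Ω → Carrier) → (Ω → Carrier) → Carrier → Set (c ⊔ ℓ₂)
  IsExpectation p f = HasSum λ n →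
    foldr _+_ 0# (map (λ π → f (n , π) * p (n , π)) (perms n))

  IsVariance : (Ω → Carrier) → (Ω → Carrier) → Carrier → Set (c ⊔ ℓ₂)
  IsVariance p f v = ∃ λ m →
    IsExpectation p f m × IsExpectation p (λ ω → (f ω - m) ^ 2) v

  IsProbability : (Ω → Carrier) → Set (c ⊔ ℓ₂)
  IsProbability p = (∀ ω → 0# ≤ p ω) × IsExpectation p (λ _ → 1#) 1#

  record BoltzmannMeasure (σ : ℕ → Carrier) (x : Carrier) : Set (c ⊔ ℓ₂) where
    field
      logZ     : Carrier
      logZ-sum : HasSum (λ k → σ (suc k) * x ^ suc k * 1/ (suc k)) logZ
      Z        : Carrier
      Z-exp    : IsExp logZ Z
      Z#0      : Z # 0#

    ℙ : Ω → Carrier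
    ℙ (n , π) = weight σ π * x ^ n * 1/! n * Z ⁻¹[ Z#0 ]

    field
      isProbability : IsProbability ℙ

  infix 4 𝔼[_]_≈_ 𝕍[_]_≈_

  𝔼[_]_≈_ : ∀ {σ x} → BoltzmannMeasure σ x → (Ω → Carrier) → Carrier → Set (c ⊔ ℓ₂)
  𝔼[ P ] f ≈ m = IsExpectation (BoltzmannMeasure.ℙ P) f m

  𝕍[_]_≈_ : ∀ {σ x} → BoltzmannMeasure σ x → (Ω → Carrier) → Carrier → Set (c ⊔ ℓ₂)
  𝕍[ P ] f ≈ v = IsVariance (BoltzmannMeasure.ℙ P) f v

  N : Ω → Carrier
  N (n , _) = fromℕ n

  X : Ω → Carrier
  X (_ , π) = fromℕ (#cycles π)

  -- | f / g - 1 | < ε; having this eventually for every ε is f ∼ g.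
  RatioWithin : Carrier → Carrier → Carrier → Set ℓ₂
  RatioWithin ε f g = Σ (g # 0#) λ g#0 → Within ε (f * g ⁻¹[ g#0 ]) 1#

{-# OPTIONS --safe #-}

-- Inserting a new point into a permutation either starts a cycle or lengthens
-- the cycle of one of the n existing points. Iterating this on cycle types and
-- following the cycle of one point gives
--   n f(n) = Σₖ σₖ f′(n-k),   f(n) = (1/n!) Σ_{π ∈ Sₙ} w(π) φ(#cycles π),
-- where f′ belongs to φ(1 + _). Its solution is Σᵣ φ(r) [xⁿ] ℓ(x)ʳ/r! with
-- ℓ(x) = Σ σₖxᵏ/k, so under the Boltzmann measure the number of cycles is
-- Poisson of mean ℓ(x), and E(N) = x ℓ′(x) = Σ σₖxᵏ.
--
-- By partial summation ℓ(x) is within δ log(1/(1-x)) + O(1) of α log(1/(1-x)),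
-- and E(N) is comparable to 1/(1-x), so log E(N) = log(1/(1-x)) + O(1) by
-- concavity of the logarithm. The logarithm itself is -log(1-y) = Σ yᵏ/k; that
-- exp inverts it is the case σₖ = 1 of the exponential formula.
--
-- Excluded middle is not available: convergence always comes with a modulus,
-- and x ≤ y, being ¬ y < x, is never split into cases.

module Submission where

open import Defs
open import Level using (_⊔_)
open import Algebra.Bundles using (CommutativeRing)
open import Algebra.Solver.Ring.AlmostCommutativeRing using (fromCommutativeRing; _-Raw-AlmostCommutative⟶_)
import Algebra.Solver.Ring
open import Data.Nat using (ℕ)
open import Data.Nat.Base as ℕ using (zero; suc; NonZero; _!; z≤n; s≤s)
import Data.Nat.Properties as ℕ
import Data.Nat.DivMod as ℕ
open import Data.Nat.GeneralisedArithmetic using (fold)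
open import Data.Integer.Base as ℤ using (ℤ; +_; -[1+_])
import Data.Integer.Properties as ℤ
open import Data.Fin.Base as Fin using (Fin; toℕ; fromℕ<)
import Data.Fin.Properties as Fin
open import Data.Fin.Patterns using (0F)
open import Data.Fin.Permutation as Perm
  using (Permutation′; _⟨$⟩ʳ_; _⟨$⟩ˡ_; _∘ₚ_; lift₀; transpose)
import Data.Fin.Permutation.Components as PC
open import Data.List.Base
  using (List; []; _∷_; _++_; map; length; filter; foldr; tabulate; allFin; concatMap; applyUpTo; cartesianProductWith)
import Data.List.Properties as List
open import Data.List.Membership.Propositional using (_∈_; lose)
open import Data.List.Membership.Propositional.Properties
  using (∈-allFin; ∈-filter⁺; ∈-filter⁻; ∈-applyUpTo⁺; ∈-applyUpTo⁻; ∈-concatMap⁺)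
open import Data.List.Membership.Propositional.Properties.WithK using (unique∧set⇒bag)
open import Data.List.Relation.Unary.Any using (here; there)
open import Data.List.Relation.Unary.All as All using (All; []; _∷_)
import Data.List.Relation.Unary.All.Properties as All
open import Data.List.Relation.Unary.AllPairs using (AllPairs; []; _∷_)
open import Data.List.Relation.Unary.Unique.Propositional using (Unique)
import Data.List.Relation.Unary.Unique.Propositional.Properties as Unique
open import Data.List.Relation.Binary.Disjoint.Propositional using (Disjoint)
open import Data.List.Relation.Binary.Permutation.Propositional using (_↭_; ↭-refl; prep; swap)
  renaming (refl to ↭-id; trans to ↭-tr)
import Data.List.Relation.Binary.Permutation.Propositional.Properties as ↭
open import Data.List.Relation.Binary.BagAndSetEquality using (∼bag⇒↭)
open import Data.Maybe.Base as Maybe using ()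
open import Data.Product using (Σ; ∃; _×_; _,_; proj₁; proj₂)
open import Data.Sum.Base using (_⊎_; inj₁; inj₂; [_,_]′)
open import Data.Empty using (⊥-elim)
open import Function.Base using (_∘_; case_of_; id)
open import Function.Bundles using (mk⇔)
open import Relation.Nullary using (¬_; yes; no; Dec)
open import Relation.Nullary.Decidable using (_×-dec_; ¬?; dec⇒maybe; dec-true; dec-false)
open import Relation.Binary.Definitions using (tri<; tri≈; tri>)
open import Relation.Binary.PropositionalEquality as ≡
  using (_≡_; _≢_)
open import Relation.Binary.Structures using (IsPreorder)
import Relation.Binary.Reasoning.Base.Triple as Triple
import Relation.Binary.Reasoning.Setoid as SetoidReasoning

-- The statistic φ stays arbitrary because the recurrence replaces it by φ(1 + _): in general only
-- the family of all its shifts satisfies a closed system. Total mass, mean and variance are then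
-- the choices 1, r and (r - ℓ)², and no second formal variable is needed. Sums are only
-- interchanged for non-negative terms, so one theorem of Tonelli type covers products, exponentials
-- and expectations alike.
--
-- The mean restricts only averages of σ, which may itself be unbounded; hence every comparison with
-- α goes through partial sums. Positivity of α enters the asymptotics twice: it makes α log μ
-- invertible, and it bounds E(N) below by a fixed multiple of 1/(1-x).
--
-- Two tolerances occur. A constant factor in E(N) costs only a bounded error in log E(N), so the
-- fixed tolerance α/2 suffices there; E(X) needs εα/2. The bounded errors disappear in the ratio
-- once log μ is large.

module IntegerRingSolver {c ℓ} (R : CommutativeRing c ℓ) where
  open CommutativeRing R
  open import Algebra.Properties.Ring ring
  open import Algebra.Properties.AbelianGroup +-abelianGroup using (⁻¹-∙-comm)
  open import Algebra.Properties.Semiring.Mult.TCOptimised semiring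
    using (×1-homo-*) renaming (_×_ to _×′_; ×-homo-+ to ×′-homo-+; 1+× to 1+×′)
  open import Relation.Binary.Reasoning.Setoid setoid

  -- Equality of carrier elements is not decidable, and a solver must recognise vanishing
  -- coefficients to cancel terms. Integer coefficients are decidable and have a canonical image in
  -- any commutative ring.
  ⟦_⟧ℤ : ℤ → Carrier
  ⟦ + n      ⟧ℤ = n ×′ 1#
  ⟦ -[1+ n ] ⟧ℤ = - (suc n ×′ 1#)

  ⟦⟧ℤ-neg : ∀ i → ⟦ ℤ.- i ⟧ℤ ≈ - ⟦ i ⟧ℤ
  ⟦⟧ℤ-neg (+ zero)  = sym -0#≈0#
  ⟦⟧ℤ-neg (+ suc n) = refl
  ⟦⟧ℤ-neg -[1+ n ]  = sym (-‿involutive _)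

  ⟦⟧ℤ-⊖ : ∀ m n → ⟦ m ℤ.⊖ n ⟧ℤ ≈ m ×′ 1# - n ×′ 1#
  ⟦⟧ℤ-⊖ m       zero    = sym (trans (+-congˡ -0#≈0#) (+-identityʳ _))
  ⟦⟧ℤ-⊖ zero    (suc n) = sym (+-identityˡ _)
  ⟦⟧ℤ-⊖ (suc m) (suc n) = begin
    ⟦ suc m ℤ.⊖ suc n ⟧ℤ                     ≡⟨ ≡.cong ⟦_⟧ℤ (ℤ.[1+m]⊖[1+n]≡m⊖n m n) ⟩
    ⟦ m ℤ.⊖ n ⟧ℤ                             ≈⟨ ⟦⟧ℤ-⊖ m n ⟩
    m ×′ 1# - n ×′ 1#                        ≈⟨ cancel ⟨
    (1# + m ×′ 1#) - (1# + n ×′ 1#)          ≈⟨ +-cong (1+×′ m 1#) (-‿cong (1+×′ n 1#)) ⟨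
    suc m ×′ 1# - suc n ×′ 1#                ∎
    where
    cancel : ∀ {x y z} → (x + y) - (x + z) ≈ y - z
    cancel {x} {y} {z} = begin
      (x + y) - (x + z)       ≈⟨ +-cong (+-comm x y) (sym (⁻¹-∙-comm x z)) ⟩
      (y + x) + (- x - z)     ≈⟨ +-assoc y x _ ⟩
      y + (x + (- x - z))     ≈⟨ +-congˡ (+-assoc x _ _) ⟨
      y + ((x - x) - z)       ≈⟨ +-congˡ (trans (+-congʳ (-‿inverseʳ x)) (+-identityˡ _)) ⟩
      y - z                   ∎

  ⟦⟧ℤ-+ : ∀ i j → ⟦ i ℤ.+ j ⟧ℤ ≈ ⟦ i ⟧ℤ + ⟦ j ⟧ℤ
  ⟦⟧ℤ-+ (+ m)    (+ n)    = ×′-homo-+ 1# m n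
  ⟦⟧ℤ-+ (+ m)    -[1+ n ] = ⟦⟧ℤ-⊖ m (suc n)
  ⟦⟧ℤ-+ -[1+ m ] (+ n)    = trans (⟦⟧ℤ-⊖ n (suc m)) (+-comm _ _)
  ⟦⟧ℤ-+ -[1+ m ] -[1+ n ] = begin
    - (suc (suc (m ℕ.+ n)) ×′ 1#)              ≡⟨ ≡.cong (λ k → - (k ×′ 1#)) (ℕ.+-suc (suc m) n) ⟨
    - ((suc m ℕ.+ suc n) ×′ 1#)                ≈⟨ -‿cong (×′-homo-+ 1# (suc m) (suc n)) ⟩
    - (suc m ×′ 1# + suc n ×′ 1#)              ≈⟨ ⁻¹-∙-comm _ _ ⟨
    - (suc m ×′ 1#) - suc n ×′ 1#              ∎

  ⟦⟧ℤ-*⁺ : ∀ m j → ⟦ + m ℤ.* j ⟧ℤ ≈ ⟦ + m ⟧ℤ * ⟦ j ⟧ℤ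
  ⟦⟧ℤ-*⁺ m (+ n) = trans (reflexive (≡.cong ⟦_⟧ℤ (≡.sym (ℤ.pos-* m n)))) (×1-homo-* m n)
  ⟦⟧ℤ-*⁺ m -[1+ n ] = begin
    ⟦ + m ℤ.* (ℤ.- (+ suc n)) ⟧ℤ    ≡⟨ ≡.cong ⟦_⟧ℤ (ℤ.neg-distribʳ-* (+ m) (+ suc n)) ⟨
    ⟦ ℤ.- (+ m ℤ.* + suc n) ⟧ℤ      ≈⟨ ⟦⟧ℤ-neg (+ m ℤ.* + suc n) ⟩
    - ⟦ + m ℤ.* + suc n ⟧ℤ          ≈⟨ -‿cong (⟦⟧ℤ-*⁺ m (+ suc n)) ⟩
    - (m ×′ 1# * (suc n ×′ 1#))     ≈⟨ -‿distribʳ-* _ _ ⟩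
    m ×′ 1# * - (suc n ×′ 1#)       ∎

  ⟦⟧ℤ-* : ∀ i j → ⟦ i ℤ.* j ⟧ℤ ≈ ⟦ i ⟧ℤ * ⟦ j ⟧ℤ
  ⟦⟧ℤ-* (+ m)    j = ⟦⟧ℤ-*⁺ m j
  ⟦⟧ℤ-* -[1+ m ] j = begin
    ⟦ (ℤ.- (+ suc m)) ℤ.* j ⟧ℤ      ≡⟨ ≡.cong ⟦_⟧ℤ (ℤ.neg-distribˡ-* (+ suc m) j) ⟨
    ⟦ ℤ.- (+ suc m ℤ.* j) ⟧ℤ        ≈⟨ ⟦⟧ℤ-neg (+ suc m ℤ.* j) ⟩
    - ⟦ + suc m ℤ.* j ⟧ℤ            ≈⟨ -‿cong (⟦⟧ℤ-*⁺ (suc m) j) ⟩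
    - (suc m ×′ 1# * ⟦ j ⟧ℤ)        ≈⟨ -‿distribˡ-* _ _ ⟩
    - (suc m ×′ 1#) * ⟦ j ⟧ℤ        ∎

  morphism : ℤ.+-*-rawRing -Raw-AlmostCommutative⟶ fromCommutativeRing R
  morphism = record
    { ⟦_⟧    = ⟦_⟧ℤ
    ; +-homo = ⟦⟧ℤ-+
    ; *-homo = ⟦⟧ℤ-*
    ; -‿homo = ⟦⟧ℤ-neg
    ; 0-homo = refl
    ; 1-homo = refl
    }

  open Algebra.Solver.Ring ℤ.+-*-rawRing (fromCommutativeRing R) morphism
    (λ i j → Maybe.map (λ i≡j → reflexive (≡.cong ⟦_⟧ℤ i≡j)) (dec⇒maybe (i ℤ.≟ j)))
    public using (solve; _:=_; _:+_; _:*_; _:-_; :-_; _:^_; con; Polynomial)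

  -- These evaluate to `0#` and `1#` definitionally. By contrast `fromℕ 1` unfolds to `1# + 0#`, so
  -- it is entered in later calls as `𝟙 :+ 𝟘`, and `fromℕ (suc n)` as `𝟙 :+ N`.
  𝟘 𝟙 : ∀ {n} → Polynomial n
  𝟘 = con (+ 0)
  𝟙 = con (+ 1)

open ≡ using (refl; sym; trans; cong; cong₂; subst)

-- Orbits and cycle types of permutations

least : ∀ {P : ℕ → Set} → (∀ k → Dec (P k)) → ∀ m → P m →
        ∃ λ i → i ℕ.≤ m × P i × (∀ k → k ℕ.< i → ¬ P k)
least P? zero    p = 0 , z≤n , p , λ _ ()
least P? (suc m) p with P? 0
... | yes p₀ = 0 , z≤n , p₀ , λ _ ()
... | no ¬p₀ with least (P? ∘ suc) m p
...   | i , i≤m , pᵢ , below = suc i , s≤s i≤m , pᵢ , λ { zero _ → ¬p₀ ; (suc k) (s≤s k<i) → below k k<i }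

module Orbits {n} (π : Permutation′ n) where

  iter-+ : ∀ a b j → iter π (a ℕ.+ b) j ≡ iter π a (iter π b j)
  iter-+ zero    b j = refl
  iter-+ (suc a) b j = cong (π ⟨$⟩ʳ_) (iter-+ a b j)

  iter-injective : ∀ k {i j} → iter π k i ≡ iter π k j → i ≡ j
  iter-injective zero    e = e
  iter-injective (suc k) e = iter-injective k
    (trans (sym (Perm.inverseˡ π)) (trans (cong (π ⟨$⟩ˡ_) e) (Perm.inverseˡ π)))

  iter-∸ : ∀ {a b j} → a ℕ.≤ b → iter π a j ≡ iter π b j → iter π (b ℕ.∸ a) j ≡ j
  iter-∸ {a} {b} {j} a≤b e = sym (iter-injective a (trans e
    (trans (cong (λ k → iter π k j) (sym (ℕ.m+[n∸m]≡n a≤b))) (iter-+ a (b ℕ.∸ a) j))))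

  -- Among the n + 1 iterates with exponents 0 to n two coincide, and injectivity of `π` moves the
  -- coincidence back to `j`.
  returns : ∀ j → ∃ λ k → k ℕ.< n × iter π (suc k) j ≡ j
  returns j with Fin.pigeonhole ℕ.≤-refl (λ (k : Fin (suc n)) → iter π (toℕ k) j)
  ... | a , b , a<b , e with toℕ b ℕ.∸ toℕ a in d≡ | iter-∸ (ℕ.<⇒≤ a<b) e
  ...   | zero  | _  = ⊥-elim (ℕ.<⇒≢ (ℕ.m<n⇒0<n∸m a<b) (sym d≡))
  ...   | suc k | e′ = k , ℕ.≤-trans (ℕ.≤-reflexive (sym d≡)) (ℕ.≤-trans (ℕ.m∸n≤m (toℕ b) (toℕ a)) (ℕ.s≤s⁻¹ (Fin.toℕ<n b))) , e′

  opaque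
    cycleLength : ∀ j → ∃ λ i → i ℕ.≤ n × CycleLength π j i
    cycleLength j with returns j
    ... | k , k<n , e with least (λ k → iter π (suc k) j Fin.≟ j) k e
    ...   | i , i≤k , eᵢ , below = suc i , ℕ.≤-trans (s≤s i≤k) k<n , s≤s z≤n , eᵢ ,
            λ { (Fin.suc l) _ → below (toℕ l) (Fin.toℕ<n l) }

  len : Fin n → ℕ
  len j = proj₁ (cycleLength j)

  len≤n : ∀ j → len j ℕ.≤ n
  len≤n j = proj₁ (proj₂ (cycleLength j))

  len-spec : ∀ j → CycleLength π j (len j)
  len-spec j = proj₂ (proj₂ (cycleLength j))

  0<len : ∀ j → 0 ℕ.< len j
  0<len j = proj₁ (len-spec j)

  iter-len : ∀ j → iter π (len j) j ≡ j
  iter-len j = proj₁ (proj₂ (len-spec j))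

  iter≢ : ∀ j k → 0 ℕ.< k → k ℕ.< len j → iter π k j ≢ j
  iter≢ j k 0<k k<p = subst (λ m → iter π m j ≢ j) (Fin.toℕ-fromℕ< k<p)
    (proj₂ (proj₂ (len-spec j)) (fromℕ< k<p) (subst (0 ℕ.<_) (sym (Fin.toℕ-fromℕ< k<p)) 0<k))

  len-unique : ∀ {j i} → CycleLength π j i → len j ≡ i
  len-unique {j} {i} (0<i , e , min) with ℕ.<-cmp (len j) i
  ... | tri≈ _ p _ = p
  ... | tri> _ _ i<p = ⊥-elim (iter≢ j i 0<i i<p e)
  ... | tri< p<i _ _ = ⊥-elim (min (fromℕ< p<i) (subst (1 ℕ.≤_) (sym (Fin.toℕ-fromℕ< p<i)) (0<len j))
          (trans (cong (λ k → iter π k j) (Fin.toℕ-fromℕ< p<i)) (iter-len j)))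

  iter-multiple : ∀ q j → iter π (q ℕ.* len j) j ≡ j
  iter-multiple zero    j = refl
  iter-multiple (suc q) j = trans (iter-+ (len j) (q ℕ.* len j) j)
    (trans (cong (iter π (len j)) (iter-multiple q j)) (iter-len j))

  iter-mod : ∀ k j → ∃ λ r → r ℕ.< len j × iter π k j ≡ iter π r j
  iter-mod k j = k ℕ.% len j , ℕ.m%n<n k (len j) ,
    trans (cong (λ m → iter π m j) (ℕ.m≡m%n+[m/n]*n k (len j)))
      (trans (iter-+ (k ℕ.% len j) (k ℕ./ len j ℕ.* len j) j)
        (cong (iter π (k ℕ.% len j)) (iter-multiple (k ℕ./ len j) j)))
    where instance
      len≢0 : NonZero (len j)
      len≢0 = ℕ.>-nonZero (0<len j)

  _~_ : Fin n → Fin n → Set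
  i ~ j = ∃ λ k → iter π k i ≡ j

  ~-trans : ∀ {i j k} → i ~ j → j ~ k → i ~ k
  ~-trans {i} (a , refl) (b , refl) = b ℕ.+ a , iter-+ b a i

  -- Only forward iterates are available, so the way back completes the cycle: after r steps out,
  -- `len i ∸ r` more steps return to `i`.
  ~-sym : ∀ {i j} → i ~ j → j ~ i
  ~-sym {i} (k , refl) with iter-mod k i
  ... | r , r<p , e = len i ℕ.∸ r , trans (cong (iter π (len i ℕ.∸ r)) e)
    (trans (sym (iter-+ (len i ℕ.∸ r) r i))
      (trans (cong (λ m → iter π m i) (ℕ.m∸n+n≡m (ℕ.<⇒≤ r<p))) (iter-len i)))

  min-≤ : ∀ {m j} → IsCycleMin π m → m ~ j → m Fin.≤ j
  min-≤ {m} min (k , refl) with iter-mod k m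
  ... | r , r<p , e = subst (m Fin.≤_) (trans (cong (λ k → iter π k m) (Fin.toℕ-fromℕ< r<n)) (sym e)) (min (fromℕ< r<n))
    where r<n = ℕ.<-≤-trans r<p (len≤n m)

  min-unique : ∀ {m m′} → IsCycleMin π m → IsCycleMin π m′ → m ~ m′ → m ≡ m′
  min-unique min min′ m~m′ = Fin.≤-antisym (min-≤ min m~m′) (min-≤ min′ (~-sym m~m′))

  len-~ : ∀ {i j} → i ~ j → len i ≡ len j
  len-~ {i} (k , refl) = sym (len-unique (0<len i ,
    trans (sym (iter-+ (len i) k i)) (trans (cong (λ m → iter π m i) (ℕ.+-comm (len i) k))
      (trans (iter-+ k (len i) i) (cong (iter π k) (iter-len i)))) ,
    λ l 0<l e → iter≢ i (toℕ l) 0<l (Fin.toℕ<n l)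
      (iter-injective k (trans (sym (iter-+ k (toℕ l) i)) (trans (cong (λ m → iter π m i) (ℕ.+-comm k (toℕ l)))
        (trans (iter-+ (toℕ l) k i) e))))))

  opaque
    minimum : ∀ j → ∃ λ m → IsCycleMin π m × m ~ j
    minimum j = go (suc (toℕ j)) j ℕ.≤-refl
      where
      -- The bound `b` drops at each call, since a point that is not least in its orbit has a
      -- strictly smaller iterate.
      go : ∀ b j → toℕ j ℕ.< b → ∃ λ m → IsCycleMin π m × m ~ j
      go (suc b) j (s≤s j≤b) with isCycleMin? π j
      ... | yes min = j , min , 0 , refl
      ... | no ¬min with Fin.¬∀⟶∃¬ n _ (λ k → j Fin.≤? iter π (toℕ k) j) ¬min
      ...   | k , j≰i with go b (iter π (toℕ k) j) (ℕ.<-≤-trans (ℕ.≰⇒> j≰i) j≤b)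
      ...     | m , min , m~i = m , min , ~-trans m~i (~-sym (toℕ k , refl))

  rep : Fin n → Fin n
  rep j = proj₁ (minimum j)

  rep-min : ∀ j → IsCycleMin π (rep j)
  rep-min j = proj₁ (proj₂ (minimum j))

  rep~ : ∀ j → rep j ~ j
  rep~ j = proj₂ (proj₂ (minimum j))

  rep-unique : ∀ {m j} → IsCycleMin π m → m ~ j → rep j ≡ m
  rep-unique {m} {j} min m~j = min-unique (rep-min j) min (~-trans (rep~ j) (~-sym m~j))

  minima : List (Fin n)
  minima = filter (isCycleMin? π) (allFin n)

  minima-unique : Unique minima
  minima-unique = Unique.filter⁺ (isCycleMin? π) (Unique.allFin⁺ n)

  minima-min : ∀ {m} → m ∈ minima → IsCycleMin π m
  minima-min m∈ = proj₂ (∈-filter⁻ (isCycleMin? π) {xs = allFin n} m∈)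

  orbit : Fin n → List (Fin n)
  orbit m = applyUpTo (λ k → iter π k m) (len m)

  ∈orbit⇒~ : ∀ {m j} → j ∈ orbit m → m ~ j
  ∈orbit⇒~ {m} j∈ with ∈-applyUpTo⁻ (λ k → iter π k m) j∈
  ... | k , _ , e = k , sym e

  ~⇒∈orbit : ∀ {m j} → m ~ j → j ∈ orbit m
  ~⇒∈orbit {m} (k , refl) with iter-mod k m
  ... | r , r<p , e = subst (_∈ orbit m) (sym e) (∈-applyUpTo⁺ (λ k → iter π k m) r<p)

  orbit-unique : ∀ m → Unique (orbit m)
  orbit-unique m = Unique.applyUpTo⁺₁ _ (len m) λ {i} {j} i<j j<p e →
    iter≢ m (j ℕ.∸ i) (ℕ.m<n⇒0<n∸m i<j) (ℕ.≤-<-trans (ℕ.m∸n≤m j i) j<p) (iter-∸ (ℕ.<⇒≤ i<j) e)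

  -- Both lists are free of duplicates and contain every point; distinct orbits are disjoint because
  -- a cycle has only one minimum. This is what groups a sum over points by cycles.
  orbits↭allFin : concatMap orbit minima ↭ allFin n
  orbits↭allFin = ∼bag⇒↭ (unique∧set⇒bag
    (Unique.concat⁺ (All.map⁺ (All.tabulate (λ {m} _ → orbit-unique m))) disjoint)
    (Unique.allFin⁺ n)
    (λ {j} → mk⇔ (λ _ → ∈-allFin j)
      (λ _ → ∈-concatMap⁺ orbit (lose (∈-filter⁺ (isCycleMin? π) (∈-allFin (rep j)) (rep-min j)) (~⇒∈orbit (rep~ j))))))
    where
    pairwise : ∀ {xs} → (∀ {m} → m ∈ xs → IsCycleMin π m) → Unique xs → AllPairs Disjoint (map orbit xs)
    pairwise min [] = []
    pairwise {x ∷ xs} min (x∉ ∷ u) =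
      All.map⁺ (All.tabulate λ {m} m∈ {j} (j∈x , j∈m) → All.lookup x∉ m∈
        (min-unique (min (here refl)) (min (there m∈)) (~-trans (∈orbit⇒~ j∈x) (~-sym (∈orbit⇒~ j∈m)))))
      ∷ pairwise (min ∘ there) u
    disjoint : AllPairs Disjoint (map orbit minima)
    disjoint = pairwise minima-min minima-unique

  cycleType : List ℕ
  cycleType = map len minima

-- Insertion of a point into a permutation

transpose-0-here : ∀ {n} (j : Fin n) → PC.transpose 0F (Fin.suc j) (Fin.suc j) ≡ 0F
transpose-0-here j rewrite dec-true (Fin.suc j Fin.≟ Fin.suc j) refl = refl

transpose-0-other : ∀ {n} {i j : Fin n} → i ≢ j → PC.transpose 0F (Fin.suc j) (Fin.suc i) ≡ Fin.suc i
transpose-0-other {i = i} {j} i≢j rewrite dec-false (Fin.suc i Fin.≟ Fin.suc j) (i≢j ∘ Fin.suc-injective) = refl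

0-min : ∀ {n} (π : Permutation′ (suc n)) → IsCycleMin π 0F
0-min π k = z≤n

-- Meant for `s = Fin.suc`: the minima of an enlarged permutation among the old points are the old
-- minima that pass `Q`, the condition of surviving the insertion.
map-filter-map : ∀ {A B C : Set} {P : A → Set} {P′ : B → Set} {Q : A → Set}
  (P? : ∀ x → Dec (P x)) (P′? : ∀ x → Dec (P′ x)) (Q? : ∀ x → Dec (Q x))
  {s : A → B} {f : A → C} {f′ : B → C} →
  (∀ {x} → P′ (s x) → P x × Q x) → (∀ {x} → P x → Q x → P′ (s x) × f′ (s x) ≡ f x) →
  ∀ xs → map f′ (filter P′? (map s xs)) ≡ map f (filter Q? (filter P? xs))
map-filter-map P? P′? Q? to from [] = refl
map-filter-map P? P′? Q? {s} {f} {f′} to from (x ∷ xs) with P? x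
... | no ¬p = trans (cong (map f′) (List.filter-reject P′? (¬p ∘ proj₁ ∘ to)))
                    (map-filter-map P? P′? Q? to from xs)
... | yes p with Q? x
...   | no ¬q = trans (cong (map f′) (List.filter-reject P′? (¬q ∘ proj₂ ∘ to)))
                      (map-filter-map P? P′? Q? to from xs)
...   | yes q = trans (cong (map f′) (List.filter-accept P′? (proj₁ (from p q))))
                      (cong₂ _∷_ (proj₂ (from p q)) (map-filter-map P? P′? Q? to from xs))

length-filter-× : ∀ {A B : Set} {P Q : A → Set} {R : B → Set}
  (P? : ∀ x → Dec (P x)) (Q? : ∀ x → Dec (Q x)) (R? : ∀ y → Dec (R y))
  {f : A → B} → (∀ {x} → Q x → R (f x)) → (∀ {x} → R (f x) → Q x) →
  ∀ xs → length (filter (λ x → P? x ×-dec Q? x) xs) ≡ length (filter R? (map f (filter P? xs)))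
length-filter-× P? Q? R? to from [] = refl
length-filter-× P? Q? R? {f} to from (x ∷ xs) with P? x
... | no ¬p = length-filter-× P? Q? R? to from xs
... | yes p with Q? x
...   | yes q = trans (cong suc (length-filter-× P? Q? R? to from xs))
                      (sym (cong length (List.filter-accept R? (to q))))
...   | no ¬q = trans (length-filter-× P? Q? R? to from xs)
                      (sym (cong length (List.filter-reject R? (¬q ∘ from))))

module _ {n} (ρ : Permutation′ n) (π : Permutation′ (suc n)) where
  private
    module ρ = Orbits ρ
    module π = Orbits π

  -- The new point `0F` is below all others, so it always represents its own cycle and heads the
  -- list; the remaining minima are successors.
  cycleType-suc : ∀ {Q : Fin n → Set} (Q? : ∀ i → Dec (Q i)) →
    (∀ {i} → IsCycleMin π (Fin.suc i) → IsCycleMin ρ i × Q i) →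
    (∀ {i} → IsCycleMin ρ i → Q i → IsCycleMin π (Fin.suc i) × π.len (Fin.suc i) ≡ ρ.len i) →
    π.cycleType ≡ π.len 0F ∷ map ρ.len (filter Q? ρ.minima)
  cycleType-suc {Q} Q? to from = trans
    (cong (map π.len) (List.filter-accept (isCycleMin? π) (0-min π)))
    (cong (π.len 0F ∷_) (trans
      (cong (map π.len ∘ filter (isCycleMin? π)) (sym (List.map-tabulate id Fin.suc)))
      (map-filter-map (isCycleMin? ρ) (isCycleMin? π) Q? to from (allFin n))))

  -- The old cycles that do not receive the new point.
  module Unaffected {i} (iter-suc : ∀ k → iter π k (Fin.suc i) ≡ Fin.suc (iter ρ k i)) where

    min⁺ : IsCycleMin ρ i → IsCycleMin π (Fin.suc i)
    min⁺ min k = subst (Fin.suc i Fin.≤_) (sym (iter-suc (toℕ k))) (s≤s (ρ.min-≤ min (toℕ k , refl)))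

    min⁻ : IsCycleMin π (Fin.suc i) → IsCycleMin ρ i
    min⁻ min k = ℕ.s≤s⁻¹ (π.min-≤ min (toℕ k , iter-suc (toℕ k)))

    len-suc : π.len (Fin.suc i) ≡ ρ.len i
    len-suc = π.len-unique (ρ.0<len i , trans (iter-suc (ρ.len i)) (cong Fin.suc (ρ.iter-len i)) ,
      λ k 0<k e → ρ.iter≢ i (toℕ k) 0<k (Fin.toℕ<n k)
        (Fin.suc-injective (trans (sym (iter-suc (toℕ k))) e)))

module _ {n} (ρ : Permutation′ n) where
  private module ρ = Orbits ρ

  cycleType-insert-0 : Orbits.cycleType (lift₀ ρ ∘ₚ transpose 0F 0F) ≡ 1 ∷ ρ.cycleType
  cycleType-insert-0 = trans
    (cycleType-suc ρ π (λ i → yes refl) (λ {i} min → Unaffected.min⁻ ρ π (iter-suc i) min , refl {x = i})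
      (λ {i} min _ → Unaffected.min⁺ ρ π (iter-suc i) min , Unaffected.len-suc ρ π (iter-suc i)))
    (cong₂ _∷_ (Orbits.len-unique π (s≤s z≤n , refl , λ { Fin.zero () }))
      (cong (map ρ.len) (List.filter-all _ (All.tabulate (λ _ → refl)))))
    where
    π = lift₀ ρ ∘ₚ transpose 0F 0F
    iter-suc : ∀ i k → iter π k (Fin.suc i) ≡ Fin.suc (iter ρ k i)
    iter-suc i zero    = refl
    iter-suc i (suc k) = cong (π ⟨$⟩ʳ_) (iter-suc i k)

  -- The new point lands between the preimage of `j` and `j`, so its orbit runs through the whole
  -- cycle of `j` before closing. The old minimum `rep j` is thereby superseded by `0F`, and no
  -- other cycle is touched.
  cycleType-insert : ∀ j → Orbits.cycleType (lift₀ ρ ∘ₚ transpose 0F (Fin.suc j)) ≡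
    suc (ρ.len j) ∷ map ρ.len (filter (λ m → ¬? (m Fin.≟ ρ.rep j)) ρ.minima)
  cycleType-insert j = trans
    (cycleType-suc ρ π (λ m → ¬? (m Fin.≟ ρ.rep j)) to from)
    (cong (_∷ map ρ.len (filter (λ m → ¬? (m Fin.≟ ρ.rep j)) ρ.minima)) (π.len-unique
      (s≤s z≤n , iter-0-p , λ { (Fin.suc k) _ e → 0≢suc (trans (sym e) (iter-0 (toℕ k) (Fin.toℕ<n k))) })))
    where
    π : Permutation′ (suc n)
    π = lift₀ ρ ∘ₚ transpose 0F (Fin.suc j)
    module π = Orbits π

    0≢suc : ∀ {i : Fin n} → 0F ≢ Fin.suc i
    0≢suc ()

    iter-0 : ∀ k → k ℕ.< ρ.len j → iter π (suc k) 0F ≡ Fin.suc (iter ρ k j)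
    iter-0 zero    _     = refl
    iter-0 (suc k) 1+k<p = trans (cong (π ⟨$⟩ʳ_) (iter-0 k (ℕ.<⇒≤ 1+k<p)))
      (transpose-0-other (ρ.iter≢ j (suc k) (s≤s z≤n) 1+k<p))

    iter-0-p : iter π (suc (ρ.len j)) 0F ≡ 0F
    iter-0-p with ρ.len j | ρ.0<len j | ρ.iter-len j | iter-0
    ... | suc q | _ | e | it = trans (cong (π ⟨$⟩ʳ_) (it q ℕ.≤-refl))
      (trans (cong (PC.transpose 0F (Fin.suc j) ∘ Fin.suc) e) (transpose-0-here j))

    iter-suc : ∀ {i} → ¬ (j ρ.~ i) → ∀ k → iter π k (Fin.suc i) ≡ Fin.suc (iter ρ k i)
    iter-suc ¬j~i zero    = refl
    iter-suc ¬j~i (suc k) = trans (cong (π ⟨$⟩ʳ_) (iter-suc ¬j~i k))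
      (transpose-0-other (λ e → ¬j~i (ρ.~-sym (suc k , e))))

    absorbed : ∀ {i} → j ρ.~ i → ¬ IsCycleMin π (Fin.suc i)
    absorbed (k , e) min with ρ.iter-mod k j
    ... | r , r<p , e′ = case π.min-≤ min (π.~-sym (suc r , trans (iter-0 r r<p) (cong Fin.suc (trans (sym e′) e)))) of λ ()

    to : ∀ {i} → IsCycleMin π (Fin.suc i) → IsCycleMin ρ i × i ≢ ρ.rep j
    to {i} min = Unaffected.min⁻ ρ π (iter-suc (λ j~i → absorbed j~i min)) min ,
      λ { refl → absorbed (ρ.~-sym (ρ.rep~ j)) min }

    from : ∀ {i} → IsCycleMin ρ i → i ≢ ρ.rep j → IsCycleMin π (Fin.suc i) × π.len (Fin.suc i) ≡ ρ.len i
    from {i} min i≢rep = Unaffected.min⁺ ρ π iter-suc′ min , Unaffected.len-suc ρ π iter-suc′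
      where
      iter-suc′ : ∀ k → iter π k (Fin.suc i) ≡ Fin.suc (iter ρ k i)
      iter-suc′ = iter-suc (λ j~i → i≢rep (sym (ρ.rep-unique min (ρ.~-sym j~i))))

#cycles≡length : ∀ {n} (π : Permutation′ n) → #cycles π ≡ length (Orbits.cycleType π)
#cycles≡length π = sym (List.length-map (Orbits.len π) (Orbits.minima π))

#cyclesOfLength≡count : ∀ {n} i (π : Permutation′ n) →
  #cyclesOfLength i π ≡ length (filter (i ℕ.≟_) (Orbits.cycleType π))
#cyclesOfLength≡count {n} i π =
  length-filter-× (isCycleMin? π) (λ j → cycleLength? π j i) (i ℕ.≟_)
    (λ c → sym (len-unique c)) (λ {j} e → subst (CycleLength π j) (sym e) (len-spec j)) (allFin n)
  where open Orbits π

module Analysis {c ℓ₁ ℓ₂} (ℝ : CompleteOrderedField c ℓ₁ ℓ₂) where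
  open Boltzmann ℝ
  open CommutativeRing commutativeRing using (ring; semiring; *-commutativeMonoid)
  open import Algebra.Properties.Ring ring using (-0#≈0#)
  import Algebra.Apartness.Properties.HeytingCommutativeRing heytingCommutativeRing as #
  import Algebra.Properties.Semiring.Mult semiring as Mult
  import Algebra.Properties.Semiring.Exp semiring as Exp
  open IntegerRingSolver commutativeRing
  module ≈-R = SetoidReasoning setoid

  -- Order

  <-resp : ∀ {x x′ y y′} → x ≈ x′ → y ≈ y′ → x < y → x′ < y′
  <-resp p q = proj₂ <-Order.<-resp-≈ p ∘ proj₁ <-Order.<-resp-≈ q

  <-trans : ∀ {x y z} → x < y → y < z → x < z
  <-trans = <-Order.trans

  <-irrefl : ∀ {x} → ¬ x < x
  <-irrefl = <-Order.irrefl ≈-refl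

  <-asym : ∀ {x y} → x < y → ¬ y < x
  <-asym p q = <-irrefl (<-trans p q)

  -- The constructive substitute for trichotomy: an arbitrary `z` can be compared with at least one
  -- end of a genuine gap. It comes from cotransitivity of apartness.
  <-cotrans : ∀ {x y} → x < y → ∀ z → x < z ⊎ z < y
  <-cotrans x<y z with #-cotrans (<⇒# x<y) z
  ... | inj₁ x#z = [ inj₁ , (λ z<x → inj₂ (<-trans z<x x<y)) ]′ (#⇒< x#z)
  ... | inj₂ z#y = [ inj₂ , (λ y<z → inj₁ (<-trans x<y y<z)) ]′ (#⇒< z#y)

  <⇒≤ : ∀ {x y} → x < y → x ≤ y
  <⇒≤ = <-asym

  ≤-reflexive : ∀ {x y} → x ≈ y → x ≤ y
  ≤-reflexive x≈y y<x = <-irrefl (<-resp ≈-refl x≈y y<x)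

  ≤-refl : ∀ {x} → x ≤ x
  ≤-refl = <-irrefl

  ≤-<-trans : ∀ {x y z} → x ≤ y → y < z → x < z
  ≤-<-trans {x} x≤y y<z = [ (λ y<x → ⊥-elim (x≤y y<x)) , (λ p → p) ]′ (<-cotrans y<z x)

  <-≤-trans : ∀ {x y z} → x < y → y ≤ z → x < z
  <-≤-trans {z = z} x<y y≤z = [ (λ p → p) , (λ z<y → ⊥-elim (y≤z z<y)) ]′ (<-cotrans x<y z)

  ≤-trans : ∀ {x y z} → x ≤ y → y ≤ z → x ≤ z
  ≤-trans x≤y y≤z z<x = x≤y (≤-<-trans y≤z z<x)

  ≤-resp : ∀ {x x′ y y′} → x ≈ x′ → y ≈ y′ → x ≤ y → x′ ≤ y′
  ≤-resp p q x≤y y′<x′ = x≤y (<-resp (≈-sym q) (≈-sym p) y′<x′)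

  ≤-antisym : ∀ {x y} → x ≤ y → y ≤ x → x ≈ y
  ≤-antisym x≤y y≤x = proj₁ (tight _ _) (λ x#y → [ y≤x , x≤y ]′ (#⇒< x#y))

  ≤-isPreorder : IsPreorder _≈_ _≤_
  ≤-isPreorder = record { isEquivalence = isEquivalence ; reflexive = ≤-reflexive ; trans = ≤-trans }

  module ≤-R = Triple {_≈_ = _≈_} {_≤_ = _≤_} {_<_ = _<_} ≤-isPreorder
    <-asym <-trans <-Order.<-resp-≈ <⇒≤ <-≤-trans ≤-<-trans

  -- Inequalities are derived from an identity y = x + d and the sign of d.

  <-by : ∀ {x y} d → 0# < d → y ≈ x + d → x < y
  <-by {x} d 0<d y≈x+d = <-resp (+-identityˡ x) (≈-trans (+-comm d x) (≈-sym y≈x+d)) (+-monoˡ-< x 0<d)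

  <⇒0<- : ∀ {x y} → x < y → 0# < y - x
  <⇒0<- {x} x<y = <-resp (-‿inverseʳ x) ≈-refl (+-monoˡ-< (- x) x<y)

  ≤-by : ∀ {x y} d → 0# ≤ d → y ≈ x + d → x ≤ y
  ≤-by {x} {y} d 0≤d y≈x+d y<x = 0≤d (<-resp
    (≈-trans (+-congʳ y≈x+d) (solve 2 (λ x d → (x :+ d) :- x := d) ≈-refl x d)) (-‿inverseʳ x)
    (+-monoˡ-< (- x) y<x))

  ≤⇒0≤- : ∀ {x y} → x ≤ y → 0# ≤ y - x
  ≤⇒0≤- {x} {y} x≤y y-x<0 = x≤y (<-resp
    (solve 2 (λ x y → (y :- x) :+ x := y) ≈-refl x y) (+-identityˡ x) (+-monoˡ-< x y-x<0))

  +-nonneg : ∀ {x y} → 0# ≤ x → 0# ≤ y → 0# ≤ x + y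
  +-nonneg {x} {y} 0≤x 0≤y = ≤-trans 0≤x (≤-by y 0≤y ≈-refl)

  +-pos : ∀ {x y} → 0# < x → 0# < y → 0# < x + y
  +-pos {x} {y} 0<x 0<y = <-trans 0<x (<-by y 0<y ≈-refl)

  +-pos-nonneg : ∀ {x y} → 0# < x → 0# ≤ y → 0# < x + y
  +-pos-nonneg {x} {y} 0<x 0≤y = <-≤-trans 0<x (≤-by y 0≤y ≈-refl)

  +-mono-≤ : ∀ {x y u v} → x ≤ y → u ≤ v → x + u ≤ y + v
  +-mono-≤ {x} {y} {u} {v} p q = ≤-by _ (+-nonneg (≤⇒0≤- p) (≤⇒0≤- q))
    (solve 4 (λ x y u v → y :+ v := x :+ u :+ (y :- x :+ (v :- u))) ≈-refl x y u v)

  +-mono-< : ∀ {x y u v} → x < y → u < v → x + u < y + v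
  +-mono-< {x} {y} {u} {v} p q = <-by _ (+-pos (<⇒0<- p) (<⇒0<- q))
    (solve 4 (λ x y u v → y :+ v := x :+ u :+ (y :- x :+ (v :- u))) ≈-refl x y u v)

  +-monoˡ-≤ : ∀ {x y} z → x ≤ y → x + z ≤ y + z
  +-monoˡ-≤ z p = +-mono-≤ p ≤-refl

  +-monoʳ-≤ : ∀ {x y} z → x ≤ y → z + x ≤ z + y
  +-monoʳ-≤ z p = +-mono-≤ ≤-refl p

  +-monoʳ-< : ∀ {x y} z → x < y → z + x < z + y
  +-monoʳ-< z p = <-resp (+-comm _ z) (+-comm _ z) (+-monoˡ-< z p)

  x-0#≈x : ∀ x → x - 0# ≈ x
  x-0#≈x x = ≈-trans (+-congˡ -0#≈0#) (+-identityʳ x)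

  -- In a Heyting field being apart from zero is being invertible, and a factor of a unit is a unit.
  *#0⇒#0 : ∀ {x y} → x * y # 0# → x # 0#
  *#0⇒#0 {x} {y} xy#0 with #⇒invertible xy#0
  ... | z , z*[xy-0]≈1 , _ = #.invertibleˡ⇒# (z * y , (begin
    z * y * (x - 0#)  ≈⟨ *-congˡ (x-0#≈x x) ⟩
    z * y * x         ≈⟨ solve 3 (λ x y z → z :* y :* x := z :* (x :* y)) ≈-refl x y z ⟩
    z * (x * y)       ≈⟨ *-congˡ (x-0#≈x _) ⟨
    z * (x * y - 0#)  ≈⟨ z*[xy-0]≈1 ⟩
    1#                ∎))
    where open ≈-R

  #0∧nonneg⇒pos : ∀ {x} → x # 0# → 0# ≤ x → 0# < x
  #0∧nonneg⇒pos x#0 0≤x = [ (λ x<0 → ⊥-elim (0≤x x<0)) , (λ p → p) ]′ (#⇒< x#0)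

  -- The claim is a negation, so `x * y < 0#` may be assumed. Then both factors are apart from zero,
  -- hence positive, and so is the product.
  *-nonneg : ∀ {x y} → 0# ≤ x → 0# ≤ y → 0# ≤ x * y
  *-nonneg {x} {y} 0≤x 0≤y xy<0 = <-asym xy<0 (*-pos
    (#0∧nonneg⇒pos (*#0⇒#0 (<⇒# xy<0)) 0≤x)
    (#0∧nonneg⇒pos (*#0⇒#0 (#.#-congʳ (*-comm x y) (<⇒# xy<0))) 0≤y))

  *-monoʳ-≤ : ∀ {x y} z → 0# ≤ z → x ≤ y → z * x ≤ z * y
  *-monoʳ-≤ {x} {y} z 0≤z x≤y = ≤-by _ (*-nonneg 0≤z (≤⇒0≤- x≤y))
    (solve 3 (λ x y z → z :* y := z :* x :+ z :* (y :- x)) ≈-refl x y z)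

  *-monoʳ-< : ∀ {x y} z → 0# < z → x < y → z * x < z * y
  *-monoʳ-< {x} {y} z 0<z x<y = <-by _ (*-pos 0<z (<⇒0<- x<y))
    (solve 3 (λ x y z → z :* y := z :* x :+ z :* (y :- x)) ≈-refl x y z)

  *-monoˡ-≤ : ∀ {x y} z → 0# ≤ z → x ≤ y → x * z ≤ y * z
  *-monoˡ-≤ z 0≤z x≤y = ≤-resp (*-comm z _) (*-comm z _) (*-monoʳ-≤ z 0≤z x≤y)

  *-monoˡ-< : ∀ {x y} z → 0# < z → x < y → x * z < y * z
  *-monoˡ-< z 0<z x<y = <-resp (*-comm z _) (*-comm z _) (*-monoʳ-< z 0<z x<y)

  *-mono-≤ : ∀ {x y u v} → 0# ≤ x → 0# ≤ v → x ≤ y → u ≤ v → x * u ≤ y * v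
  *-mono-≤ {x} {v = v} 0≤x 0≤v x≤y u≤v = ≤-trans (*-monoʳ-≤ x 0≤x u≤v) (*-monoˡ-≤ v 0≤v x≤y)

  *-cancelˡ-≤ : ∀ {x y} z → 0# < z → z * x ≤ z * y → x ≤ y
  *-cancelˡ-≤ z 0<z zx≤zy y<x = zx≤zy (*-monoʳ-< z 0<z y<x)

  *-cancelˡ-≈ : ∀ {x y} z → 0# < z → z * x ≈ z * y → x ≈ y
  *-cancelˡ-≈ z 0<z e = ≤-antisym
    (*-cancelˡ-≤ z 0<z (≤-reflexive e)) (*-cancelˡ-≤ z 0<z (≤-reflexive (≈-sym e)))

  0≤1 : 0# ≤ 1#
  0≤1 = <⇒≤ 0<1

  pos⇒#0 : ∀ {x} → 0# < x → x # 0#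
  pos⇒#0 = #-sym ∘ <⇒#

  x*x⁻¹≈1 : ∀ {x} (x#0 : x # 0#) → x * x ⁻¹[ x#0 ] ≈ 1#
  x*x⁻¹≈1 {x} x#0 = ≈-trans (*-congʳ (≈-sym (x-0#≈x x))) (proj₂ (proj₂ (#⇒invertible x#0)))

  ⁻¹-pos : ∀ {x} (x#0 : x # 0#) → 0# < x → 0# < x ⁻¹[ x#0 ]
  ⁻¹-pos {x} x#0 0<x = #0∧nonneg⇒pos
    (*#0⇒#0 {y = x} (pos⇒#0 (<-resp ≈-refl (≈-sym (≈-trans (*-comm _ x) (x*x⁻¹≈1 x#0))) 0<1)))
    (λ p → <-asym 0<1 (<-resp (x*x⁻¹≈1 x#0) (zeroʳ x) (*-monoʳ-< x 0<x p)))

  *-cancelˡ-< : ∀ {x y} z → 0# < z → z * x < z * y → x < y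
  *-cancelˡ-< {x} {y} z 0<z zx<zy = <-resp (cancel x) (cancel y) (*-monoʳ-< z⁻¹ (⁻¹-pos _ 0<z) zx<zy)
    where
    z⁻¹ = z ⁻¹[ pos⇒#0 0<z ]
    cancel : ∀ w → z⁻¹ * (z * w) ≈ w
    cancel w = ≈-trans (solve 3 (λ i z w → i :* (z :* w) := z :* i :* w) ≈-refl z⁻¹ z w)
      (≈-trans (*-congʳ (x*x⁻¹≈1 _)) (*-identityˡ w))

  -- Natural numbers

  fromℕ-* : ∀ m n → fromℕ (m ℕ.* n) ≈ fromℕ m * fromℕ n
  fromℕ-* = Mult.×1-homo-*

  fromℕ-1 : fromℕ 1 ≈ 1#
  fromℕ-1 = +-identityʳ 1#

  fromℕ-nonneg : ∀ n → 0# ≤ fromℕ n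
  fromℕ-nonneg zero    = ≤-refl
  fromℕ-nonneg (suc n) = <⇒≤ (fromℕ-pos n)

  fromℕ-mono-≤ : ∀ {m n} → m ℕ.≤ n → fromℕ m ≤ fromℕ n
  fromℕ-mono-≤ {n = n} z≤n = fromℕ-nonneg n
  fromℕ-mono-≤ (s≤s m≤n)   = +-monoʳ-≤ 1# (fromℕ-mono-≤ m≤n)

  n*1/n≈1 : ∀ n .{{_ : NonZero n}} → fromℕ n * 1/ n ≈ 1#
  n*1/n≈1 n = x*x⁻¹≈1 (fromℕ#0 n)

  1/-pos : ∀ n .{{_ : NonZero n}} → 0# < 1/ n
  1/-pos (suc n) = ⁻¹-pos _ (fromℕ-pos n)

  n!*1/!n≈1 : ∀ n → fromℕ (n !) * 1/! n ≈ 1#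
  n!*1/!n≈1 n = n*1/n≈1 (n !) {{n ℕ.!≢0}}

  1/!-pos : ∀ n → 0# < 1/! n
  1/!-pos n = 1/-pos (n !) {{n ℕ.!≢0}}

  n!-pos : ∀ n → 0# < fromℕ (n !)
  n!-pos n = #0∧nonneg⇒pos (fromℕ#0 (n !) {{n ℕ.!≢0}}) (fromℕ-nonneg (n !))

  1/!-0 : 1/! 0 ≈ 1#
  1/!-0 = *-cancelˡ-≈ (fromℕ 1) (fromℕ-pos 0)
    (≈-trans (n!*1/!n≈1 0) (≈-sym (≈-trans (*-identityʳ _) fromℕ-1)))

  1/!-suc : ∀ n → fromℕ (suc n) * 1/! (suc n) ≈ 1/! n
  1/!-suc n = *-cancelˡ-≈ (fromℕ (n !)) (n!-pos n) (begin
    fromℕ (n !) * (fromℕ (suc n) * 1/! (suc n))  ≈⟨ solve 3 (λ a b c → a :* (b :* c) := b :* a :* c) ≈-refl _ _ _ ⟩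
    fromℕ (suc n) * fromℕ (n !) * 1/! (suc n)    ≈⟨ *-congʳ (fromℕ-* (suc n) (n !)) ⟨
    fromℕ (suc n !) * 1/! (suc n)                ≈⟨ n!*1/!n≈1 (suc n) ⟩
    1#                                           ≈⟨ n!*1/!n≈1 n ⟨
    fromℕ (n !) * 1/! n                          ∎)
    where open ≈-R

  opaque
    halve : ∀ ε → 0# < ε → ∃ λ δ → 0# < δ × δ + δ ≈ ε
    halve ε 0<ε = h * ε , *-pos (1/-pos 2) 0<ε , (begin
      h * ε + h * ε            ≈⟨ double h ε ⟩
      (fromℕ 2 * h) * ε        ≈⟨ *-congʳ (n*1/n≈1 2) ⟩
      1# * ε                   ≈⟨ *-identityˡ ε ⟩
      ε                        ∎)
      where
      open ≈-R
      h : Carrier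
      h = 1/ 2
      double : ∀ x y → x * y + x * y ≈ fromℕ 2 * x * y
      double = solve 2 (λ x y → x :* y :+ x :* y := (𝟙 :+ (𝟙 :+ 𝟘)) :* x :* y) ≈-refl

  ≤-from-ε : ∀ {x y} → (∀ ε → 0# < ε → x ≤ y + ε) → x ≤ y
  ≤-from-ε {x} {y} x≤y+ε y<x =
    let δ , 0<δ , δ+δ≈x-y = halve (x - y) (<⇒0<- y<x) in
    x≤y+ε δ 0<δ (<-by δ 0<δ (begin
    x                  ≈⟨ solve 2 (λ x y → x := y :+ (x :- y)) ≈-refl x y ⟩
    y + (x - y)        ≈⟨ +-congˡ δ+δ≈x-y ⟨
    y + (δ + δ)        ≈⟨ +-assoc y δ δ ⟨
    y + δ + δ          ∎))
    where open ≈-R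

  ^-nonneg : ∀ {x} n → 0# ≤ x → 0# ≤ x ^ n
  ^-nonneg zero    0≤x = 0≤1
  ^-nonneg (suc n) 0≤x = *-nonneg 0≤x (^-nonneg n 0≤x)

  ^-mono-≤ : ∀ {x y} n → 0# ≤ x → x ≤ y → x ^ n ≤ y ^ n
  ^-mono-≤ zero    0≤x x≤y = ≤-refl
  ^-mono-≤ (suc n) 0≤x x≤y = *-mono-≤ 0≤x (^-nonneg n (≤-trans 0≤x x≤y)) x≤y (^-mono-≤ n 0≤x x≤y)

  -- Finite sums

  -- ∑< and HasSum unfold to terms from which the summand cannot be inferred by
  -- unification; ∑ and Sums are rigid copies of them.
  opaque
    ∑ : ℕ → (ℕ → Carrier) → Carrier
    ∑ = ∑<

    ∑≡∑< : ∀ n a → ∑ n a ≡ ∑< n a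
    ∑≡∑< n a = ≡.refl

    ∑-0 : ∀ a → ∑ 0 a ≈ 0#
    ∑-0 a = ≈-refl

    ∑-suc : ∀ n a → ∑ (suc n) a ≈ a 0 + ∑ n (a ∘ suc)
    ∑-suc n a = ≈-refl

    ∑-cong : ∀ n {a b} → (∀ i → a i ≈ b i) → ∑ n a ≈ ∑ n b
    ∑-cong zero    a≈b = ≈-refl
    ∑-cong (suc n) a≈b = +-cong (a≈b 0) (∑-cong n (a≈b ∘ suc))

    ∑-cong< : ∀ n {a b} → (∀ i → i ℕ.< n → a i ≈ b i) → ∑ n a ≈ ∑ n b
    ∑-cong< zero    a≈b = ≈-refl
    ∑-cong< (suc n) a≈b = +-cong (a≈b 0 (s≤s z≤n)) (∑-cong< n (λ i i<n → a≈b (suc i) (s≤s i<n)))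

    ∑-last : ∀ n a → ∑ (suc n) a ≈ ∑ n a + a n
    ∑-last zero    a = +-comm _ _
    ∑-last (suc n) a = ≈-trans (+-congˡ (∑-last n (a ∘ suc))) (≈-sym (+-assoc _ _ _))

    ∑-zero : ∀ n → ∑ n (λ _ → 0#) ≈ 0#
    ∑-zero zero    = ≈-refl
    ∑-zero (suc n) = ≈-trans (+-identityˡ _) (∑-zero n)

    ∑-+ : ∀ n a b → ∑ n (λ i → a i + b i) ≈ ∑ n a + ∑ n b
    ∑-+ zero    a b = ≈-sym (+-identityˡ 0#)
    ∑-+ (suc n) a b = ≈-trans (+-congˡ (∑-+ n (a ∘ suc) (b ∘ suc)))
      (solve 4 (λ p q r s → p :+ q :+ (r :+ s) := p :+ r :+ (q :+ s)) ≈-refl _ _ _ _)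

    ∑-*ˡ : ∀ n x a → ∑ n (λ i → x * a i) ≈ x * ∑ n a
    ∑-*ˡ zero    x a = ≈-sym (zeroʳ x)
    ∑-*ˡ (suc n) x a = ≈-trans (+-congˡ (∑-*ˡ n x (a ∘ suc))) (≈-sym (distribˡ x _ _))

    ∑-comm : ∀ m n (a : ℕ → ℕ → Carrier) →
      ∑ m (λ i → ∑ n (a i)) ≈ ∑ n (λ j → ∑ m (λ i → a i j))
    ∑-comm zero    n a = ≈-sym (∑-zero n)
    ∑-comm (suc m) n a = ≈-trans (+-congˡ (∑-comm m n (a ∘ suc))) 
      (≈-sym (∑-+ n (a 0) (λ j → ∑ m (λ i → a (suc i) j))))

    ∑-mono-≤ : ∀ n {a b} → (∀ i → a i ≤ b i) → ∑ n a ≤ ∑ n b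
    ∑-mono-≤ zero    a≤b = ≤-refl
    ∑-mono-≤ (suc n) a≤b = +-mono-≤ (a≤b 0) (∑-mono-≤ n (a≤b ∘ suc))

    ∑-nonneg : ∀ n {a} → (∀ i → 0# ≤ a i) → 0# ≤ ∑ n a
    ∑-nonneg zero    0≤a = ≤-refl
    ∑-nonneg (suc n) 0≤a = +-nonneg (0≤a 0) (∑-nonneg n (0≤a ∘ suc))

    ∑-++ : ∀ m k a → ∑ (m ℕ.+ k) a ≈ ∑ m a + ∑ k (λ i → a (m ℕ.+ i))
    ∑-++ zero    k a = ≈-sym (+-identityˡ _)
    ∑-++ (suc m) k a = ≈-trans (+-congˡ (∑-++ m k (a ∘ suc))) (≈-sym (+-assoc _ _ _))

  ∑-split : ∀ {m n} a → m ℕ.≤ n → ∃ λ k → ∑ n a ≈ ∑ m a + ∑ k (λ i → a (m ℕ.+ i))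
  ∑-split {m} {n} a m≤n = n ℕ.∸ m ,
    ≈-trans (reflexive (≡.cong (λ k → ∑ k a) (≡.sym (ℕ.m+[n∸m]≡n m≤n)))) (∑-++ m (n ℕ.∸ m) a)

  ∑-mono-range : ∀ {m n} {a} → (∀ i → 0# ≤ a i) → m ℕ.≤ n → ∑ m a ≤ ∑ n a
  ∑-mono-range {m} {a = a} 0≤a m≤n with ∑-split a m≤n
  ... | k , e = ≤-by _ (∑-nonneg k (λ i → 0≤a (m ℕ.+ i))) e

  -- Limits

  ⟶-cong : ∀ {a b l m} → (∀ n → a n ≈ b n) → l ≈ m → a ⟶ l → b ⟶ m
  ⟶-cong a≈b l≈m a⟶l ε 0<ε =
    let M , close = a⟶l ε 0<ε in
    M , λ n M≤n → let p , q = close n M≤n in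
      <-resp (a≈b n) (+-congʳ l≈m) p , <-resp l≈m (+-congʳ (a≈b n)) q

  ⟶-upper : ∀ {a l B} M → (∀ n → M ℕ.≤ n → a n ≤ B) → a ⟶ l → l ≤ B
  ⟶-upper {a} {l} {B} M a≤B a⟶l = ≤-from-ε λ ε 0<ε →
    let M′ , close = a⟶l ε 0<ε
        n = M ℕ.⊔ M′
    in <⇒≤ (<-≤-trans (proj₂ (close n (ℕ.m≤n⊔m M M′))) (+-monoˡ-≤ ε (a≤B n (ℕ.m≤m⊔n M M′))))

  ⟶-lower : ∀ {a l B} M → (∀ n → M ℕ.≤ n → B ≤ a n) → a ⟶ l → B ≤ l
  ⟶-lower {a} {l} {B} M B≤a a⟶l = ≤-from-ε λ ε 0<ε →
    let M′ , close = a⟶l ε 0<ε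
        n = M ℕ.⊔ M′
    in <⇒≤ (≤-<-trans (B≤a n (ℕ.m≤m⊔n M M′)) (proj₁ (close n (ℕ.m≤n⊔m M M′))))

  ⟶-+ : ∀ {a b l m} → a ⟶ l → b ⟶ m → (λ n → a n + b n) ⟶ l + m
  ⟶-+ {a} {b} {l} {m} a⟶l b⟶m ε 0<ε =
    let δ , 0<δ , δ+δ≈ε = halve ε 0<ε
        M , close = a⟶l δ 0<δ
        M′ , close′ = b⟶m δ 0<δ
        regroup : ∀ x y → x + δ + (y + δ) ≈ x + y + ε
        regroup x y = ≈-trans (solve 3 (λ x y d → x :+ d :+ (y :+ d) := x :+ y :+ (d :+ d)) ≈-refl x y δ)
                              (+-congˡ δ+δ≈ε)
    in M ℕ.⊔ M′ , λ n M≤n →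
      let p , q = close n (ℕ.≤-trans (ℕ.m≤m⊔n M M′) M≤n)
          p′ , q′ = close′ n (ℕ.≤-trans (ℕ.m≤n⊔m M M′) M≤n)
      in <-resp ≈-refl (regroup l m) (+-mono-< p p′) , <-resp ≈-refl (regroup (a n) (b n)) (+-mono-< q q′)

  ⟶-neg : ∀ {a l} → a ⟶ l → (λ n → - a n) ⟶ - l
  ⟶-neg {a} {l} a⟶l ε 0<ε =
    let M , close = a⟶l ε 0<ε in
    M , λ n M≤n → let p , q = close n M≤n in flip q , flip p
    where
    flip : ∀ {x y} → x < y + ε → - y < - x + ε
    flip {x} {y} p = <-by _ (<⇒0<- p)
      (solve 3 (λ x y e → :- x :+ e := :- y :+ (y :+ e :- x)) ≈-refl x y ε)

  ⟶-unique : ∀ {a l m} → a ⟶ l → a ⟶ m → l ≈ m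
  ⟶-unique p q = ≤-antisym (le p q) (le q p)
    where
    le : ∀ {a l m} → a ⟶ l → a ⟶ m → l ≤ m
    le {a} {l} {m} a⟶l a⟶m = ≤-from-ε λ ε 0<ε →
      let δ , 0<δ , δ+δ≈ε = halve ε 0<ε
          M , close = a⟶l δ 0<δ
          M′ , close′ = a⟶m δ 0<δ
          n = M ℕ.⊔ M′
      in <⇒≤ (<-trans (proj₂ (close n (ℕ.m≤m⊔n M M′)))
           (<-resp ≈-refl (≈-trans (+-assoc m δ δ) (+-congˡ δ+δ≈ε))
             (+-monoˡ-< δ (proj₁ (close′ n (ℕ.m≤n⊔m M M′))))))

  ⟶-const : ∀ x → (λ _ → x) ⟶ x
  ⟶-const x ε 0<ε = 0 , λ _ _ → <-by ε 0<ε ≈-refl , <-by ε 0<ε ≈-refl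

  ⟶-*ˡ : ∀ {a l} x → 0# ≤ x → a ⟶ l → (λ n → x * a n) ⟶ x * l
  ⟶-*ˡ {a} {l} x 0≤x a⟶l ε 0<ε =
    let K , x<K = archimedean x
        0<K = ≤-<-trans 0≤x x<K
        K⁻¹ = fromℕ K ⁻¹[ pos⇒#0 0<K ]
        0<δ = *-pos 0<ε (⁻¹-pos (pos⇒#0 0<K) 0<K)
        M , close = a⟶l (ε * K⁻¹) 0<δ
        scale : ∀ {u v} → u < v + ε * K⁻¹ → x * u < x * v + ε
        scale {u} {v} p = ≤-<-trans (*-monoʳ-≤ x 0≤x (<⇒≤ p)) (<-resp
          (≈-sym (distribˡ x v _))
          (+-congˡ (≈-trans (solve 3 (λ k e i → k :* (e :* i) := e :* (k :* i)) ≈-refl (fromℕ K) ε K⁻¹)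
            (≈-trans (*-congˡ (x*x⁻¹≈1 _)) (*-identityʳ ε))))
          (+-monoʳ-< (x * v) (*-monoˡ-< (ε * K⁻¹) 0<δ x<K)))
    in M , λ n M≤n → let p , q = close n M≤n in scale p , scale q

  -- Series

  record Sums (a : ℕ → Carrier) (s : Carrier) : Set (c ⊔ ℓ₂) where
    constructor sums
    field partialSums : (λ n → ∑ n a) ⟶ s
  open Sums

  HasSum⇒Sums : ∀ {a s} → HasSum a s → Sums a s
  HasSum⇒Sums {a} p = sums (⟶-cong (λ n → reflexive (≡.sym (∑≡∑< n a))) ≈-refl p)

  Sums⇒HasSum : ∀ {a s} → Sums a s → HasSum a s
  Sums⇒HasSum {a} p = ⟶-cong (λ n → reflexive (∑≡∑< n a)) ≈-refl (partialSums p)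

  Sums-cong : ∀ {a b s t} → (∀ n → a n ≈ b n) → s ≈ t → Sums a s → Sums b t
  Sums-cong a≈b s≈t (sums p) = sums (⟶-cong (λ n → ∑-cong n a≈b) s≈t p)

  Sums-unique : ∀ {a s t} → Sums a s → Sums a t → s ≈ t
  Sums-unique (sums p) (sums q) = ⟶-unique p q

  Sums-+ : ∀ {a b s t} → Sums a s → Sums b t → Sums (λ n → a n + b n) (s + t)
  Sums-+ {a} {b} (sums p) (sums q) = sums (⟶-cong (λ n → ≈-sym (∑-+ n a b)) ≈-refl (⟶-+ p q))

  Sums-*ˡ : ∀ {a s} x → 0# ≤ x → Sums a s → Sums (λ n → x * a n) (x * s)
  Sums-*ˡ {a} x 0≤x (sums p) = sums (⟶-cong (λ n → ≈-sym (∑-*ˡ n x a)) ≈-refl (⟶-*ˡ x 0≤x p))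

  Sums-cancel-+ : ∀ {a b s t} → Sums (λ n → a n + b n) (s + t) → Sums b t → Sums a s
  Sums-cancel-+ {a} {b} {s} {t} (sums p) (sums q) = sums (⟶-cong
    (λ n → ≈-trans (+-congʳ (∑-+ n a b)) (cancel (∑ n a) (∑ n b))) (cancel s t) (⟶-+ p (⟶-neg q)))
    where
    cancel : ∀ x y → x + y - y ≈ x
    cancel = solve 2 (λ x y → x :+ y :- y := x) ≈-refl

  Sums-suc : ∀ {a s} → Sums (a ∘ suc) s → Sums a (a 0 + s)
  Sums-suc {a} {s} (sums p) = sums λ ε 0<ε →
    let M , close = p ε 0<ε in
    suc M , λ { (suc n) (s≤s M≤n) → let q , r = close n M≤n in
      <-resp (≈-sym (∑-suc n a)) (≈-sym (+-assoc _ _ _)) (+-monoʳ-< (a 0) q) ,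
      <-resp ≈-refl (≈-trans (≈-sym (+-assoc _ _ _)) (+-congʳ (≈-sym (∑-suc n a)))) (+-monoʳ-< (a 0) r) }

  Sums-mono-≤ : ∀ {a b s t} → (∀ n → a n ≤ b n) → Sums a s → Sums b t → s ≤ t
  Sums-mono-≤ {a} {b} {s} {t} a≤b (sums p) (sums q) = ≤-resp (+-identityˡ s)
    (solve 2 (λ s t → t :- s :+ s := t) ≈-refl s t)
    (+-monoˡ-≤ s (⟶-lower 0 (λ n _ → ≤⇒0≤- (∑-mono-≤ n a≤b)) (⟶-+ q (⟶-neg p))))

  ∑≤Sums : ∀ {a s} → (∀ n → 0# ≤ a n) → Sums a s → ∀ n → ∑ n a ≤ s
  ∑≤Sums 0≤a (sums p) n = ⟶-lower n (λ m n≤m → ∑-mono-range 0≤a n≤m) p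

  Sums-nonneg : ∀ {a s} → (∀ n → 0# ≤ a n) → Sums a s → 0# ≤ s
  Sums-nonneg 0≤a p = ≤-resp (∑-0 _) ≈-refl (∑≤Sums 0≤a p 0)

  -- Partial sums increase, so one index within ε of the bound serves as a modulus for all later
  -- ones; completeness is not invoked.
  Sums-sup : ∀ {a s} → (∀ n → 0# ≤ a n) → (∀ n → ∑ n a ≤ s) →
               (∀ ε → 0# < ε → ∃ λ n → s < ∑ n a + ε) → Sums a s
  Sums-sup {a} {s} 0≤a ub approx = sums λ ε 0<ε →
    let M , s<∑+ε = approx ε 0<ε in
    M , λ n M≤n → ≤-<-trans (ub n) (<-by ε 0<ε ≈-refl) ,
                  <-≤-trans s<∑+ε (+-monoˡ-≤ ε (∑-mono-range 0≤a M≤n))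

  comparison-test : ∀ {a b s} → (∀ n → 0# ≤ a n) → (∀ n → a n ≤ b n) → Sums b s → ∃ (Sums a)
  comparison-test {a} {b} {s} 0≤a a≤b p =
    let t , a⟶t = complete (λ n → ∑ n a) cauchy in t , sums a⟶t
    where
    0≤b : ∀ n → 0# ≤ b n
    0≤b n = ≤-trans (0≤a n) (a≤b n)

    -- The block of `a` from M to n is at most the entire tail of `b` after M; written additively to
    -- avoid differences.
    tail : ∀ {M n} → M ℕ.≤ n → ∑ n a + ∑ M b ≤ ∑ M a + s
    tail {M} {n} M≤n =
      let k , e = ∑-split a M≤n
      in ≤-trans (≤-resp (≈-sym (≈-trans (+-congʳ e) (+-assoc _ _ _))) ≈-refl (+-monoʳ-≤ (∑ M a)
           (≤-resp (+-comm _ _) (≈-sym (∑-++ M k b)) (+-monoʳ-≤ (∑ M b) (∑-mono-≤ k (λ i → a≤b (M ℕ.+ i)))))))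
           (+-monoʳ-≤ (∑ M a) (∑≤Sums 0≤b p (M ℕ.+ k)))

    cauchy : IsCauchy (λ n → ∑ n a)
    cauchy ε 0<ε =
      let M , close = partialSums p ε 0<ε
          s<∑b+ε = proj₂ (close M ℕ.≤-refl)
          gap : ∀ m n → M ℕ.≤ m → M ℕ.≤ n → ∑ m a < ∑ n a + ε
          gap m n M≤m M≤n = <-≤-trans
            (<-by _ (+-pos-nonneg (<⇒0<- s<∑b+ε) (≤⇒0≤- (tail M≤m)))
              (solve 5 (λ am bM aM s e → aM :+ e := am :+ (bM :+ e :- s :+ (aM :+ s :- (am :+ bM)))) ≈-refl
                (∑ m a) (∑ M b) (∑ M a) s ε))
            (+-monoˡ-≤ ε (∑-mono-range 0≤a M≤n))
      in M , λ m n M≤m M≤n → gap m n M≤m M≤n , gap n m M≤n M≤m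

  ⟶-∑ : ∀ {f : ℕ → ℕ → Carrier} {l} R → (∀ r → f r ⟶ l r) → (λ n → ∑ R (λ r → f r n)) ⟶ ∑ R l
  ⟶-∑ zero    p = ⟶-cong (λ n → ≈-sym (∑-0 _)) (≈-sym (∑-0 _)) (⟶-const 0#)
  ⟶-∑ (suc R) p = ⟶-cong (λ n → ≈-sym (∑-suc R _)) (≈-sym (∑-suc R _)) (⟶-+ (p 0) (⟶-∑ R (p ∘ suc)))

  ∑-truncate : ∀ {m n a} → m ℕ.< n → (∀ i → m ℕ.< i → a i ≈ 0#) → ∑ n a ≈ ∑ (suc m) a
  ∑-truncate {m} {n} {a} m<n a≈0 =
    let k , e = ∑-split a m<n in begin
    ∑ n a                                            ≈⟨ e ⟩
    ∑ (suc m) a + ∑ k (λ i → a (suc m ℕ.+ i))        ≈⟨ +-congˡ (∑-cong k (λ i → a≈0 _ (s≤s (ℕ.m≤m+n m i)))) ⟩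
    ∑ (suc m) a + ∑ k (λ _ → 0#)                     ≈⟨ +-congˡ (∑-zero k) ⟩
    ∑ (suc m) a + 0#                                 ≈⟨ +-identityʳ _ ⟩
    ∑ (suc m) a                                      ∎
    where open ≈-R

  -- Tonelli's theorem for a lower triangular array.
  Sums-triangular : ∀ {a : ℕ → ℕ → Carrier} {A z} → (∀ r n → 0# ≤ a r n) →
    (∀ r n → n ℕ.< r → a r n ≈ 0#) → (∀ r → Sums (a r) (A r)) → Sums A z →
    Sums (λ n → ∑ (suc n) (λ r → a r n)) z
  Sums-triangular {a} {A} {z} 0≤a upper≈0 rows total = Sums-sup
    (λ n → ∑-nonneg (suc n) (λ r → 0≤a r n))
    (λ N → ≤-resp (≈-sym (square N)) ≈-refl
      (≤-trans (∑-mono-≤ N (λ r → ∑≤Sums (0≤a r) (rows r) N)) (∑≤Sums 0≤A total N)))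
    approx
    where
    0≤A : ∀ r → 0# ≤ A r
    0≤A r = Sums-nonneg (0≤a r) (rows r)

    column : ∀ N n → n ℕ.< N → ∑ (suc n) (λ r → a r n) ≈ ∑ N (λ r → a r n)
    column N n n<N = ≈-sym (∑-truncate n<N (λ r n<r → upper≈0 r n n<r))

    square : ∀ N → ∑ N (λ n → ∑ (suc n) (λ r → a r n)) ≈ ∑ N (λ r → ∑ N (a r))
    square N = ≈-trans (∑-cong< N (column N)) (∑-comm N N (λ n r → a r n))

    approx : ∀ ε → 0# < ε → ∃ λ n → z < ∑ n (λ n → ∑ (suc n) (λ r → a r n)) + ε
    approx ε 0<ε =
      -- One half of ε pays for the rows beyond R, the other for cutting the first R rows at N.
      -- Taking N ≥ R puts those rows inside the square.
      let δ , 0<δ , δ+δ≈ε = halve ε 0<ε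
          R , close = partialSums total δ 0<δ
          M , close′ = ⟶-∑ R (partialSums ∘ rows) δ 0<δ
          N = R ℕ.⊔ M
          ∑A<∑∑a+δ : ∑ R A < ∑ R (λ r → ∑ N (a r)) + δ
          ∑A<∑∑a+δ = proj₂ (close′ N (ℕ.m≤n⊔m R M))
          enlarge : ∑ R (λ r → ∑ N (a r)) ≤ ∑ N (λ r → ∑ N (a r))
          enlarge = ∑-mono-range (λ r → ∑-nonneg N (0≤a r)) (ℕ.m≤m⊔n R M)
      in N , <-resp ≈-refl (≈-trans (+-assoc _ δ δ) (+-cong (≈-sym (square N)) δ+δ≈ε))
        (<-trans (proj₂ (close R ℕ.≤-refl))
          (+-monoˡ-< δ (<-≤-trans ∑A<∑∑a+δ (+-monoˡ-≤ δ enlarge))))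

  -- Cauchy products

  -- Recursion on the tail of `a` avoids truncated subtraction in the indices and makes the
  -- algebraic laws plain inductions.
  conv : (ℕ → Carrier) → (ℕ → Carrier) → ℕ → Carrier
  conv a b zero    = a 0 * b 0
  conv a b (suc n) = a 0 * b (suc n) + conv (a ∘ suc) b n

  shift : ℕ → (ℕ → Carrier) → ℕ → Carrier
  shift zero    b n       = b n
  shift (suc r) b zero    = 0#
  shift (suc r) b (suc n) = shift r b n

  shift-nonneg : ∀ {b} → (∀ n → 0# ≤ b n) → ∀ r n → 0# ≤ shift r b n
  shift-nonneg 0≤b zero    n       = 0≤b n
  shift-nonneg 0≤b (suc r) zero    = ≤-refl
  shift-nonneg 0≤b (suc r) (suc n) = shift-nonneg 0≤b r n

  shift-zero : ∀ b r n → n ℕ.< r → shift r b n ≈ 0#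
  shift-zero b (suc r) zero    _         = ≈-refl
  shift-zero b (suc r) (suc n) (s≤s n<r) = shift-zero b r n n<r

  Sums-shift : ∀ {b s} r → Sums b s → Sums (shift r b) s
  Sums-shift zero    p = p
  Sums-shift {b} {s} (suc r) p =
    Sums-cong (λ _ → ≈-refl) (+-identityˡ s) (Sums-suc {a = shift (suc r) b} (Sums-shift r p))

  conv-shift : ∀ a b n → ∑ (suc n) (λ r → a r * shift r b n) ≈ conv a b n
  conv-shift a b zero    = ≈-trans (∑-suc 0 _) (≈-trans (+-congˡ (∑-0 _)) (+-identityʳ _))
  conv-shift a b (suc n) = ≈-trans (∑-suc (suc n) _) (+-congˡ (conv-shift (a ∘ suc) b n))

  conv-cong : ∀ {a a′ b b′} n → (∀ k → a k ≈ a′ k) → (∀ k → k ℕ.≤ n → b k ≈ b′ k) →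
              conv a b n ≈ conv a′ b′ n
  conv-cong zero    a≈a′ b≈b′ = *-cong (a≈a′ 0) (b≈b′ 0 z≤n)
  conv-cong (suc n) a≈a′ b≈b′ = +-cong (*-cong (a≈a′ 0) (b≈b′ (suc n) ℕ.≤-refl))
    (conv-cong n (a≈a′ ∘ suc) (λ k k≤n → b≈b′ k (ℕ.m≤n⇒m≤1+n k≤n)))

  conv-nonneg : ∀ {a b} → (∀ n → 0# ≤ a n) → (∀ n → 0# ≤ b n) → ∀ n → 0# ≤ conv a b n
  conv-nonneg 0≤a 0≤b zero    = *-nonneg (0≤a 0) (0≤b 0)
  conv-nonneg 0≤a 0≤b (suc n) = +-nonneg (*-nonneg (0≤a 0) (0≤b (suc n))) (conv-nonneg (0≤a ∘ suc) 0≤b n)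

  -- The product is arranged as a triangular array: row r is `a r` times `b` moved r places, with
  -- sum `a r * t`, and the columns add up to the coefficients of the product.
  Sums-conv : ∀ {a b s t} → (∀ n → 0# ≤ a n) → (∀ n → 0# ≤ b n) →
                Sums a s → Sums b t → Sums (conv a b) (s * t)
  Sums-conv {a} {b} {s} {t} 0≤a 0≤b p q = Sums-cong (conv-shift a b) (*-comm t s)
    (Sums-triangular
      (λ r n → *-nonneg (0≤a r) (shift-nonneg 0≤b r n))
      (λ r n n<r → ≈-trans (*-congˡ (shift-zero b r n n<r)) (zeroʳ _))
      (λ r → Sums-*ˡ (a r) (0≤a r) (Sums-shift r q))
      (Sums-cong (λ r → *-comm t (a r)) ≈-refl (Sums-*ˡ t (Sums-nonneg 0≤b q) p)))

  -- Geometric and exponential series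

  ∑-geometric : ∀ x n → (1# - x) * ∑ n (x ^_) ≈ 1# - x ^ n
  ∑-geometric x zero    = ≈-trans (*-congˡ (∑-0 _)) (solve 1 (λ x → (𝟙 :- x) :* 𝟘 := 𝟙 :- 𝟙) ≈-refl x)
  ∑-geometric x (suc n) = begin
    (1# - x) * ∑ (suc n) (x ^_)                  ≈⟨ *-congˡ (∑-last n (x ^_)) ⟩
    (1# - x) * (∑ n (x ^_) + x ^ n)              ≈⟨ distribˡ _ _ _ ⟩
    (1# - x) * ∑ n (x ^_) + (1# - x) * x ^ n     ≈⟨ +-congʳ (∑-geometric x n) ⟩
    1# - x ^ n + (1# - x) * x ^ n                ≈⟨ solve 2 (λ x p → 𝟙 :- p :+ (𝟙 :- x) :* p := 𝟙 :- x :* p) ≈-refl x (x ^ n) ⟩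
    1# - x * x ^ n                               ∎
    where open ≈-R

  -- Bernoulli's inequality in multiplied-out form. With the Archimedean property it gives an
  -- explicit index beyond which powers are small.
  power-decay : ∀ {x} → 0# ≤ x → x ≤ 1# → ∀ n → x ^ n * (1# + fromℕ n * (1# - x)) ≤ 1#
  power-decay {x} 0≤x x≤1 zero    = ≤-reflexive (solve 1 (λ x → 𝟙 :* (𝟙 :+ 𝟘 :* (𝟙 :- x)) := 𝟙) ≈-refl x)
  power-decay {x} 0≤x x≤1 (suc n) = begin
    x * p * (1# + (1# + m) * (1# - x))
      ≤⟨ ≤-by ((1# + m) * p * ((1# - x) * (1# - x)))
           (*-nonneg (*-nonneg (+-nonneg 0≤1 (fromℕ-nonneg n)) (^-nonneg n 0≤x))
                     (*-nonneg (≤⇒0≤- x≤1) (≤⇒0≤- x≤1)))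
           (solve 3 (λ x p N → p :* (𝟙 :+ N :* (𝟙 :- x)) :=
              x :* p :* (𝟙 :+ (𝟙 :+ N) :* (𝟙 :- x)) :+ (𝟙 :+ N) :* p :* ((𝟙 :- x) :* (𝟙 :- x))) ≈-refl x p m) ⟩
    p * (1# + m * (1# - x))                      ≤⟨ power-decay 0≤x x≤1 n ⟩
    1#                                           ∎
    where
    open ≤-R
    m p : Carrier
    m = fromℕ n
    p = x ^ n

  archimedean-* : ∀ ε → 0# < ε → ∃ λ n → 1# < fromℕ n * ε
  archimedean-* ε 0<ε =
    let n , ε⁻¹<n = archimedean (ε ⁻¹[ pos⇒#0 0<ε ]) in
    n , <-resp (≈-trans (*-comm _ ε) (x*x⁻¹≈1 _)) ≈-refl (*-monoˡ-< ε 0<ε ε⁻¹<n)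

  power-small : ∀ {x} → 0# ≤ x → x < 1# → ∀ ε → 0# < ε → ∃ λ n → x ^ n < ε
  power-small {x} 0≤x x<1 ε 0<ε =
    let 0<h = <⇒0<- x<1
        n , 1<nεh = archimedean-* (ε * (1# - x)) (*-pos 0<ε 0<h)
        0<1+nh = +-pos-nonneg 0<1 (*-nonneg (fromℕ-nonneg n) (<⇒≤ 0<h))
    in n , *-cancelˡ-< (1# + fromℕ n * (1# - x)) 0<1+nh (≤-<-trans
         (≤-resp (*-comm _ _) ≈-refl (power-decay 0≤x (<⇒≤ x<1) n))
         (<-trans 1<nεh (<-by ε 0<ε
           (solve 3 (λ x N e → (𝟙 :+ N :* (𝟙 :- x)) :* e := N :* (e :* (𝟙 :- x)) :+ e) ≈-refl x (fromℕ n) ε))))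

  Sums-geometric : ∀ {x t} → 0# ≤ x → x < 1# → (1# - x) * t ≈ 1# → Sums (x ^_) t
  Sums-geometric {x} {t} 0≤x x<1 ht≈1 = Sums-sup (λ n → ^-nonneg n 0≤x)
    (λ n → *-cancelˡ-≤ h 0<h (≤-resp (≈-sym (∑-geometric x n)) (≈-sym ht≈1)
      (≤-by _ (^-nonneg n 0≤x) (solve 1 (λ p → 𝟙 := 𝟙 :- p :+ p) ≈-refl (x ^ n)))))
    (λ ε 0<ε →
      let N , x^N<hε = power-small 0≤x x<1 (h * ε) (*-pos 0<h 0<ε) in
      N , *-cancelˡ-< h 0<h (<-resp (≈-sym ht≈1)
        (≈-sym (≈-trans (distribˡ h _ ε) (+-congʳ (∑-geometric x N))))
        (<-by _ (<⇒0<- x^N<hε) (solve 2 (λ p q → 𝟙 :- p :+ q := 𝟙 :+ (q :- p)) ≈-refl (x ^ N) (h * ε)))))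
    where
    h : Carrier
    h = 1# - x
    0<h : 0# < h
    0<h = <⇒0<- x<1

  conv-geometric : ∀ x y n → conv (λ k → y * x ^ k) (x ^_) n ≈ fromℕ (suc n) * (y * x ^ n)
  conv-geometric x y zero    = solve 1 (λ y → y :* 𝟙 :* 𝟙 := (𝟙 :+ 𝟘) :* (y :* 𝟙)) ≈-refl y
  conv-geometric x y (suc n) = begin
    y * 1# * (x * x ^ n) + conv (λ k → y * (x * x ^ k)) (x ^_) n
      ≈⟨ +-congˡ (conv-cong n (λ k → ≈-sym (*-assoc y x _)) (λ _ _ → ≈-refl)) ⟩
    y * 1# * (x * x ^ n) + conv (λ k → y * x * x ^ k) (x ^_) n
      ≈⟨ +-congˡ (conv-geometric x (y * x) n) ⟩
    y * 1# * (x * x ^ n) + fromℕ (suc n) * (y * x * x ^ n)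
      ≈⟨ solve 4 (λ x y p N → y :* 𝟙 :* (x :* p) :+ N :* (y :* x :* p) := (𝟙 :+ N) :* (y :* (x :* p))) ≈-refl
           x y (x ^ n) (fromℕ (suc n)) ⟩
    fromℕ (suc (suc n)) * (y * (x * x ^ n))
      ∎
    where open ≈-R

  Sums-geometric² : ∀ {x t} → 0# ≤ x → x < 1# → (1# - x) * t ≈ 1# →
                    Sums (λ n → fromℕ (suc n) * x ^ n) (t * t)
  Sums-geometric² {x} {t} 0≤x x<1 ht≈1 = Sums-cong
    (λ n → ≈-trans (conv-cong n (λ k → ≈-sym (*-identityˡ _)) (λ _ _ → ≈-refl))
      (≈-trans (conv-geometric x 1# n) (*-congˡ (*-identityˡ _))))
    ≈-refl
    (Sums-conv (λ n → ^-nonneg n 0≤x) (λ n → ^-nonneg n 0≤x) p p)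
    where
    p : Sums (x ^_) t
    p = Sums-geometric 0≤x x<1 ht≈1

  -- Up to k = m the factor mᵐ alone suffices; every later step multiplies the left side by m and
  -- the right side by at least m.
  ^≤^*! : ∀ m .{{_ : NonZero m}} k → m ℕ.^ k ℕ.≤ m ℕ.^ m ℕ.* k !
  ^≤^*! m zero    = ≡.subst (1 ℕ.≤_) (≡.sym (ℕ.*-identityʳ _)) (ℕ.m^n>0 m m)
  ^≤^*! m (suc k) = case suc k ℕ.≤? m of λ where
      (yes k<m) → ℕ.≤-trans (ℕ.^-monoʳ-≤ m k<m) (ℕ.m≤m*n (m ℕ.^ m) (suc k !) {{suc k ℕ.!≢0}})
      (no  k≮m) → ≡.subst (m ℕ.^ suc k ℕ.≤_) (x∙yz≈y∙xz (suc k) (m ℕ.^ m) (k !))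
        (ℕ.*-mono-≤ (ℕ.m≤n⇒m≤1+n (ℕ.≮⇒≥ k≮m)) (^≤^*! m k))
    where
    open import Algebra.Properties.CommutativeSemigroup ℕ.*-commutativeSemigroup using (x∙yz≈y∙xz)

  fromℕ-^ : ∀ m k → fromℕ (m ℕ.^ k) ≈ fromℕ m ^ k
  fromℕ-^ m zero    = fromℕ-1
  fromℕ-^ m (suc k) = ≈-trans (fromℕ-* m (m ℕ.^ k)) (*-congˡ (fromℕ-^ m k))

  ^-distrib-* : ∀ x y n → (x * y) ^ n ≈ x ^ n * y ^ n
  ^-distrib-* x y zero    = ≈-sym (*-identityˡ 1#)
  ^-distrib-* x y (suc n) = ≈-trans (*-congˡ (^-distrib-* x y n))
    (solve 4 (λ x y p q → x :* y :* (p :* q) := x :* p :* (y :* q)) ≈-refl x y (x ^ n) (y ^ n))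

  ^-congˡ : ∀ {x y} n → x ≈ y → x ^ n ≈ y ^ n
  ^-congˡ zero    x≈y = ≈-refl
  ^-congˡ (suc n) x≈y = *-cong x≈y (^-congˡ n x≈y)

  expTerm : Carrier → ℕ → Carrier
  expTerm u k = u ^ k * 1/! k

  expTerm-nonneg : ∀ {u} → 0# ≤ u → ∀ k → 0# ≤ expTerm u k
  expTerm-nonneg 0≤u k = *-nonneg (^-nonneg k 0≤u) (<⇒≤ (1/!-pos k))

  ½ : Carrier
  ½ = 1/ 2

  opaque
    0<½ : 0# < ½
    0<½ = 1/-pos 2

    ½+½≈1 : ½ + ½ ≈ 1#
    ½+½≈1 = ≈-trans (solve 1 (λ h → h :+ h := (𝟙 :+ (𝟙 :+ 𝟘)) :* h) ≈-refl ½) (n*1/n≈1 2)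

  ½<1 : ½ < 1#
  ½<1 = <-by ½ 0<½ (≈-sym ½+½≈1)

  -- Domination by a multiple of the geometric series with ratio ½.
  exp-converges : ∀ {u} → 0# ≤ u → ∃ (Sums (expTerm u))
  exp-converges {u} 0≤u =
    comparison-test (expTerm-nonneg 0≤u) dominated
      (Sums-*ˡ (fromℕ (M ℕ.^ M)) (fromℕ-nonneg (M ℕ.^ M))
        (Sums-geometric (<⇒≤ 0<½) ½<1 (x*x⁻¹≈1 (pos⇒#0 (<⇒0<- ½<1)))))
    where
    open ≤-R
    v : Carrier
    -- Doubling `u` leaves a factor ½ᵏ over once vᵏ / k! has been bounded by the constant Mᴹ.
    v = u + u
    M : ℕ
    M = suc (proj₁ (archimedean v))
    v≤M : v ≤ fromℕ M
    v≤M = ≤-trans (<⇒≤ (proj₂ (archimedean v))) (fromℕ-mono-≤ {proj₁ (archimedean v)} {M} (ℕ.n≤1+n _))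
    u≈½v : u ≈ ½ * v
    u≈½v = ≈-sym (≈-trans (solve 2 (λ h u → h :* (u :+ u) := (h :+ h) :* u) ≈-refl ½ u)
      (≈-trans (*-congʳ ½+½≈1) (*-identityˡ u)))

    v^k≤ : ∀ k → v ^ k ≤ fromℕ (M ℕ.^ M) * fromℕ (k !)
    v^k≤ k = begin
      v ^ k                              ≤⟨ ^-mono-≤ k (+-nonneg 0≤u 0≤u) v≤M ⟩
      fromℕ M ^ k                        ≈⟨ fromℕ-^ M k ⟨
      fromℕ (M ℕ.^ k)                    ≤⟨ fromℕ-mono-≤ (^≤^*! M k) ⟩
      fromℕ (M ℕ.^ M ℕ.* k !)            ≈⟨ fromℕ-* (M ℕ.^ M) (k !) ⟩
      fromℕ (M ℕ.^ M) * fromℕ (k !)      ∎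

    dominated : ∀ k → expTerm u k ≤ fromℕ (M ℕ.^ M) * ½ ^ k
    dominated k = begin
      u ^ k * 1/! k
        ≈⟨ *-congʳ (≈-trans (^-congˡ k u≈½v) (^-distrib-* ½ v k)) ⟩
      ½ ^ k * v ^ k * 1/! k
        ≤⟨ *-monoˡ-≤ (1/! k) (<⇒≤ (1/!-pos k)) (*-monoʳ-≤ (½ ^ k) (^-nonneg k (<⇒≤ 0<½)) (v^k≤ k)) ⟩
      ½ ^ k * (fromℕ (M ℕ.^ M) * fromℕ (k !)) * 1/! k
        ≈⟨ solve 4 (λ h m f g → h :* (m :* f) :* g := m :* h :* (f :* g)) ≈-refl (½ ^ k) (fromℕ (M ℕ.^ M)) (fromℕ (k !)) (1/! k) ⟩
      fromℕ (M ℕ.^ M) * ½ ^ k * (fromℕ (k !) * 1/! k)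
        ≈⟨ ≈-trans (*-congˡ (n!*1/!n≈1 k)) (*-identityʳ _) ⟩
      fromℕ (M ℕ.^ M) * ½ ^ k
        ∎

  -- Exponential formula

  conv-zero : ∀ {a b} n → (∀ k → k ℕ.≤ n → b k ≈ 0#) → conv a b n ≈ 0#
  conv-zero zero    b≈0 = ≈-trans (*-congˡ (b≈0 0 z≤n)) (zeroʳ _)
  conv-zero (suc n) b≈0 = ≈-trans
    (+-cong (≈-trans (*-congˡ (b≈0 (suc n) ℕ.≤-refl)) (zeroʳ _))
            (conv-zero n (λ k k≤n → b≈0 k (ℕ.m≤n⇒m≤1+n k≤n))))
    (+-identityˡ 0#)

  conv-*ʳ : ∀ x a b n → conv a (λ k → x * b k) n ≈ x * conv a b n
  conv-*ʳ x a b zero    = solve 3 (λ x a b → a :* (x :* b) := x :* (a :* b)) ≈-refl x (a 0) (b 0)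
  conv-*ʳ x a b (suc n) = ≈-trans (+-congˡ (conv-*ʳ x (a ∘ suc) b n))
    (solve 4 (λ x a b c → a :* (x :* b) :+ x :* c := x :* (a :* b :+ c)) ≈-refl x (a 0) (b (suc n)) (conv (a ∘ suc) b n))

  conv-*ˡ : ∀ x a b n → conv (λ k → x * a k) b n ≈ x * conv a b n
  conv-*ˡ x a b zero    = *-assoc x (a 0) (b 0)
  conv-*ˡ x a b (suc n) = ≈-trans (+-cong (*-assoc x (a 0) _) (conv-*ˡ x (a ∘ suc) b n)) (≈-sym (distribˡ x _ _))

  conv-0ˡ : ∀ a b n → a 0 ≈ 0# → conv a b (suc n) ≈ conv (a ∘ suc) b n
  conv-0ˡ a b n a₀≈0 = ≈-trans (+-congʳ (≈-trans (*-congʳ a₀≈0) (zeroˡ _))) (+-identityˡ _)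

  conv-0ʳ : ∀ a b n → b 0 ≈ 0# → conv a b (suc n) ≈ conv a (b ∘ suc) n
  conv-0ʳ a b zero    b₀≈0 = ≈-trans (+-congˡ (≈-trans (*-congˡ b₀≈0) (zeroʳ _))) (+-identityʳ _)
  conv-0ʳ a b (suc n) b₀≈0 = +-congˡ (conv-0ʳ (a ∘ suc) b n b₀≈0)

  conv-+ʳ : ∀ a b b′ n → conv a (λ k → b k + b′ k) n ≈ conv a b n + conv a b′ n
  conv-+ʳ a b b′ zero    = distribˡ (a 0) (b 0) (b′ 0)
  conv-+ʳ a b b′ (suc n) = ≈-trans (+-congˡ (conv-+ʳ (a ∘ suc) b b′ n))
    (solve 5 (λ a b b′ c c′ → a :* (b :+ b′) :+ (c :+ c′) := a :* b :+ c :+ (a :* b′ :+ c′)) ≈-refl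
      (a 0) (b (suc n)) (b′ (suc n)) (conv (a ∘ suc) b n) (conv (a ∘ suc) b′ n))

  conv-∑ʳ : ∀ R a (b : ℕ → ℕ → Carrier) n →
    conv a (λ k → ∑ R (λ r → b r k)) n ≈ ∑ R (λ r → conv a (b r) n)
  conv-∑ʳ zero    a b n = ≈-trans (conv-zero n (λ k _ → ∑-0 _)) (≈-sym (∑-0 _))
  conv-∑ʳ (suc R) a b n = begin
    conv a (λ k → ∑ (suc R) (λ r → b r k)) n          ≈⟨ conv-cong n (λ _ → ≈-refl) (λ k _ → ∑-suc R _) ⟩
    conv a (λ k → b 0 k + ∑ R (λ r → b (suc r) k)) n  ≈⟨ conv-+ʳ a _ _ n ⟩
    conv a (b 0) n + conv a (λ k → ∑ R (λ r → b (suc r) k)) n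
                                                      ≈⟨ +-congˡ (conv-∑ʳ R a (b ∘ suc) n) ⟩
    conv a (b 0) n + ∑ R (λ r → conv a (b (suc r)) n) ≈⟨ ∑-suc R _ ⟨
    ∑ (suc R) (λ r → conv a (b r) n)                  ∎
    where open ≈-R

  -- Peeling a term off both `a` and `b` leaves a product two places lower, hence the two base
  -- cases. This one law does the work of associativity and commutativity in moving `S` past `L`.
  conv-leftComm : ∀ a b d n → conv a (conv b d) n ≈ conv b (conv a d) n
  conv-leftComm a b d zero = solve 3 (λ a b d → a :* (b :* d) := b :* (a :* d)) ≈-refl (a 0) (b 0) (d 0)
  conv-leftComm a b d (suc zero) =
    solve 6 (λ a a′ b b′ d d′ → a :* (b :* d′ :+ b′ :* d) :+ a′ :* (b :* d)
                             := b :* (a :* d′ :+ a′ :* d) :+ b′ :* (a :* d)) ≈-refl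
      (a 0) (a 1) (b 0) (b 1) (d 0) (d 1)
  conv-leftComm a b d (suc (suc n)) = begin
    a₀ * (b₀ * d₂ + conv b⁺ d (suc n)) + (a 1 * conv b d (suc n) + conv a⁺⁺ (conv b d) n)
      ≈⟨ +-congˡ (conv-leftComm a⁺ b d (suc n)) ⟩
    a₀ * (b₀ * d₂ + conv b⁺ d (suc n)) + (b₀ * conv a⁺ d (suc n) + conv b⁺ (conv a⁺ d) n)
      ≈⟨ +-congˡ (+-congˡ (conv-leftComm b⁺ a⁺ d n)) ⟩
    a₀ * (b₀ * d₂ + conv b⁺ d (suc n)) + (b₀ * conv a⁺ d (suc n) + conv a⁺ (conv b⁺ d) n)
      ≈⟨ solve 6 (λ a b d p q r → a :* (b :* d :+ p) :+ (b :* q :+ r) := b :* (a :* d :+ q) :+ (a :* p :+ r)) ≈-refl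
           a₀ b₀ d₂ (conv b⁺ d (suc n)) (conv a⁺ d (suc n)) (conv a⁺ (conv b⁺ d) n) ⟩
    b₀ * (a₀ * d₂ + conv a⁺ d (suc n)) + (a₀ * conv b⁺ d (suc n) + conv a⁺ (conv b⁺ d) n)
      ≈⟨ +-congˡ (conv-leftComm a b⁺ d (suc n)) ⟩
    b₀ * (a₀ * d₂ + conv a⁺ d (suc n)) + (b 1 * conv a d (suc n) + conv b⁺⁺ (conv a d) n)
      ∎
    where
    open ≈-R
    a₀ b₀ d₂ : Carrier
    a₀ = a 0
    b₀ = b 0
    d₂ = d (suc (suc n))
    a⁺ b⁺ a⁺⁺ b⁺⁺ : ℕ → Carrier
    a⁺ = a ∘ suc
    b⁺ = b ∘ suc
    a⁺⁺ = a⁺ ∘ suc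
    b⁺⁺ = b⁺ ∘ suc

  -- The Euler operator x d/dx on coefficient sequences; `conv-Leibniz` is its product rule.
  θ : (ℕ → Carrier) → ℕ → Carrier
  θ a n = fromℕ n * a n

  conv-Leibniz : ∀ a b n → θ (conv a b) n ≈ conv (θ a) b n + conv a (θ b) n
  conv-Leibniz a b zero    = solve 2 (λ a b → 𝟘 :* (a :* b) := 𝟘 :* a :* b :+ a :* (𝟘 :* b)) ≈-refl (a 0) (b 0)
  conv-Leibniz a b (suc n) = begin
    (1# + fromℕ n) * (a 0 * b (suc n) + conv a⁺ b n)
      ≈⟨ solve 4 (λ N a b c → (𝟙 :+ N) :* (a :* b :+ c) := a :* ((𝟙 :+ N) :* b) :+ c :+ N :* c) ≈-refl
           (fromℕ n) (a 0) (b (suc n)) (conv a⁺ b n) ⟩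
    a 0 * θ b (suc n) + conv a⁺ b n + θ (conv a⁺ b) n
      ≈⟨ +-congˡ (conv-Leibniz a⁺ b n) ⟩
    a 0 * θ b (suc n) + conv a⁺ b n + (conv (θ a⁺) b n + conv a⁺ (θ b) n)
      -- The zero introduced here is the leading term `θ a 0 * b (suc n)` of `conv (θ a) b (suc n)`.
      ≈⟨ solve 6 (λ p q r s a b → p :+ q :+ (r :+ s) := 𝟘 :* a :* b :+ (q :+ r) :+ (p :+ s)) ≈-refl
           (a 0 * θ b (suc n)) (conv a⁺ b n) (conv (θ a⁺) b n) (conv a⁺ (θ b) n) (a 0) (b (suc n)) ⟩
    0# * a 0 * b (suc n) + (conv a⁺ b n + conv (θ a⁺) b n) + (a 0 * θ b (suc n) + conv a⁺ (θ b) n)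
      ≈⟨ +-congʳ (+-congˡ (conv-+ˡ a⁺ (θ a⁺) b n)) ⟨
    0# * a 0 * b (suc n) + conv (λ k → a⁺ k + θ a⁺ k) b n + (a 0 * θ b (suc n) + conv a⁺ (θ b) n)
      ≈⟨ +-congʳ (+-congˡ (conv-cong n (λ k → ≈-trans (+-congʳ (≈-sym (*-identityˡ _))) (≈-sym (distribʳ _ _ _))) (λ _ _ → ≈-refl))) ⟩
    0# * a 0 * b (suc n) + conv (θ a ∘ suc) b n + (a 0 * θ b (suc n) + conv a⁺ (θ b) n)
      ∎
    where
    open ≈-R
    a⁺ : ℕ → Carrier
    a⁺ = a ∘ suc
    conv-+ˡ : ∀ a a′ b n → conv (λ k → a k + a′ k) b n ≈ conv a b n + conv a′ b n
    conv-+ˡ a a′ b zero    = distribʳ (b 0) (a 0) (a′ 0)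
    conv-+ˡ a a′ b (suc n) = ≈-trans (+-congˡ (conv-+ˡ (a ∘ suc) (a′ ∘ suc) b n))
      (solve 5 (λ a a′ b c c′ → (a :+ a′) :* b :+ (c :+ c′) := a :* b :+ c :+ (a′ :* b :+ c′)) ≈-refl
        (a 0) (a′ 0) (b (suc n)) (conv (a ∘ suc) b n) (conv (a′ ∘ suc) b n))

  conv-power : ∀ x a b n → conv (λ k → a k * x ^ k) (λ k → b k * x ^ k) n ≈ conv a b n * x ^ n
  conv-power x a b zero    = solve 2 (λ a b → a :* 𝟙 :* (b :* 𝟙) := a :* b :* 𝟙) ≈-refl (a 0) (b 0)
  conv-power x a b (suc n) = begin
    a 0 * 1# * (b (suc n) * (x * x ^ n)) + conv (λ k → a⁺ k * (x * x ^ k)) (λ k → b k * x ^ k) n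
      ≈⟨ +-congˡ (conv-cong n (λ k → solve 3 (λ a x p → a :* (x :* p) := x :* a :* p) ≈-refl (a⁺ k) x (x ^ k)) (λ _ _ → ≈-refl)) ⟩
    a 0 * 1# * (b (suc n) * (x * x ^ n)) + conv (λ k → x * a⁺ k * x ^ k) (λ k → b k * x ^ k) n
      ≈⟨ +-congˡ (≈-trans (conv-power x (λ k → x * a⁺ k) b n) (*-congʳ (conv-*ˡ x a⁺ b n))) ⟩
    a 0 * 1# * (b (suc n) * (x * x ^ n)) + x * conv a⁺ b n * x ^ n
      ≈⟨ solve 5 (λ a b x p c → a :* 𝟙 :* (b :* (x :* p)) :+ x :* c :* p := (a :* b :+ c) :* (x :* p)) ≈-refl
           (a 0) (b (suc n)) x (x ^ n) (conv a⁺ b n) ⟩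
    (a 0 * b (suc n) + conv a⁺ b n) * (x * x ^ n)
      ∎
    where
    open ≈-R
    a⁺ : ℕ → Carrier
    a⁺ = a ∘ suc

  -- With s k standing for σₖ₊₁: the coefficients of Σ σₖ xᵏ, of its
  -- logarithmic primitive ℓ(x) = Σ σₖ xᵏ / k, and of ℓ(x)ʳ / r!.
  module Coefficients (s : ℕ → Carrier) where

    S L : ℕ → Carrier
    S zero    = 0#
    S (suc k) = s k
    L zero    = 0#
    L (suc k) = s k * 1/ (suc k)

    e : ℕ → ℕ → Carrier
    e zero    zero    = 1#
    e zero    (suc n) = 0#
    e (suc r) n       = 1/ (suc r) * conv L (e r) n

    conv-S : ∀ b n → conv S b (suc n) ≈ conv s b n
    conv-S b n = conv-0ˡ S b n ≈-refl

    θL≈S : ∀ n → θ L n ≈ S n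
    θL≈S zero    = zeroˡ 0#
    θL≈S (suc n) = begin
      fromℕ (suc n) * (s n * 1/ (suc n))   ≈⟨ solve 3 (λ k s i → k :* (s :* i) := s :* (k :* i)) ≈-refl _ _ _ ⟩
      s n * (fromℕ (suc n) * 1/ (suc n))   ≈⟨ *-congˡ (n*1/n≈1 (suc n)) ⟩
      s n * 1#                             ≈⟨ *-identityʳ _ ⟩
      s n                                  ∎
      where open ≈-R

    mutual
      -- The second term of the product rule in `θe`. Differentiating ℓʳ/r! gives S ℓʳ⁻¹/(r-1)!;
      -- once ℓ and S are exchanged, ℓ · ℓʳ⁻¹/(r-1)! is r copies of ℓʳ/r!.
      conv-L-θe : ∀ r n → conv L (θ (e r)) n ≈ fromℕ r * conv S (e r) n
      conv-L-θe zero    n = ≈-trans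
        (conv-zero n λ { zero _ → zeroˡ 1# ; (suc k) _ → zeroʳ _ }) (≈-sym (zeroˡ _))
      conv-L-θe (suc r) n = begin
        conv L (θ (e (suc r))) n
          ≈⟨ conv-cong n (λ _ → ≈-refl) (λ k _ → θe r k) ⟩
        conv L (conv S (e r)) n
          ≈⟨ conv-leftComm L S (e r) n ⟩
        conv S (conv L (e r)) n
          ≈⟨ conv-cong n (λ _ → ≈-refl) (λ k _ → conv-L-e k) ⟩
        conv S (λ k → fromℕ (suc r) * e (suc r) k) n
          ≈⟨ conv-*ʳ _ S (e (suc r)) n ⟩
        fromℕ (suc r) * conv S (e (suc r)) n
          ∎
        where
        open ≈-R
        conv-L-e : ∀ k → conv L (e r) k ≈ fromℕ (suc r) * e (suc r) k
        conv-L-e k = ≈-sym (≈-trans (≈-sym (*-assoc _ _ _))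
          (≈-trans (*-congʳ (n*1/n≈1 (suc r))) (*-identityˡ _)))

      -- The chain rule for ℓʳ⁺¹/(r+1)!: differentiating the explicit factor ℓ gives one copy of S
      -- ℓʳ/r!, the rest gives r copies, and 1/(r+1) normalises.
      θe : ∀ r n → θ (e (suc r)) n ≈ conv S (e r) n
      θe r n = begin
        fromℕ n * (1/ (suc r) * conv L (e r) n)
          ≈⟨ solve 3 (λ n i c → n :* (i :* c) := i :* (n :* c)) ≈-refl _ _ _ ⟩
        1/ (suc r) * θ (conv L (e r)) n
          ≈⟨ *-congˡ (≈-trans (conv-Leibniz L (e r) n)
               (+-cong (conv-cong n θL≈S (λ _ _ → ≈-refl)) (conv-L-θe r n))) ⟩
        1/ (suc r) * (conv S (e r) n + fromℕ r * conv S (e r) n)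
          ≈⟨ solve 3 (λ i k c → i :* (c :+ k :* c) := (𝟙 :+ k) :* i :* c) ≈-refl _ (fromℕ r) _ ⟩
        fromℕ (suc r) * 1/ (suc r) * conv S (e r) n
          ≈⟨ ≈-trans (*-congʳ (n*1/n≈1 (suc r))) (*-identityˡ _) ⟩
        conv S (e r) n
          ∎
        where open ≈-R

    e-triangular : ∀ r n → n ℕ.< r → e r n ≈ 0#
    e-triangular (suc r) zero    _         = ≈-trans (*-congˡ (zeroˡ _)) (zeroʳ _)
    e-triangular (suc r) (suc n) (s≤s n<r) = ≈-trans (*-congˡ (≈-trans (+-cong (zeroˡ _)
      (conv-zero n (λ k k≤n → e-triangular r k (ℕ.≤-<-trans k≤n n<r)))) (+-identityˡ 0#))) (zeroʳ _)

    mix : (ℕ → Carrier) → ℕ → Carrier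
    mix φ n = ∑ (suc n) (λ r → φ r * e r n)

    mix-zero : ∀ φ → mix φ 0 ≈ φ 0
    mix-zero φ = ≈-trans (∑-suc 0 _) (≈-trans (+-congˡ (∑-0 _)) (≈-trans (+-identityʳ _) (*-identityʳ _)))

    -- Differentiation lowers the exponent of ℓ by one while `φ` keeps its argument, so `φ` is read
    -- one place further on.
    mix-suc : ∀ φ n → fromℕ (suc n) * mix φ (suc n) ≈ conv s (mix (φ ∘ suc)) n
    mix-suc φ n = begin
      fromℕ (suc n) * mix φ (suc n)
        ≈⟨ *-congˡ (≈-trans (∑-suc (suc n) _) (≈-trans (+-congʳ (zeroʳ _)) (+-identityˡ _))) ⟩
      fromℕ (suc n) * ∑ (suc n) (λ r → φ (suc r) * e (suc r) (suc n))
        ≈⟨ ∑-*ˡ (suc n) _ _ ⟨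
      ∑ (suc n) (λ r → fromℕ (suc n) * (φ (suc r) * e (suc r) (suc n)))
        ≈⟨ ∑-cong (suc n) (λ r → ≈-trans
             (solve 3 (λ k f e → k :* (f :* e) := f :* (k :* e)) ≈-refl _ (φ (suc r)) _)
             (*-congˡ (≈-trans (θe r (suc n)) (conv-S (e r) n)))) ⟩
      ∑ (suc n) (λ r → φ (suc r) * conv s (e r) n)
        ≈⟨ ∑-cong (suc n) (λ r → ≈-sym (conv-*ʳ (φ (suc r)) s (e r) n)) ⟩
      ∑ (suc n) (λ r → conv s (λ k → φ (suc r) * e r k) n)
        ≈⟨ conv-∑ʳ (suc n) s (λ r k → φ (suc r) * e r k) n ⟨
      conv s (λ k → ∑ (suc n) (λ r → φ (suc r) * e r k)) n
        ≈⟨ conv-cong n (λ _ → ≈-refl) (λ k k≤n → truncate k (s≤s k≤n)) ⟩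
      conv s (mix (φ ∘ suc)) n
        ∎
      where
      open ≈-R
      truncate : ∀ k → k ℕ.< suc n → ∑ (suc n) (λ r → φ (suc r) * e r k) ≈ mix (φ ∘ suc) k
      truncate k k<1+n = ∑-truncate k<1+n
        (λ r k<r → ≈-trans (*-congˡ (e-triangular r k k<r)) (zeroʳ _))

    -- The equation for shift `j` refers to shift `j + 1` at all smaller sizes, so the induction
    -- treats every shift at once and is bounded by `b` rather than by `n` itself.
    mix-unique : ∀ (g : ℕ → ℕ → Carrier) φ → (∀ j → g j 0 ≈ φ j) →
      (∀ j n → fromℕ (suc n) * g j (suc n) ≈ conv s (g (suc j)) n) → ∀ n → g 0 n ≈ mix φ n
    mix-unique g φ g-zero g-suc n = ≈-trans (unique n 0 n ℕ.≤-refl) (∑-cong (suc n) (λ _ → ≈-refl))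
      where
      open ≈-R
      unique : ∀ b j n → n ℕ.≤ b → g j n ≈ mix (λ r → φ (j ℕ.+ r)) n
      unique b       j zero    _         = ≈-trans (g-zero j)
        (≈-sym (≈-trans (mix-zero _) (reflexive (≡.cong φ (ℕ.+-identityʳ j)))))
      unique (suc b) j (suc n) (s≤s n≤b) = *-cancelˡ-≈ (fromℕ (suc n)) (fromℕ-pos n) (begin
        fromℕ (suc n) * g j (suc n)
          ≈⟨ g-suc j n ⟩
        conv s (g (suc j)) n
          ≈⟨ conv-cong n (λ _ → ≈-refl) (λ k k≤n → ≈-trans (unique b (suc j) k (ℕ.≤-trans k≤n n≤b))
               (∑-cong (suc k) (λ r → *-congʳ (reflexive (≡.cong φ (≡.sym (ℕ.+-suc j r))))))) ⟩
        conv s (mix (λ r → φ (j ℕ.+ suc r))) n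
          ≈⟨ mix-suc (λ r → φ (j ℕ.+ r)) n ⟨
        fromℕ (suc n) * mix (λ r → φ (j ℕ.+ r)) (suc n)
          ∎)

    L-nonneg : (∀ k → 0# ≤ s k) → ∀ n → 0# ≤ L n
    L-nonneg 0≤s zero    = ≤-refl
    L-nonneg 0≤s (suc n) = *-nonneg (0≤s n) (<⇒≤ (1/-pos (suc n)))

    e-nonneg : (∀ k → 0# ≤ s k) → ∀ r n → 0# ≤ e r n
    e-nonneg 0≤s zero    zero    = 0≤1
    e-nonneg 0≤s zero    (suc n) = ≤-refl
    e-nonneg 0≤s (suc r) n       =
      *-nonneg (<⇒≤ (1/-pos (suc r))) (conv-nonneg (L-nonneg 0≤s) (e-nonneg 0≤s r) n)

    Sums-e : ∀ {x ℓ} → (∀ k → 0# ≤ s k) → 0# ≤ x → Sums (λ n → L n * x ^ n) ℓ →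
             ∀ r → Sums (λ n → e r n * x ^ n) (expTerm ℓ r)
    Sums-e {x} {ℓ} 0≤s 0≤x p zero = Sums-sup
      (λ n → *-nonneg (e-nonneg 0≤s 0 n) (^-nonneg n 0≤x))
      (λ { zero → ≤-resp (≈-sym (∑-0 _)) ≈-refl (<⇒≤ (*-pos 0<1 (1/!-pos 0)))
         ; (suc n) → ≤-reflexive (total n) })
      (λ ε 0<ε → 1 , <-by ε 0<ε (+-congʳ (total 0)))
      where
      total : ∀ n → ∑ (suc n) (λ n → e 0 n * x ^ n) ≈ 1# * 1/! 0
      total n = begin
        ∑ (suc n) (λ n → e 0 n * x ^ n)                 ≈⟨ ∑-suc n _ ⟩
        1# * 1# + ∑ n (λ n → 0# * (x * x ^ n))          ≈⟨ +-congˡ (≈-trans (∑-cong n (λ _ → zeroˡ _)) (∑-zero n)) ⟩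
        1# * 1# + 0#                                    ≈⟨ +-identityʳ _ ⟩
        1# * 1#                                         ≈⟨ *-congˡ 1/!-0 ⟨
        1# * 1/! 0                                      ∎
        where open ≈-R
    Sums-e {x} {ℓ} 0≤s 0≤x p (suc r) = Sums-cong
      (λ n → ≈-trans (*-congˡ (conv-power x L (e r) n)) (≈-sym (*-assoc _ _ _)))
      (begin
        1/ (suc r) * (ℓ * (ℓ ^ r * 1/! r))
          ≈⟨ *-congˡ (*-congˡ (*-congˡ (1/!-suc r))) ⟨
        1/ (suc r) * (ℓ * (ℓ ^ r * (fromℕ (suc r) * 1/! (suc r))))
          ≈⟨ solve 5 (λ i l p k f → i :* (l :* (p :* (k :* f))) := k :* i :* (l :* p :* f)) ≈-refl _ _ _ (fromℕ (suc r)) _ ⟩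
        fromℕ (suc r) * 1/ (suc r) * (ℓ * ℓ ^ r * 1/! (suc r))
          ≈⟨ ≈-trans (*-congʳ (n*1/n≈1 (suc r))) (*-identityˡ _) ⟩
        ℓ * ℓ ^ r * 1/! (suc r)
          ∎)
      (Sums-*ˡ (1/ (suc r)) (<⇒≤ (1/-pos (suc r)))
        (Sums-conv (λ n → *-nonneg (L-nonneg 0≤s n) (^-nonneg n 0≤x))
                   (λ n → *-nonneg (e-nonneg 0≤s r n) (^-nonneg n 0≤x))
                   p (Sums-e 0≤s 0≤x p r)))
      where open ≈-R

    -- Interchanges the sums over the exponent r and the size n: summed over n first, row r is `φ r`
    -- times ℓʳ/r!.
    Sums-mix : ∀ {x ℓ z} φ → (∀ k → 0# ≤ s k) → (∀ r → 0# ≤ φ r) → 0# ≤ x →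
               Sums (λ n → L n * x ^ n) ℓ → Sums (λ r → φ r * expTerm ℓ r) z →
               Sums (λ n → mix φ n * x ^ n) z
    Sums-mix {x} φ 0≤s 0≤φ 0≤x p q = Sums-cong
      (λ n → ≈-trans (∑-cong (suc n) (λ r → solve 3 (λ f e p → f :* (e :* p) := p :* (f :* e)) ≈-refl (φ r) (e r n) (x ^ n)))
        (≈-trans (∑-*ˡ (suc n) (x ^ n) _) (*-comm _ _)))
      ≈-refl
      (Sums-triangular
        (λ r n → *-nonneg (0≤φ r) (*-nonneg (e-nonneg 0≤s r n) (^-nonneg n 0≤x)))
        (λ r n n<r → ≈-trans (*-congˡ (≈-trans (*-congʳ (e-triangular r n n<r)) (zeroˡ _))) (zeroʳ _))
        (λ r → Sums-*ˡ (φ r) (0≤φ r) (Sums-e 0≤s 0≤x p r))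
        q)

  -- Sums over lists

  sumOver : {A : Set} → (A → Carrier) → List A → Carrier
  sumOver f xs = foldr _+_ 0# (map f xs)

  module _ {A : Set} where

    sumOver-cong : ∀ {f g : A → Carrier} xs → (∀ {x} → x ∈ xs → f x ≈ g x) → sumOver f xs ≈ sumOver g xs
    sumOver-cong []       f≈g = ≈-refl
    sumOver-cong (x ∷ xs) f≈g = +-cong (f≈g (here ≡.refl)) (sumOver-cong xs (f≈g ∘ there))

    sumOver-++ : ∀ (f : A → Carrier) xs ys → sumOver f (xs ++ ys) ≈ sumOver f xs + sumOver f ys
    sumOver-++ f []       ys = ≈-sym (+-identityˡ _)
    sumOver-++ f (x ∷ xs) ys = ≈-trans (+-congˡ (sumOver-++ f xs ys)) (≈-sym (+-assoc _ _ _))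

    sumOver-+ : ∀ (f g : A → Carrier) xs → sumOver (λ x → f x + g x) xs ≈ sumOver f xs + sumOver g xs
    sumOver-+ f g []       = ≈-sym (+-identityˡ 0#)
    sumOver-+ f g (x ∷ xs) = ≈-trans (+-congˡ (sumOver-+ f g xs))
      (solve 4 (λ p q r s → p :+ q :+ (r :+ s) := p :+ r :+ (q :+ s)) ≈-refl (f x) (g x) (sumOver f xs) (sumOver g xs))

    sumOver-*ˡ : ∀ k (f : A → Carrier) xs → sumOver (λ x → k * f x) xs ≈ k * sumOver f xs
    sumOver-*ˡ k f []       = ≈-sym (zeroʳ k)
    sumOver-*ˡ k f (x ∷ xs) = ≈-trans (+-congˡ (sumOver-*ˡ k f xs)) (≈-sym (distribˡ k _ _))

    sumOver-const : ∀ k (xs : List A) → sumOver (λ _ → k) xs ≈ fromℕ (length xs) * k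
    sumOver-const k []       = ≈-sym (zeroˡ k)
    sumOver-const k (x ∷ xs) = ≈-trans (+-congˡ (sumOver-const k xs))
      (solve 2 (λ k n → k :+ n :* k := (𝟙 :+ n) :* k) ≈-refl k (fromℕ (length xs)))

    sumOver-↭ : ∀ (f : A → Carrier) {xs ys} → xs ↭ ys → sumOver f xs ≈ sumOver f ys
    sumOver-↭ f ↭-id          = ≈-refl
    sumOver-↭ f (prep x p)    = +-congˡ (sumOver-↭ f p)
    sumOver-↭ f (swap x y p)  = ≈-trans (+-congˡ (+-congˡ (sumOver-↭ f p)))
      (solve 3 (λ p q r → p :+ (q :+ r) := q :+ (p :+ r)) ≈-refl (f x) (f y) _)
    sumOver-↭ f (↭-tr p q)    = ≈-trans (sumOver-↭ f p) (sumOver-↭ f q)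

  module _ {A B : Set} where

    sumOver-map : ∀ (f : B → Carrier) (g : A → B) xs → sumOver f (map g xs) ≈ sumOver (f ∘ g) xs
    sumOver-map f g []       = ≈-refl
    sumOver-map f g (x ∷ xs) = +-congˡ (sumOver-map f g xs)

    sumOver-concatMap : ∀ (f : B → Carrier) (g : A → List B) xs →
      sumOver f (concatMap g xs) ≈ sumOver (λ x → sumOver f (g x)) xs
    sumOver-concatMap f g []       = ≈-refl
    sumOver-concatMap f g (x ∷ xs) =
      ≈-trans (sumOver-++ f (g x) (concatMap g xs)) (+-congˡ (sumOver-concatMap f g xs))

    sumOver-comm : ∀ (f : A → B → Carrier) xs ys →
      sumOver (λ x → sumOver (f x) ys) xs ≈ sumOver (λ y → sumOver (λ x → f x y) xs) ys
    sumOver-comm f []       ys = ≈-sym (≈-trans (sumOver-const 0# ys) (zeroʳ _))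
    sumOver-comm f (x ∷ xs) ys =
      ≈-trans (+-congˡ (sumOver-comm f xs ys)) (≈-sym (sumOver-+ (f x) (λ y → sumOver (λ x → f x y) xs) ys))

  sumOver-product : ∀ {A B C : Set} (f : C → Carrier) (g : A → B → C) xs ys →
    sumOver f (cartesianProductWith g xs ys) ≈ sumOver (λ x → sumOver (f ∘ g x) ys) xs
  sumOver-product f g []       ys = ≈-refl
  sumOver-product f g (x ∷ xs) ys = ≈-trans (sumOver-++ f (map (g x) ys) _)
    (+-cong (sumOver-map f (g x) ys) (sumOver-product f g xs ys))

  -- Cycle types of all permutations

  Symmetric : (List ℕ → Carrier) → Set ℓ₁
  Symmetric f = ∀ {ks ls} → ks ↭ ls → f ks ≈ f ls

  -- The sum of f over the cycle types obtained by adding one point to a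
  -- permutation of cycle type ls, inside an existing cycle (grow) or anywhere
  -- (extend).
  grow : (List ℕ → Carrier) → List ℕ → Carrier
  grow f []       = 0#
  grow f (l ∷ ls) = fromℕ l * f (suc l ∷ ls) + grow (f ∘ (l ∷_)) ls

  extend : (List ℕ → Carrier) → List ℕ → Carrier
  extend f ls = f (1 ∷ ls) + grow f ls

  grow-cong : ∀ {f g} → (∀ ls → f ls ≈ g ls) → ∀ ls → grow f ls ≈ grow g ls
  grow-cong f≈g []       = ≈-refl
  grow-cong f≈g (l ∷ ls) = +-cong (*-congˡ (f≈g _)) (grow-cong (f≈g ∘ (l ∷_)) ls)

  extend-cong : ∀ {f g} → (∀ ls → f ls ≈ g ls) → ∀ ls → extend f ls ≈ extend g ls
  extend-cong f≈g ls = +-cong (f≈g _) (grow-cong f≈g ls)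

  grow-symmetric : ∀ {f} → Symmetric f → Symmetric (grow f)
  grow-symmetric sym-f ↭-id         = ≈-refl
  grow-symmetric sym-f (prep x p)   = +-cong (*-congˡ (sym-f (prep (suc x) p)))
    (grow-symmetric (sym-f ∘ prep x) p)
  grow-symmetric {f} sym-f (swap {ks} {ls} x y p) = begin
    fromℕ x * f (suc x ∷ y ∷ ks) + (fromℕ y * f (x ∷ suc y ∷ ks) + grow (f ∘ (x ∷_) ∘ (y ∷_)) ks)
      ≈⟨ +-cong (*-congˡ (sym-f (swap (suc x) y p))) (+-cong (*-congˡ (sym-f (swap x (suc y) p)))
           (≈-trans (grow-cong (λ _ → sym-f (swap x y ↭-refl)) ks) (grow-symmetric (sym-f ∘ prep y ∘ prep x) p))) ⟩
    fromℕ x * f (y ∷ suc x ∷ ls) + (fromℕ y * f (suc y ∷ x ∷ ls) + grow (f ∘ (y ∷_) ∘ (x ∷_)) ls)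
      ≈⟨ solve 3 (λ p q r → p :+ (q :+ r) := q :+ (p :+ r)) ≈-refl _ _ _ ⟩
    fromℕ y * f (suc y ∷ x ∷ ls) + (fromℕ x * f (y ∷ suc x ∷ ls) + grow (f ∘ (y ∷_) ∘ (x ∷_)) ls)
      ∎
    where open ≈-R
  grow-symmetric sym-f (↭-tr p q)   = ≈-trans (grow-symmetric sym-f p) (grow-symmetric sym-f q)

  extend-symmetric : ∀ {f} → Symmetric f → Symmetric (extend f)
  extend-symmetric sym-f p = +-cong (sym-f (prep 1 p)) (grow-symmetric sym-f p)

  -- `grow` lengthens a cycle in place, whereas an insertion puts the lengthened cycle in front;
  -- symmetry of `f` reconciles them. Uniqueness ensures that the filter removes exactly one entry.
  grow-map : ∀ {n} {f} (len : Fin n → ℕ) → Symmetric f → ∀ {xs} → Unique xs →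
    sumOver (λ m → fromℕ (len m) * f (suc (len m) ∷ map len (filter (λ x → ¬? (x Fin.≟ m)) xs))) xs
      ≈ grow f (map len xs)
  grow-map {n} {f} len sym-f [] = ≈-refl
  grow-map {n} {f} len sym-f {x ∷ xs} (x∉ ∷ u) = +-cong
    (*-congˡ (reflexive (≡.cong (λ ys → f (suc (len x) ∷ map len ys))
      (≡.trans (List.filter-reject (without x) (λ x≢x → x≢x ≡.refl))
               (List.filter-all (without x) (All.map (λ x≢y y≡x → x≢y (≡.sym y≡x)) x∉))))))
    (≈-trans
      (sumOver-cong xs λ {m} m∈ → *-congˡ (≈-trans
        (reflexive (≡.cong (λ ys → f (suc (len m) ∷ map len ys)) (List.filter-accept (without m) (All.lookup x∉ m∈))))
        (sym-f (swap (suc (len m)) (len x) ↭-refl))))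
      (grow-map len (sym-f ∘ prep (len x)) u))
    where
    without : ∀ m (y : Fin n) → Dec (y ≢ m)
    without m y = ¬? (y Fin.≟ m)

  -- All points of one cycle yield the same cycle type, so after grouping by orbits a cycle of
  -- length l contributes l equal terms, the factor in `grow`.
  sum-insertions : ∀ {n f} → Symmetric f → (ρ : Permutation′ n) →
    sumOver (λ j → f (Orbits.cycleType (lift₀ ρ ∘ₚ transpose 0F j))) (allFin (suc n))
      ≈ extend f (Orbits.cycleType ρ)
  sum-insertions {n} {f} sym-f ρ = +-cong
    (reflexive (≡.cong f (cycleType-insert-0 ρ)))
    (begin
      sumOver F (tabulate Fin.suc)
        ≡⟨ ≡.cong (sumOver F) (List.map-tabulate id Fin.suc) ⟨
      sumOver F (map Fin.suc (allFin n))
        ≈⟨ sumOver-map F Fin.suc (allFin n) ⟩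
      sumOver (F ∘ Fin.suc) (allFin n)
        ≈⟨ sumOver-↭ (F ∘ Fin.suc) orbits↭allFin ⟨
      sumOver (F ∘ Fin.suc) (concatMap orbit minima)
        ≈⟨ sumOver-concatMap (F ∘ Fin.suc) orbit minima ⟩
      sumOver (λ m → sumOver (F ∘ Fin.suc) (orbit m)) minima
        ≈⟨ sumOver-cong minima (λ {m} m∈ → begin
             sumOver (F ∘ Fin.suc) (orbit m)
               ≈⟨ sumOver-cong (orbit m) (λ {j} j∈ → reflexive (≡.trans (≡.cong f (cycleType-insert ρ j))
                    (≡.cong₂ (λ l r → f (suc l ∷ map len (filter (λ x → ¬? (x Fin.≟ r)) minima)))
                      (≡.sym (len-~ (∈orbit⇒~ j∈))) (rep-unique (minima-min m∈) (∈orbit⇒~ j∈))))) ⟩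
             sumOver (λ _ → G m) (orbit m)
               ≈⟨ sumOver-const (G m) (orbit m) ⟩
             fromℕ (length (orbit m)) * G m
               ≡⟨ ≡.cong (λ l → fromℕ l * G m) (List.length-applyUpTo (λ k → iter ρ k m) (len m)) ⟩
             fromℕ (len m) * G m
               ∎) ⟩
      sumOver (λ m → fromℕ (len m) * G m) minima
        ≈⟨ grow-map len sym-f minima-unique ⟩
      grow f cycleType
        ∎)
    where
    open ≈-R
    open Orbits ρ
    F : Fin (suc n) → Carrier
    F j = f (Orbits.cycleType (lift₀ ρ ∘ₚ transpose 0F j))
    G : Fin n → Carrier
    G m = f (suc (len m) ∷ map len (filter (λ x → ¬? (x Fin.≟ m)) minima))

  extendⁿ : ℕ → (List ℕ → Carrier) → List ℕ → Carrier
  extendⁿ n f = fold f extend n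

  extendⁿ-commutes : ∀ n f → extendⁿ n (extend f) ≡ extend (extendⁿ n f)
  extendⁿ-commutes zero    f = ≡.refl
  extendⁿ-commutes (suc n) f = ≡.cong extend (extendⁿ-commutes n f)

  extendⁿ-symmetric : ∀ n {f} → Symmetric f → Symmetric (extendⁿ n f)
  extendⁿ-symmetric zero    sym-f = sym-f
  extendⁿ-symmetric (suc n) sym-f = extend-symmetric (extendⁿ-symmetric n sym-f)

  extendⁿ-cong : ∀ n {f g} → (∀ ls → f ls ≈ g ls) → ∀ ls → extendⁿ n f ls ≈ extendⁿ n g ls
  extendⁿ-cong zero    f≈g = f≈g
  extendⁿ-cong (suc n) f≈g = extend-cong (extendⁿ-cong n f≈g)

  -- With the sums exchanged, summing out the last insertion turns `f` into `extend f`; the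
  -- induction therefore ranges over all symmetric `f`.
  sum-cycleTypes : ∀ n {f} → Symmetric f → sumOver (f ∘ Orbits.cycleType) (perms n) ≈ extendⁿ n f []
  sum-cycleTypes zero    sym-f = +-identityʳ _
  sum-cycleTypes (suc n) {f} sym-f = begin
    sumOver (f ∘ Orbits.cycleType) (perms (suc n))
      ≈⟨ sumOver-product (f ∘ Orbits.cycleType) (λ j ρ → lift₀ ρ ∘ₚ transpose 0F j) (allFin (suc n)) (perms n) ⟩
    sumOver (λ j → sumOver (λ ρ → f (Orbits.cycleType (lift₀ ρ ∘ₚ transpose 0F j))) (perms n)) (allFin (suc n))
      ≈⟨ sumOver-comm (λ j ρ → f (Orbits.cycleType (lift₀ ρ ∘ₚ transpose 0F j))) (allFin (suc n)) (perms n) ⟩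
    sumOver (λ ρ → sumOver (λ j → f (Orbits.cycleType (lift₀ ρ ∘ₚ transpose 0F j))) (allFin (suc n))) (perms n)
      ≈⟨ sumOver-cong (perms n) (λ {ρ} _ → sum-insertions sym-f ρ) ⟩
    sumOver (extend f ∘ Orbits.cycleType) (perms n)
      ≈⟨ sum-cycleTypes n (extend-symmetric sym-f) ⟩
    extendⁿ n (extend f) []
      ≡⟨ ≡.cong (λ g → g []) (extendⁿ-commutes n f) ⟩
    extendⁿ (suc n) f []
      ∎
    where open ≈-R

  grow-+ : ∀ f g ls → grow (λ ls → f ls + g ls) ls ≈ grow f ls + grow g ls
  grow-+ f g []       = ≈-sym (+-identityˡ 0#)
  grow-+ f g (l ∷ ls) = ≈-trans (+-congˡ (grow-+ (f ∘ (l ∷_)) (g ∘ (l ∷_)) ls))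
    (solve 5 (λ l a b p q → l :* (a :+ b) :+ (p :+ q) := l :* a :+ p :+ (l :* b :+ q)) ≈-refl _ _ _ _ _)

  grow-* : ∀ k f ls → grow (λ ls → k * f ls) ls ≈ k * grow f ls
  grow-* k f []       = ≈-sym (zeroʳ k)
  grow-* k f (l ∷ ls) = ≈-trans (+-congˡ (grow-* k (f ∘ (l ∷_)) ls))
    (solve 4 (λ k l a p → l :* (k :* a) :+ k :* p := k :* (l :* a :+ p)) ≈-refl k _ _ _)

  extend-+ : ∀ f g ls → extend (λ ls → f ls + g ls) ls ≈ extend f ls + extend g ls
  extend-+ f g ls = ≈-trans (+-congˡ (grow-+ f g ls))
    (solve 4 (λ a b p q → a :+ b :+ (p :+ q) := a :+ p :+ (b :+ q)) ≈-refl _ _ _ _)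

  extend-* : ∀ k f ls → extend (λ ls → k * f ls) ls ≈ k * extend f ls
  extend-* k f ls = ≈-trans (+-congˡ (grow-* k f ls)) (≈-sym (distribˡ k _ _))

  extend-conv : ∀ a (h : ℕ → List ℕ → Carrier) n ls →
    extend (λ ls → conv a (λ k → h k ls) n) ls ≈ conv a (λ k → extend (h k) ls) n
  extend-conv a h zero    ls = extend-* (a 0) (h 0) ls
  extend-conv a h (suc n) ls = ≈-trans
    (extend-+ (λ ls → a 0 * h (suc n) ls) (λ ls → conv (a ∘ suc) (λ k → h k ls) n) ls)
    (+-cong (extend-* (a 0) (h (suc n)) ls) (extend-conv (a ∘ suc) h n ls))

  -- Weighted sums over cycle types and the growth of a marked cycle.

  prodOver : (ℕ → Carrier) → List ℕ → Carrier
  prodOver σ ls = foldr _*_ 1# (map σ ls)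

  prodOver-↭ : ∀ σ {ks ls} → ks ↭ ls → prodOver σ ks ≈ prodOver σ ls
  prodOver-↭ σ ↭-id         = ≈-refl
  prodOver-↭ σ (prep x p)   = *-congˡ (prodOver-↭ σ p)
  prodOver-↭ σ (swap x y p) = ≈-trans (*-congˡ (*-congˡ (prodOver-↭ σ p)))
    (solve 3 (λ p q r → p :* (q :* r) := q :* (p :* r)) ≈-refl (σ x) (σ y) _)
  prodOver-↭ σ (↭-tr p q)   = ≈-trans (prodOver-↭ σ p) (prodOver-↭ σ q)

  -- The rising factorial l (l + 1) ... (l + k - 1).
  rise : ℕ → ℕ → ℕ
  rise l zero    = 1
  rise l (suc k) = l ℕ.* rise (suc l) k

  rise-! : ∀ l k → rise (suc l) k ℕ.* l ! ≡ (l ℕ.+ k) !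
  rise-! l zero    = ≡.trans (ℕ.*-identityˡ (l !)) (≡.cong _! (≡.sym (ℕ.+-identityʳ l)))
  rise-! l (suc k) = ≡.trans (x∙y∙z≡y∙[x∙z] (suc l) (rise (suc (suc l)) k) (l !))
    (≡.trans (rise-! (suc l) k) (≡.cong _! (≡.sym (ℕ.+-suc l k))))
    where
    open import Algebra.Properties.CommutativeSemigroup ℕ.*-commutativeSemigroup
      using () renaming (xy∙z≈y∙xz to x∙y∙z≡y∙[x∙z])

  module CycleWeights (σ : ℕ → Carrier) where

    W : (ℕ → Carrier) → List ℕ → Carrier
    W φ ls = φ (length ls) * prodOver σ ls

    W-symmetric : ∀ φ → Symmetric (W φ)
    W-symmetric φ p = *-cong (reflexive (≡.cong φ (↭.↭-length p))) (prodOver-↭ σ p)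

    g : (ℕ → Carrier) → ℕ → List ℕ → Carrier
    g φ n ls = 1/! n * extendⁿ n (W φ) ls

    -- A cycle of length l reaches length l + k by k of the insertions in
    -- rise l k ways.
    coeff : ℕ → ℕ → Carrier
    coeff l k = fromℕ (rise l k) * 1/! k * σ (l ℕ.+ k)

    coeff-suc : ∀ l k → fromℕ (suc k) * coeff l (suc k) ≈ fromℕ l * coeff (suc l) k
    coeff-suc l k = begin
      fromℕ (suc k) * (fromℕ (l ℕ.* rise (suc l) k) * 1/! (suc k) * σ (l ℕ.+ suc k))
        ≈⟨ solve 4 (λ k r f s → k :* (r :* f :* s) := r :* (k :* f) :* s) ≈-refl (fromℕ (suc k)) _ _ _ ⟩
      fromℕ (l ℕ.* rise (suc l) k) * (fromℕ (suc k) * 1/! (suc k)) * σ (l ℕ.+ suc k)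
        ≈⟨ *-cong (*-cong (fromℕ-* l _) (1/!-suc k)) (reflexive (≡.cong σ (ℕ.+-suc l k))) ⟩
      fromℕ l * fromℕ (rise (suc l) k) * 1/! k * σ (suc l ℕ.+ k)
        ≈⟨ solve 4 (λ l r f s → l :* r :* f :* s := l :* (r :* f :* s)) ≈-refl (fromℕ l) _ _ _ ⟩
      fromℕ l * coeff (suc l) k
        ∎
      where open ≈-R

    g-suc : ∀ φ n ls → fromℕ (suc n) * g φ (suc n) ls ≈ extend (g φ n) ls
    g-suc φ n ls = ≈-trans (≈-sym (*-assoc _ _ _))
      (≈-trans (*-congʳ (1/!-suc n)) (≈-sym (extend-* (1/! n) (extendⁿ n (W φ)) ls)))

    -- Insertions into the first cycle and insertions elsewhere are independent: 1/n! absorbs the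
    -- choice of which are which, leaving a Cauchy product, and `φ ∘ suc` accounts for the first
    -- cycle. The proof checks that both sides satisfy the same equation for `θ`.
    g-cons : ∀ φ n l ls → g φ n (l ∷ ls) ≈ conv (coeff l) (λ k → g (φ ∘ suc) k ls) n
    g-cons φ zero l ls = begin
      1/! 0 * (φ (suc (length ls)) * (σ l * prodOver σ ls))
        ≈⟨ *-congʳ 1/!-0 ⟩
      1# * (φ (suc (length ls)) * (σ l * prodOver σ ls))
        ≈⟨ solve 3 (λ f s p → 𝟙 :* (f :* (s :* p)) := (𝟙 :+ 𝟘) :* 𝟙 :* s :* (𝟙 :* (f :* p))) ≈-refl
             (φ (suc (length ls))) (σ l) (prodOver σ ls) ⟩
      fromℕ 1 * 1# * σ l * (1# * (φ (suc (length ls)) * prodOver σ ls))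
        ≈⟨ *-cong (*-cong (*-congˡ 1/!-0) (reflexive (≡.cong σ (ℕ.+-identityʳ l)))) (*-congʳ 1/!-0) ⟨
      fromℕ 1 * 1/! 0 * σ (l ℕ.+ 0) * (1/! 0 * (φ (suc (length ls)) * prodOver σ ls))
        ∎
      where open ≈-R
    g-cons φ (suc n) l ls = *-cancelˡ-≈ (fromℕ (suc n)) (fromℕ-pos n) (begin
      fromℕ (suc n) * g φ (suc n) (l ∷ ls)
        ≈⟨ g-suc φ n (l ∷ ls) ⟩
      g φ n (1 ∷ l ∷ ls) + (fromℕ l * g φ n (suc l ∷ ls) + grow (g φ n ∘ (l ∷_)) ls)
        -- A freshly started cycle belongs to the rest, so it is moved behind the marked one to
        -- complete `extend` on `ls`.
        ≈⟨ +-congʳ (*-congˡ (extendⁿ-symmetric n (W-symmetric φ) (swap 1 l ↭-refl))) ⟩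
      g φ n (l ∷ 1 ∷ ls) + (fromℕ l * g φ n (suc l ∷ ls) + grow (g φ n ∘ (l ∷_)) ls)
        ≈⟨ solve 3 (λ a b c → a :+ (b :+ c) := b :+ (a :+ c)) ≈-refl _ _ _ ⟩
      fromℕ l * g φ n (suc l ∷ ls) + extend (g φ n ∘ (l ∷_)) ls
        ≈⟨ +-cong (*-congˡ (g-cons φ n (suc l) ls)) (extend-cong (g-cons φ n l) ls) ⟩
      fromℕ l * conv (coeff (suc l)) h n + extend (λ ls → conv (coeff l) (λ k → g (φ ∘ suc) k ls) n) ls
        ≈⟨ +-congˡ (extend-conv (coeff l) (g (φ ∘ suc)) n ls) ⟩
      fromℕ l * conv (coeff (suc l)) h n + conv (coeff l) (λ k → extend (g (φ ∘ suc) k) ls) n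
        ≈⟨ +-cong (conv-*ˡ (fromℕ l) (coeff (suc l)) h n)
             (conv-cong n (λ _ → ≈-refl) (λ k _ → g-suc (φ ∘ suc) k ls)) ⟨
      conv (λ k → fromℕ l * coeff (suc l) k) h n + conv (coeff l) (θ h ∘ suc) n
        ≈⟨ +-congʳ (conv-cong n (λ k → ≈-sym (coeff-suc l k)) (λ _ _ → ≈-refl)) ⟩
      conv (θ (coeff l) ∘ suc) h n + conv (coeff l) (θ h ∘ suc) n
        ≈⟨ +-cong (conv-0ˡ (θ (coeff l)) h n (zeroˡ _)) (conv-0ʳ (coeff l) (θ h) n (zeroˡ _)) ⟨
      conv (θ (coeff l)) h (suc n) + conv (coeff l) (θ h) (suc n)
        ≈⟨ conv-Leibniz (coeff l) h (suc n) ⟨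
      fromℕ (suc n) * conv (coeff l) h (suc n)
        ∎)
      where
      open ≈-R
      h : ℕ → Carrier
      h k = g (φ ∘ suc) k ls

    -- A single point grows into a cycle of length k + 1 in k! ways, which cancels 1/k!.
    coeff-1 : ∀ k → coeff 1 k ≈ σ (suc k)
    coeff-1 k = ≈-trans (*-congʳ (≈-trans
      (*-congʳ (reflexive (≡.cong fromℕ (≡.trans (≡.sym (ℕ.*-identityʳ (rise 1 k))) (rise-! 0 k)))))
      (n!*1/!n≈1 k))) (*-identityˡ _)

    open Coefficients (σ ∘ suc) using (mix; mix-unique)

    -- From the empty permutation the first insertion can only start a cycle; following that cycle
    -- with `g-cons` gives the recurrence that determines `mix`.
    g≈mix : ∀ φ n → g φ n [] ≈ mix φ n
    g≈mix φ = mix-unique (λ j n → g (λ r → φ (j ℕ.+ r)) n []) φ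
      (λ j → begin
        1/! 0 * (φ (j ℕ.+ 0) * 1#)   ≈⟨ *-cong 1/!-0 (*-congʳ (reflexive (≡.cong φ (ℕ.+-identityʳ j)))) ⟩
        1# * (φ j * 1#)              ≈⟨ solve 1 (λ f → 𝟙 :* (f :* 𝟙) := f) ≈-refl (φ j) ⟩
        φ j                          ∎)
      (λ j n → begin
        fromℕ (suc n) * g (λ r → φ (j ℕ.+ r)) (suc n) []
          ≈⟨ g-suc (λ r → φ (j ℕ.+ r)) n [] ⟩
        g (λ r → φ (j ℕ.+ r)) n (1 ∷ []) + 0#
          ≈⟨ +-identityʳ _ ⟩
        g (λ r → φ (j ℕ.+ r)) n (1 ∷ [])
          ≈⟨ g-cons (λ r → φ (j ℕ.+ r)) n 1 [] ⟩
        conv (coeff 1) (λ k → g (λ r → φ (j ℕ.+ suc r)) k []) n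
          ≈⟨ conv-cong n coeff-1 (λ k _ → *-congˡ (extendⁿ-cong k
               (λ ls → *-congʳ (reflexive (≡.cong φ (ℕ.+-suc j (length ls))))) [])) ⟩
        conv (σ ∘ suc) (λ k → g (λ r → φ (suc j ℕ.+ r)) k []) n
          ∎)
      where open ≈-R

  -- Weights as products over cycles

  private
    module ∏ where
      open import Algebra.Properties.CommutativeMonoid.Sum *-commutativeMonoid public
        using () renaming (∑-distrib-+ to distrib; sum-cong-≋ to cong)

  ∏-single : ∀ {n} (t : Fin n → Carrier) i → (∀ j → j ≢ i → t j ≈ 1#) → product t ≈ t i
  ∏-single t Fin.zero    t≈1 = ≈-trans (*-congˡ (∏-one _ (λ j → t≈1 (Fin.suc j) λ ()))) (*-identityʳ _)
    where
    ∏-one : ∀ {n} (t : Fin n → Carrier) → (∀ j → t j ≈ 1#) → product t ≈ 1#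
    ∏-one {zero}  t t≈1 = ≈-refl
    ∏-one {suc n} t t≈1 = ≈-trans (*-cong (t≈1 Fin.zero) (∏-one (t ∘ Fin.suc) (t≈1 ∘ Fin.suc))) (*-identityˡ 1#)
  ∏-single t (Fin.suc i) t≈1 = ≈-trans
    (*-cong (t≈1 Fin.zero λ ()) (∏-single (t ∘ Fin.suc) i (λ j j≢i → t≈1 (Fin.suc j) (j≢i ∘ Fin.suc-injective))))
    (*-identityˡ _)

  -- One more cycle of length l changes only the factor at l, by `σ l`; the bounds place l within
  -- the range of the product.
  ∏-counts : ∀ σ n ls → All (λ l → 0 ℕ.< l × l ℕ.≤ n) ls →
    product {n} (λ i → σ (suc (toℕ i)) ^ length (filter (suc (toℕ i) ℕ.≟_) ls)) ≈ prodOver σ ls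
  ∏-counts σ zero    []       [] = ≈-refl
  ∏-counts σ (suc n) []       [] = ≈-trans (*-identityˡ _) (∏-counts (σ ∘ suc) n [] [])
  ∏-counts σ n (suc l ∷ ls) ((_ , l<n) ∷ bounds) = begin
    product {n} (λ i → s i ^ length (filter (suc (toℕ i) ℕ.≟_) (suc l ∷ ls)))
      ≈⟨ ∏.cong {n} split ⟩
    product {n} (λ i → δ i * s i ^ length (filter (suc (toℕ i) ℕ.≟_) ls))
      ≈⟨ ∏.distrib {n} δ (λ i → s i ^ length (filter (suc (toℕ i) ℕ.≟_) ls)) ⟩
    product {n} δ * product {n} (λ i → s i ^ length (filter (suc (toℕ i) ℕ.≟_) ls))
      ≈⟨ *-cong (≈-trans (∏-single δ (fromℕ< l<n) δ-other) δ-here) (∏-counts σ n ls bounds) ⟩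
    σ (suc l) * prodOver σ ls
      ∎
    where
    open ≈-R
    s δ : Fin n → Carrier
    s i = σ (suc (toℕ i))
    δ i = s i ^ length (filter (suc (toℕ i) ℕ.≟_) (suc l ∷ []))

    δ-here : δ (fromℕ< l<n) ≈ σ (suc l)
    δ-here = ≈-trans (reflexive (≡.cong₂ (λ a b → σ (suc a) ^ b) (Fin.toℕ-fromℕ< l<n)
      (≡.cong length (List.filter-accept (suc (toℕ (fromℕ< l<n)) ℕ.≟_) (≡.cong suc (Fin.toℕ-fromℕ< l<n))))))
      (*-identityʳ _)

    δ-other : ∀ j → j ≢ fromℕ< l<n → δ j ≈ 1#
    δ-other j j≢ = reflexive (≡.cong (λ ys → s j ^ length ys) (List.filter-reject (suc (toℕ j) ℕ.≟_) {x = suc l} {xs = []}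
      (λ e → j≢ (Fin.toℕ-injective (≡.trans (ℕ.suc-injective e) (≡.sym (Fin.toℕ-fromℕ< l<n)))))))

    split : ∀ i → s i ^ length (filter (suc (toℕ i) ℕ.≟_) (suc l ∷ ls)) ≈
                  δ i * s i ^ length (filter (suc (toℕ i) ℕ.≟_) ls)
    split i = ≈-trans
      (reflexive (≡.cong (s i ^_) (≡.trans (≡.cong length (List.filter-++ (suc (toℕ i) ℕ.≟_) (suc l ∷ []) ls))
        (List.length-++ (filter (suc (toℕ i) ℕ.≟_) (suc l ∷ []))))))
      (Exp.^-homo-* (s i) (length (filter (suc (toℕ i) ℕ.≟_) (suc l ∷ []))) (length (filter (suc (toℕ i) ℕ.≟_) ls)))

  weight≈prodOver : ∀ σ {n} (π : Permutation′ n) → weight σ π ≈ prodOver σ (Orbits.cycleType π)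
  weight≈prodOver σ {n} π = ≈-trans
    (∏.cong {n} (λ i → reflexive (≡.cong (σ (suc (toℕ i)) ^_) (#cyclesOfLength≡count (suc (toℕ i)) π))))
    (∏-counts σ n cycleType (All.map⁺ (All.tabulate (λ {j} _ → 0<len j , len≤n j))))
    where open Orbits π

  sum-perms : ∀ σ φ n → 1/! n * sumOver (λ π → φ (#cycles π) * weight σ π) (perms n) ≈ Coefficients.mix (σ ∘ suc) φ n
  sum-perms σ φ n = ≈-trans (*-congˡ (≈-trans
    (sumOver-cong (perms n) (λ {π} _ → *-cong (reflexive (≡.cong φ (#cycles≡length π))) (weight≈prodOver σ π)))
    (sum-cycleTypes n (W-symmetric φ)))) (g≈mix φ n)
    where open CycleWeights σ

  -- Moments of the Boltzmann measure

  1/≤1 : ∀ n → 1/ (suc n) ≤ 1#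
  1/≤1 n = *-cancelˡ-≤ (fromℕ (suc n)) (fromℕ-pos n) (≤-resp (≈-sym (n*1/n≈1 (suc n))) (≈-sym (*-identityʳ _))
    (≤-by (fromℕ n) (fromℕ-nonneg n) ≈-refl))

  product-nonneg : ∀ {n} (t : Fin n → Carrier) → (∀ i → 0# ≤ t i) → 0# ≤ product t
  product-nonneg {zero}  t 0≤t = 0≤1
  product-nonneg {suc n} t 0≤t = *-nonneg (0≤t Fin.zero) (product-nonneg (t ∘ Fin.suc) (0≤t ∘ Fin.suc))

  exp≥1 : ∀ {u z} → 0# ≤ u → Sums (expTerm u) z → 1# ≤ z
  exp≥1 0≤u p = ≤-resp
    (≈-trans (∑-suc 0 _) (≈-trans (+-congˡ (∑-0 _)) (≈-trans (+-identityʳ _) (≈-trans (*-identityˡ _) 1/!-0))))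
    ≈-refl (∑≤Sums (expTerm-nonneg 0≤u) p 1)

  module Poisson {ℓ z} (0≤ℓ : 0# ≤ ℓ) (p : Sums (expTerm ℓ) z) where

    Sums-mass : Sums (λ r → 1# * expTerm ℓ r) z
    Sums-mass = Sums-cong (λ r → ≈-sym (*-identityˡ _)) ≈-refl p

    expTerm-suc : ∀ r → fromℕ (suc r) * expTerm ℓ (suc r) ≈ ℓ * expTerm ℓ r
    expTerm-suc r = ≈-trans
      (solve 4 (λ k l q f → k :* (l :* q :* f) := l :* (q :* (k :* f))) ≈-refl (fromℕ (suc r)) ℓ (ℓ ^ r) (1/! (suc r)))
      (*-congˡ (*-congˡ (1/!-suc r)))

    Sums-mean : Sums (λ r → fromℕ r * expTerm ℓ r) (ℓ * z)
    Sums-mean = Sums-cong (λ _ → ≈-refl) (≈-trans (+-congʳ (zeroˡ _)) (+-identityˡ _))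
      (Sums-suc (Sums-cong (λ r → ≈-sym (expTerm-suc r)) ≈-refl (Sums-*ˡ ℓ 0≤ℓ p)))

    Sums-square : Sums (λ r → fromℕ r * fromℕ r * expTerm ℓ r) (ℓ * (ℓ * z + z))
    Sums-square = Sums-cong (λ _ → ≈-refl)
      (≈-trans (+-congʳ (≈-trans (*-congʳ (zeroˡ _)) (zeroˡ _))) (+-identityˡ _))
      (Sums-suc (Sums-cong (λ r → ≈-sym (begin
          fromℕ (suc r) * fromℕ (suc r) * expTerm ℓ (suc r)    ≈⟨ *-assoc _ _ _ ⟩
          fromℕ (suc r) * (fromℕ (suc r) * expTerm ℓ (suc r))  ≈⟨ *-congˡ (expTerm-suc r) ⟩
          (1# + fromℕ r) * (ℓ * expTerm ℓ r)
            ≈⟨ solve 3 (λ k l t → (𝟙 :+ k) :* (l :* t) := l :* (k :* t :+ t)) ≈-refl (fromℕ r) ℓ (expTerm ℓ r) ⟩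
          ℓ * (fromℕ r * expTerm ℓ r + expTerm ℓ r)            ∎))
        ≈-refl (Sums-*ˡ ℓ 0≤ℓ (Sums-+ Sums-mean p))))
      where open ≈-R

    -- Series are scaled only by non-negative numbers, so the square is expanded as k² + ℓ² = (k -
    -- ℓ)² + 2ℓk and the last series is cancelled.
    Sums-variance : Sums (λ r → (fromℕ r - ℓ) ^ 2 * expTerm ℓ r) (ℓ * z)
    Sums-variance = Sums-cancel-+
      (Sums-cong
        (λ r → solve 3 (λ k l t → k :* k :* t :+ l :* l :* t := (k :- l) :^ 2 :* t :+ (l :+ l) :* (k :* t)) ≈-refl
          (fromℕ r) ℓ (expTerm ℓ r))
        (solve 2 (λ l z → l :* (l :* z :+ z) :+ l :* l :* z := l :* z :+ (l :+ l) :* (l :* z)) ≈-refl ℓ z)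
        (Sums-+ Sums-square (Sums-*ˡ (ℓ * ℓ) (*-nonneg 0≤ℓ 0≤ℓ) p)))
      (Sums-*ˡ (ℓ + ℓ) (+-nonneg 0≤ℓ 0≤ℓ) Sums-mean)

  -- If the square were negative, `x` would be apart from zero, and its sign would be known.
  square-nonneg : ∀ x → 0# ≤ x ^ 2
  square-nonneg x x²<0 = [ (λ x<0 → let 0<-x = <-resp ≈-refl (+-identityˡ (- x)) (<⇒0<- x<0) in
                                     <-asym x²<0 (<-resp ≈-refl (solve 1 (λ x → (:- x) :* (:- x) := x :^ 2) ≈-refl x) (*-pos 0<-x 0<-x)))
                         , (λ 0<x → <-asym x²<0 (<-resp ≈-refl (solve 1 (λ x → x :* x := x :^ 2) ≈-refl x) (*-pos 0<x 0<x))) ]′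
    (#⇒< (*#0⇒#0 (<⇒# x²<0)))

  module Moments {σ : ℕ → Carrier} {x ℓ z : Carrier} (0≤s : IsWeighting σ) (0≤x : 0# ≤ x)
    (logZ : Sums (λ n → Coefficients.L (λ k → σ (suc k)) n * x ^ n) ℓ) (expZ : Sums (expTerm ℓ) z) (z#0 : z # 0#) where

    open Coefficients (σ ∘ suc)

    0≤ℓ : 0# ≤ ℓ
    0≤ℓ = Sums-nonneg (λ n → *-nonneg (L-nonneg 0≤s n) (^-nonneg n 0≤x)) logZ

    open Poisson 0≤ℓ expZ

    z⁻¹ : Carrier
    z⁻¹ = z ⁻¹[ z#0 ]

    0<z : 0# < z
    0<z = <-≤-trans 0<1 (exp≥1 0≤ℓ expZ)

    0≤z⁻¹ : 0# ≤ z⁻¹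
    0≤z⁻¹ = <⇒≤ (⁻¹-pos z#0 0<z)

    cancel-z : ∀ y → z⁻¹ * (y * z) ≈ y
    cancel-z y = ≈-trans (solve 3 (λ i y z → i :* (y :* z) := y :* (z :* i)) ≈-refl z⁻¹ y z)
      (≈-trans (*-congˡ (x*x⁻¹≈1 z#0)) (*-identityʳ y))

    -- Definitionally the density in `BoltzmannMeasure`, so the moments below hold for any given
    -- measure as well as for the one constructed later.
    ℙ : Ω → Carrier
    ℙ (n , π) = weight σ π * x ^ n * 1/! n * z⁻¹

    ℙ-nonneg : ∀ ω → 0# ≤ ℙ ω
    ℙ-nonneg (n , π) = *-nonneg (*-nonneg (*-nonneg
      (product-nonneg {n} _ (λ i → ^-nonneg (#cyclesOfLength (suc (toℕ i)) π) (0≤s (toℕ i))))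
      (^-nonneg n 0≤x)) (<⇒≤ (1/!-pos n))) 0≤z⁻¹

    level-sum : ∀ φ n → sumOver (λ π → φ (#cycles π) * ℙ (n , π)) (perms n) ≈ z⁻¹ * (mix φ n * x ^ n)
    level-sum φ n = begin
      sumOver (λ π → φ (#cycles π) * ℙ (n , π)) (perms n)
        ≈⟨ sumOver-cong (perms n) (λ {π} _ →
             solve 5 (λ f w p i j → f :* (w :* p :* i :* j) := j :* p :* i :* (f :* w)) ≈-refl
               (φ (#cycles π)) (weight σ π) (x ^ n) (1/! n) z⁻¹) ⟩
      sumOver (λ π → z⁻¹ * x ^ n * 1/! n * (φ (#cycles π) * weight σ π)) (perms n)
        ≈⟨ sumOver-*ˡ (z⁻¹ * x ^ n * 1/! n) (λ π → φ (#cycles π) * weight σ π) (perms n) ⟩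
      z⁻¹ * x ^ n * 1/! n * sumOver (λ π → φ (#cycles π) * weight σ π) (perms n)
        ≈⟨ solve 4 (λ j p i s → j :* p :* i :* s := j :* (i :* s :* p)) ≈-refl z⁻¹ (x ^ n) (1/! n) _ ⟩
      z⁻¹ * (1/! n * sumOver (λ π → φ (#cycles π) * weight σ π) (perms n) * x ^ n)
        ≈⟨ *-congˡ (*-congʳ (sum-perms σ φ n)) ⟩
      z⁻¹ * (mix φ n * x ^ n)
        ∎
      where open ≈-R

    𝔼-#cycles : ∀ φ {m} → (∀ r → 0# ≤ φ r) → Sums (λ r → φ r * expTerm ℓ r) (m * z) →
      IsExpectation ℙ (λ (_ , π) → φ (#cycles π)) m
    𝔼-#cycles φ {m} 0≤φ q = Sums⇒HasSum (Sums-cong (λ n → ≈-sym (level-sum φ n)) (cancel-z m)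
      (Sums-*ˡ z⁻¹ 0≤z⁻¹ (Sums-mix φ 0≤s 0≤φ 0≤x logZ q)))

    𝔼-1 : IsExpectation ℙ (λ _ → 1#) 1#
    𝔼-1 = 𝔼-#cycles (λ _ → 1#) (λ _ → 0≤1) (Sums-cong (λ _ → ≈-refl) (≈-sym (*-identityˡ z)) Sums-mass)

    𝔼-X : IsExpectation ℙ X ℓ
    𝔼-X = 𝔼-#cycles fromℕ fromℕ-nonneg Sums-mean

    𝕍-X : IsVariance ℙ X ℓ
    𝕍-X = ℓ , 𝔼-X , 𝔼-#cycles (λ r → (fromℕ r - ℓ) ^ 2) (λ r → square-nonneg _) Sums-variance

    -- For constant φ the recurrence `mix-suc` closes up; it says x Z′ = x ℓ′ Z, and weighting by
    -- the size becomes a Cauchy product.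
    𝔼-N : ∀ {t} → Sums (λ n → σ (suc n) * x ^ n) t → IsExpectation ℙ N (x * t)
    𝔼-N {t} p = Sums⇒HasSum (Sums-cong level (cancel-z (x * t)) (Sums-*ˡ z⁻¹ 0≤z⁻¹ θmix))
      where
      one : ℕ → Carrier
      one _ = 1#

      mix-sum : Sums (λ n → mix one n * x ^ n) z
      mix-sum = Sums-mix one 0≤s (λ _ → 0≤1) 0≤x logZ Sums-mass

      mix-nonneg : ∀ n → 0# ≤ mix one n
      mix-nonneg n = ∑-nonneg (suc n) (λ r → *-nonneg 0≤1 (e-nonneg 0≤s r n))

      θmix : Sums (λ n → θ (mix one) n * x ^ n) (x * t * z)
      θmix = Sums-cong (λ _ → ≈-refl)
        (≈-trans (+-congʳ (≈-trans (*-congʳ (zeroˡ _)) (zeroˡ _))) (≈-trans (+-identityˡ _) (≈-sym (*-assoc x t z))))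
        (Sums-suc (Sums-cong
          (λ n → ≈-trans (*-congˡ (≈-trans (conv-power x (σ ∘ suc) (mix one) n) (*-congʳ (≈-sym (mix-suc one n)))))
            (solve 3 (λ x a p → x :* (a :* p) := a :* (x :* p)) ≈-refl x (θ (mix one) (suc n)) (x ^ n)))
          ≈-refl
          (Sums-*ˡ x 0≤x (Sums-conv (λ n → *-nonneg (0≤s n) (^-nonneg n 0≤x))
            (λ n → *-nonneg (mix-nonneg n) (^-nonneg n 0≤x)) p mix-sum))))

      level : ∀ n → z⁻¹ * (θ (mix one) n * x ^ n) ≈ sumOver (λ π → fromℕ n * ℙ (n , π)) (perms n)
      level n = begin
        z⁻¹ * (fromℕ n * mix one n * x ^ n)
          ≈⟨ solve 4 (λ j n a p → j :* (n :* a :* p) := n :* (j :* (a :* p))) ≈-refl z⁻¹ (fromℕ n) (mix one n) (x ^ n) ⟩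
        fromℕ n * (z⁻¹ * (mix one n * x ^ n))
          ≈⟨ *-congˡ (level-sum one n) ⟨
        fromℕ n * sumOver (λ π → 1# * ℙ (n , π)) (perms n)
          ≈⟨ *-congˡ (sumOver-cong (perms n) (λ _ → *-identityˡ _)) ⟩
        fromℕ n * sumOver (λ π → ℙ (n , π)) (perms n)
          ≈⟨ sumOver-*ˡ (fromℕ n) (λ π → ℙ (n , π)) (perms n) ⟨
        sumOver (λ π → fromℕ n * ℙ (n , π)) (perms n)
          ∎
        where open ≈-R

  logZ-terms : ∀ {σ : ℕ → Carrier} {x ℓ} → Sums (λ k → σ (suc k) * x ^ suc k * 1/ (suc k)) ℓ →
               Sums (λ n → Coefficients.L (λ k → σ (suc k)) n * x ^ n) ℓ
  logZ-terms {σ} {x} p = Sums-cong (λ _ → ≈-refl) (≈-trans (+-congʳ (zeroˡ _)) (+-identityˡ _))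
    (Sums-suc {a = λ n → Coefficients.L (λ k → σ (suc k)) n * x ^ n} (Sums-cong
      (λ k → solve 3 (λ s p i → s :* p :* i := s :* i :* p) ≈-refl (σ (suc k)) (x ^ suc k) (1/ (suc k))) ≈-refl p))

  -- Convergence for x in (0,1) from the existence of the mean.

  module Mean {σ : ℕ → Carrier} {α : Carrier} (0≤s : IsWeighting σ) (mean : HasMean σ α) where

    s : ℕ → Carrier
    s = σ ∘ suc

    partialSums-near : ∀ δ → 0# < δ → ∃ λ M → ∀ n → M ℕ.≤ n →
      ∑ (suc n) s < (α + δ) * fromℕ (suc n) × α * fromℕ (suc n) < ∑ (suc n) s + δ * fromℕ (suc n)
    partialSums-near δ 0<δ =
      let M , close = mean δ 0<δ in
      M , λ n M≤n →
        let p , q = close n M≤n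
            scale : ∀ {u v} → u < v → u * fromℕ (suc n) < v * fromℕ (suc n)
            scale = *-monoˡ-< (fromℕ (suc n)) (fromℕ-pos n)
            back : 1/ (suc n) * ∑< (suc n) s * fromℕ (suc n) ≈ ∑ (suc n) s
            back = ≈-trans (solve 3 (λ i a k → i :* a :* k := k :* i :* a) ≈-refl (1/ (suc n)) (∑< (suc n) s) (fromℕ (suc n)))
              (≈-trans (*-congʳ (n*1/n≈1 (suc n))) (≈-trans (*-identityˡ _) (reflexive (≡.sym (∑≡∑< (suc n) s)))))
        in <-resp back ≈-refl (scale p) ,
           <-resp ≈-refl (≈-trans (distribʳ (fromℕ (suc n)) _ δ) (+-congʳ back)) (scale q)

    -- The mean controls the partial sums only from `M` on; the earlier ones lie below the constant
    -- `B`, and the sum of both bounds serves throughout.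
    linear-bound : ∃ λ A → ∀ n → ∑ (suc n) s ≤ fromℕ A * fromℕ (suc n)
    linear-bound =
      let M , near = partialSums-near 1# 0<1
          A , α+1<A = archimedean (α + 1#)
          B , ∑<B = archimedean (∑ (suc M) s)
          A≤ : fromℕ A ≤ fromℕ (A ℕ.+ B)
          A≤ = fromℕ-mono-≤ {A} {A ℕ.+ B} (ℕ.m≤m+n A B)
          B≤ : fromℕ B ≤ fromℕ (A ℕ.+ B)
          B≤ = fromℕ-mono-≤ {B} {A ℕ.+ B} (ℕ.m≤n+m B A)
      in A ℕ.+ B , λ n → [
        (λ n≤M → ≤-trans (∑-mono-range 0≤s (s≤s n≤M)) (≤-trans (<⇒≤ ∑<B) (≤-trans B≤
          (≤-by (fromℕ (A ℕ.+ B) * fromℕ n) (*-nonneg (fromℕ-nonneg (A ℕ.+ B)) (fromℕ-nonneg n))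
            (solve 2 (λ a n → a :* (𝟙 :+ n) := a :+ a :* n) ≈-refl (fromℕ (A ℕ.+ B)) (fromℕ n)))))) ,
        (λ M≤n → ≤-trans (<⇒≤ (proj₁ (near n M≤n)))
          (*-monoˡ-≤ (fromℕ (suc n)) (fromℕ-nonneg (suc n)) (≤-trans (<⇒≤ α+1<A) A≤))) ]′
        (ℕ.≤-total n M)

    module _ {x} (0≤x : 0# ≤ x) (x<1 : x < 1#) where

      term-nonneg : ∀ n → 0# ≤ s n * x ^ n
      term-nonneg n = *-nonneg (0≤s n) (^-nonneg n 0≤x)

      -- A single weight is bounded only through the partial sum that contains it, hence linearly in
      -- n; the majorant is the squared geometric series.
      Sums-powers : ∃ (Sums (λ n → s n * x ^ n))
      Sums-powers =
        let A , bound = linear-bound in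
        comparison-test term-nonneg
          (λ n → ≤-resp ≈-refl (*-assoc (fromℕ A) (fromℕ (suc n)) (x ^ n))
            (*-monoˡ-≤ (x ^ n) (^-nonneg n 0≤x) (≤-trans
              (≤-by (∑ n s) (∑-nonneg n 0≤s) (≈-trans (∑-last n s) (+-comm _ _))) (bound n))))
          (Sums-*ˡ (fromℕ A) (fromℕ-nonneg A) (Sums-geometric² 0≤x x<1 (x*x⁻¹≈1 (pos⇒#0 (<⇒0<- x<1)))))

      Sums-logZ : ∃ (Sums (λ k → s k * x ^ suc k * 1/ (suc k)))
      Sums-logZ = comparison-test
        (λ k → *-nonneg (*-nonneg (0≤s k) (^-nonneg (suc k) 0≤x)) (<⇒≤ (1/-pos (suc k))))
        (λ k → ≤-resp ≈-refl (*-identityʳ _) (*-mono-≤ (*-nonneg (0≤s k) (^-nonneg (suc k) 0≤x)) 0≤1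
          (*-monoʳ-≤ (s k) (0≤s k) (≤-resp ≈-refl (*-identityˡ _) (*-monoˡ-≤ (x ^ k) (^-nonneg k 0≤x) (<⇒≤ x<1)))) (1/≤1 k)))
        (proj₂ Sums-powers)

    moments : ∀ x → 0# < x → x < 1# → Σ (BoltzmannMeasure σ x) λ P → ∃ λ μ → ∃ λ m →
      𝔼[ P ] N ≈ μ × 𝔼[ P ] X ≈ m × 𝕍[ P ] X ≈ m
    moments x 0<x x<1 =
      let 0≤x = <⇒≤ 0<x
          ℓ , logZ = Sums-logZ 0≤x x<1
          0≤ℓ = Sums-nonneg (λ k → *-nonneg (*-nonneg (0≤s k) (^-nonneg (suc k) 0≤x)) (<⇒≤ (1/-pos (suc k)))) logZ
          z , expZ = exp-converges 0≤ℓ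
          z#0 = pos⇒#0 (<-≤-trans 0<1 (exp≥1 0≤ℓ expZ))
          t , powers = Sums-powers 0≤x x<1
          module M = Moments {σ} {x} {ℓ} {z} 0≤s 0≤x (logZ-terms {σ} logZ) expZ z#0
      in record
        { logZ = ℓ ; logZ-sum = Sums⇒HasSum logZ ; Z = z ; Z-exp = Sums⇒HasSum expZ ; Z#0 = z#0
        ; isProbability = M.ℙ-nonneg , M.𝔼-1 }
        , x * t , ℓ , M.𝔼-N powers , M.𝔼-X , M.𝕍-X

  -- Logarithms

  logTerm : Carrier → ℕ → Carrier
  logTerm x k = x ^ suc k * 1/ (suc k)

  logTerm-nonneg : ∀ {x} → 0# ≤ x → ∀ k → 0# ≤ logTerm x k
  logTerm-nonneg 0≤x k = *-nonneg (^-nonneg (suc k) 0≤x) (<⇒≤ (1/-pos (suc k)))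

  ^-antitone : ∀ {x} → 0# ≤ x → x ≤ 1# → ∀ k → x ^ suc k ≤ x ^ k
  ^-antitone {x} 0≤x x≤1 k = ≤-resp ≈-refl (*-identityˡ _) (*-monoˡ-≤ (x ^ k) (^-nonneg k 0≤x) x≤1)

  1/-antitone : ∀ k → 1/ (suc (suc k)) < 1/ (suc k)
  1/-antitone k = *-cancelˡ-< (fromℕ (suc k)) (fromℕ-pos k) (<-resp ≈-refl
    (≈-trans (n*1/n≈1 (suc (suc k))) (≈-sym (n*1/n≈1 (suc k))))
    (<-by (1/ (suc (suc k))) (1/-pos (suc (suc k)))
      (solve 2 (λ n i → (𝟙 :+ n) :* i := n :* i :+ i) ≈-refl (fromℕ (suc k)) (1/ (suc (suc k))))))

  logTerm-antitone : ∀ {x} → 0# ≤ x → x ≤ 1# → ∀ k → logTerm x (suc k) ≤ logTerm x k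
  logTerm-antitone 0≤x x≤1 k = *-mono-≤ (^-nonneg (suc (suc k)) 0≤x) (<⇒≤ (1/-pos (suc k)))
    (^-antitone 0≤x x≤1 (suc k)) (<⇒≤ (1/-antitone k))

  log-converges : ∀ {x} → 0# ≤ x → x < 1# → ∃ (Sums (logTerm x))
  log-converges {x} 0≤x x<1 = comparison-test (logTerm-nonneg 0≤x)
    (λ k → ≤-resp ≈-refl (*-identityʳ _)
      (*-mono-≤ (^-nonneg (suc k) 0≤x) 0≤1 (^-antitone 0≤x (<⇒≤ x<1) k) (1/≤1 k)))
    (Sums-geometric 0≤x x<1 (x*x⁻¹≈1 (pos⇒#0 (<⇒0<- x<1))))

  -- The exponential formula with all σₖ = 1, where the weights of Sₙ sum to n!.
  exp-log : ∀ {x t ℓ} → 0# ≤ x → x < 1# → (1# - x) * t ≈ 1# → Sums (logTerm x) ℓ → Sums (expTerm ℓ) t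
  exp-log {x} {t} {ℓ} 0≤x x<1 ht≈1 p =
    let z , expZ = exp-converges (Sums-nonneg (logTerm-nonneg 0≤x) p)
        mix-sum = Sums-mix one (λ _ → 0≤1) (λ _ → 0≤1) 0≤x logZ
                    (Sums-cong (λ r → ≈-sym (*-identityˡ _)) ≈-refl expZ)
        powers = Sums-cong (λ n → ≈-trans (*-congʳ (≈-sym (mix≈1 n))) (*-identityˡ _)) ≈-refl mix-sum
    in Sums-cong (λ _ → ≈-refl) (Sums-unique powers (Sums-geometric 0≤x x<1 ht≈1)) expZ
    where
    one : ℕ → Carrier
    one _ = 1#

    open Coefficients one

    logZ : Sums (λ n → L n * x ^ n) ℓ
    logZ = logZ-terms {one} (Sums-cong (λ k → ≈-sym (*-congʳ (*-identityˡ _))) ≈-refl p)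

    conv-one : ∀ n → conv one one n ≈ fromℕ (suc n)
    conv-one zero    = solve 0 (𝟙 :* 𝟙 := 𝟙 :+ 𝟘) ≈-refl
    conv-one (suc n) = +-cong (*-identityˡ 1#) (conv-one n)

    mix≈1 : ∀ n → 1# ≈ mix one n
    mix≈1 = mix-unique (λ _ _ → 1#) one (λ _ → ≈-refl)
      (λ _ n → ≈-trans (*-identityʳ _) (≈-sym (conv-one n)))

  -- The tangent line inequality for x ↦ xⁿ⁺¹ at y.
  power-convex : ∀ {x y} → 0# ≤ x → 0# ≤ y → ∀ n → fromℕ (suc n) * (x * y ^ n) ≤ x ^ suc n + fromℕ n * y ^ suc n
  power-convex {x} {y} 0≤x 0≤y zero = ≤-reflexive
    (solve 2 (λ x y → (𝟙 :+ 𝟘) :* (x :* 𝟙) := x :* 𝟙 :+ 𝟘 :* (y :* 𝟙)) ≈-refl x y)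
  power-convex {x} {y} 0≤x 0≤y (suc n) = ≤-by _
    (+-nonneg (*-nonneg 0≤x (≤⇒0≤- (power-convex 0≤x 0≤y n)))
      (*-nonneg (fromℕ-nonneg (suc n)) (*-nonneg (^-nonneg n 0≤y) (square-nonneg (x - y)))))
    (solve 5 (λ x y p q n → x :* (x :* p) :+ (𝟙 :+ n) :* (y :* (y :* q)) :=
        (𝟙 :+ (𝟙 :+ n)) :* (x :* (y :* q)) :+
        (x :* (x :* p :+ n :* (y :* q) :- (𝟙 :+ n) :* (x :* q)) :+ (𝟙 :+ n) :* (q :* (x :- y) :^ 2)))
      ≈-refl x y (x ^ n) (y ^ n) (fromℕ n))

  -- With u = log t and v = log t′ this is log t′ ≤ log t + t′/t - 1.
  log-concave : ∀ {x y t′ u v} → 0# ≤ x → 0# ≤ y → y < 1# → (1# - y) * t′ ≈ 1# →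
    Sums (logTerm x) u → Sums (logTerm y) v → v + 1# ≤ u + t′ * (1# - x)
  log-concave {x} {y} {t′} {u} {v} 0≤x 0≤y y<1 ht′≈1 p q = ≤-resp
    ≈-refl (solve 4 (λ x y t u → u :+ y :* t :+ ((𝟙 :- y) :* t :- x :* t) := u :+ t :* (𝟙 :- x)) ≈-refl x y t′ u)
    (≤-resp (≈-trans (+-congˡ (+-congʳ ht′≈1))
        (solve 3 (λ v a o → v :+ a :+ (o :- a) := v :+ o) ≈-refl v (x * t′) 1#)) ≈-refl
      (+-monoˡ-≤ ((1# - y) * t′ - x * t′) (Sums-mono-≤ termwise
        (Sums-+ q (Sums-*ˡ x 0≤x geometric)) (Sums-+ p (Sums-*ˡ y 0≤y geometric)))))
    where
    geometric : Sums (y ^_) t′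
    geometric = Sums-geometric 0≤y y<1 ht′≈1

    -- The tangent inequality for exponent k + 1, divided by k + 1, with the negative terms moved
    -- across so that all four series are non-negative.
    termwise : ∀ k → logTerm y k + x * y ^ k ≤ logTerm x k + y * y ^ k
    termwise k = *-cancelˡ-≤ (fromℕ (suc k)) (fromℕ-pos k) (≤-by _ (≤⇒0≤- (power-convex 0≤x 0≤y k)) (begin
      fromℕ (suc k) * (x ^ suc k * 1/ (suc k) + y ^ suc k)
        ≈⟨ clear (x ^ suc k) (y ^ suc k) ⟩
      x ^ suc k + fromℕ (suc k) * y ^ suc k
        ≈⟨ solve 4 (λ a b c k → a :+ (𝟙 :+ k) :* b := b :+ c :+ (a :+ k :* b :- c)) ≈-refl
             (x ^ suc k) (y ^ suc k) (fromℕ (suc k) * (x * y ^ k)) (fromℕ k) ⟩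
      y ^ suc k + fromℕ (suc k) * (x * y ^ k) + (x ^ suc k + fromℕ k * y ^ suc k - fromℕ (suc k) * (x * y ^ k))
        ≈⟨ +-congʳ (clear (y ^ suc k) (x * y ^ k)) ⟨
      fromℕ (suc k) * (y ^ suc k * 1/ (suc k) + x * y ^ k) +
        (x ^ suc k + fromℕ k * y ^ suc k - fromℕ (suc k) * (x * y ^ k))
        ∎))
      where
      open ≈-R
      clear : ∀ a b → fromℕ (suc k) * (a * 1/ (suc k) + b) ≈ a + fromℕ (suc k) * b
      clear a b = ≈-trans (solve 4 (λ n a i b → n :* (a :* i :+ b) := a :* (n :* i) :+ n :* b) ≈-refl
          (fromℕ (suc k)) a (1/ (suc k)) b)
        (+-congʳ (≈-trans (*-congˡ (n*1/n≈1 (suc k))) (*-identityʳ a)))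

  -- Comparison of weighted sums through partial sums

  ∑-const : ∀ n x → ∑ n (λ _ → x) ≈ fromℕ n * x
  ∑-const zero    x = ≈-trans (∑-0 _) (≈-sym (zeroˡ x))
  ∑-const (suc n) x = ≈-trans (∑-suc n _) (≈-trans (+-congˡ (∑-const n x))
    (solve 2 (λ n x → x :+ n :* x := (𝟙 :+ n) :* x) ≈-refl (fromℕ n) x))

  module _ {a b w : ℕ → Carrier} {d : Carrier} (∑a≤∑b+d : ∀ n → ∑ n a ≤ ∑ n b + d)
    (0≤w : ∀ k → 0# ≤ w k) (w-antitone : ∀ k → w (suc k) ≤ w k) where

    -- Summation by parts; the slack on the left drives the induction.
    ∑-abel : ∀ n → ∑ n (λ k → a k * w k) + (∑ n b + d - ∑ n a) * w n ≤ ∑ n (λ k → b k * w k) + d * w 0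
    ∑-abel zero    = ≤-reflexive (≈-trans
      (+-cong (∑-0 _) (*-congʳ (+-cong (+-congʳ (∑-0 b)) (-‿cong (∑-0 a)))))
      (≈-trans (solve 2 (λ d w → 𝟘 :+ (𝟘 :+ d :- 𝟘) :* w := 𝟘 :+ d :* w) ≈-refl d (w 0))
        (+-congʳ (≈-sym (∑-0 _)))))
    ∑-abel (suc n) = begin
      ∑ (suc n) (λ k → a k * w k) + (∑ (suc n) b + d - ∑ (suc n) a) * w (suc n)
        ≤⟨ +-monoʳ-≤ (∑ (suc n) (λ k → a k * w k))
             (*-monoʳ-≤ (∑ (suc n) b + d - ∑ (suc n) a) (≤⇒0≤- (∑a≤∑b+d (suc n))) (w-antitone n)) ⟩
      ∑ (suc n) (λ k → a k * w k) + (∑ (suc n) b + d - ∑ (suc n) a) * w n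
        ≈⟨ +-cong (∑-last n _) (*-congʳ (+-cong (+-congʳ (∑-last n b)) (-‿cong (∑-last n a)))) ⟩
      ∑ n (λ k → a k * w k) + a n * w n + (∑ n b + b n + d - (∑ n a + a n)) * w n
        ≈⟨ solve 7 (λ S a w B b d A → S :+ a :* w :+ (B :+ b :+ d :- (A :+ a)) :* w := S :+ (B :+ d :- A) :* w :+ b :* w)
             ≈-refl (∑ n (λ k → a k * w k)) (a n) (w n) (∑ n b) (b n) d (∑ n a) ⟩
      ∑ n (λ k → a k * w k) + (∑ n b + d - ∑ n a) * w n + b n * w n
        ≤⟨ +-monoˡ-≤ (b n * w n) (∑-abel n) ⟩
      ∑ n (λ k → b k * w k) + d * w 0 + b n * w n
        ≈⟨ solve 3 (λ S d b → S :+ d :+ b := S :+ b :+ d) ≈-refl (∑ n (λ k → b k * w k)) (d * w 0) (b n * w n) ⟩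
      ∑ n (λ k → b k * w k) + b n * w n + d * w 0
        ≈⟨ +-congʳ (∑-last n _) ⟨
      ∑ (suc n) (λ k → b k * w k) + d * w 0
        ∎
      where open ≤-R

    Sums-abel : ∀ {A B} → (∀ k → 0# ≤ b k) →
      Sums (λ k → a k * w k) A → Sums (λ k → b k * w k) B → A ≤ B + d * w 0
    Sums-abel 0≤b (sums p) q = ⟶-upper 0 (λ n _ → ≤-trans
      (≤-by _ (*-nonneg (≤⇒0≤- (∑a≤∑b+d n)) (0≤w n)) ≈-refl)
      (≤-trans (∑-abel n) (+-monoˡ-≤ (d * w 0) (∑≤Sums (λ k → *-nonneg (0≤b k) (0≤w k)) q n)))) p

  -- Asymptotics

  -- The common core of both inequalities in the conclusion: λ = log(1/(1-x)),
  -- v = log μ and m = E(X), with 2δ = εα.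
  module _ {α δ K₁ K₂ d v λ′ m : Carrier} (0≤α : 0# ≤ α) (0≤δ : 0# ≤ δ) (0≤K₁ : 0# ≤ K₁) (0≤K₂ : 0# ≤ K₂)
    (v≤ : v ≤ λ′ + K₁) (λ≤ : λ′ ≤ v + K₂)
    (m≤ : m ≤ (α + δ) * λ′ + d) (≤m : α * λ′ ≤ m + δ * λ′ + d)
    (big : (α + δ) * (K₁ + K₂) + d < δ * v) where

    -- m ≤ (α + δ) λ′ + d ≤ (α + δ)(v + K₂) + d, and `big` puts (α + δ) K₂ + d below δ v.
    ratio-upper : m < α * v + (δ + δ) * v
    ratio-upper = <-by _
      (+-pos-nonneg (<⇒0<- big) (+-nonneg (≤⇒0≤- m≤)
        (+-nonneg (*-nonneg (+-nonneg 0≤α 0≤δ) (≤⇒0≤- λ≤)) (*-nonneg (+-nonneg 0≤α 0≤δ) 0≤K₁))))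
      (solve 8 (λ α δ K L d v l m → α :* v :+ (δ :+ δ) :* v := m :+
          (δ :* v :- ((α :+ δ) :* (K :+ L) :+ d) :+ ((α :+ δ) :* l :+ d :- m :+
            ((α :+ δ) :* (v :+ L :- l) :+ (α :+ δ) :* K))))
        ≈-refl α δ K₁ K₂ d v λ′ m)

    -- α v ≤ α λ′ + α K₁ ≤ m + δ λ′ + d + α K₁ and δ λ′ ≤ δ v + δ K₂; `big` covers d + α K₁ + δ K₂.
    ratio-lower : α * v < m + (δ + δ) * v
    ratio-lower = <-by _
      (+-pos-nonneg (<⇒0<- big) (+-nonneg (≤⇒0≤- ≤m) (+-nonneg (*-nonneg 0≤α (≤⇒0≤- v≤))
        (+-nonneg (*-nonneg 0≤δ (≤⇒0≤- λ≤)) (+-nonneg (*-nonneg 0≤α 0≤K₂) (*-nonneg 0≤δ 0≤K₁))))))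
      (solve 8 (λ α δ K L d v l m → m :+ (δ :+ δ) :* v := α :* v :+
          (δ :* v :- ((α :+ δ) :* (K :+ L) :+ d) :+ (m :+ δ :* l :+ d :- α :* l :+
            (α :* (l :+ K :- v) :+ (δ :* (v :+ L :- l) :+ (α :* L :+ δ :* K))))))
        ≈-refl α δ K₁ K₂ d v λ′ m)

  ratioWithin : ∀ {ε m g} → 0# < g → m < g + ε * g → g < m + ε * g → RatioWithin ε m g
  ratioWithin {ε} {m} {g} 0<g upper lower = g#0 ,
    <-resp ≈-refl (≈-trans (solve 3 (λ g e i → (g :+ e :* g) :* i := g :* i :+ e :* (g :* i)) ≈-refl g ε g⁻¹)
      (+-cong (x*x⁻¹≈1 g#0) (≈-trans (*-congˡ (x*x⁻¹≈1 g#0)) (*-identityʳ ε)))) (*-monoˡ-< g⁻¹ 0<g⁻¹ upper) ,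
    <-resp (x*x⁻¹≈1 g#0) (≈-trans (solve 4 (λ m g e i → (m :+ e :* g) :* i := m :* i :+ e :* (g :* i)) ≈-refl m g ε g⁻¹)
      (+-congˡ (≈-trans (*-congˡ (x*x⁻¹≈1 g#0)) (*-identityʳ ε)))) (*-monoˡ-< g⁻¹ 0<g⁻¹ lower)
    where
    g#0 : g # 0#
    g#0 = pos⇒#0 0<g
    g⁻¹ : Carrier
    g⁻¹ = g ⁻¹[ g#0 ]
    0<g⁻¹ : 0# < g⁻¹
    0<g⁻¹ = ⁻¹-pos g#0 0<g

  module Asymptotics {σ : ℕ → Carrier} {α : Carrier} (0≤s : IsWeighting σ) (mean : HasMean σ α) (0<α : 0# < α) where

    open Mean {σ} {α} 0≤s mean

    0≤α : 0# ≤ α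
    0≤α = <⇒≤ 0<α

    -- Partial sums too short for the mean to control are at most their values at `suc M`, and `d`
    -- is the total of these values for `s` and for the constant α.
    partialSums-offset : ∀ δ → 0# < δ → ∃ λ d → 0# ≤ d ×
      (∀ n → ∑ n s ≤ ∑ n (λ _ → α + δ) + d) × (∀ n → ∑ n (λ _ → α) ≤ ∑ n (λ k → s k + δ) + d)
    partialSums-offset δ 0<δ =
      let M , near = partialSums-near δ 0<δ
          a = ∑ (suc M) s
          b = ∑ (suc M) (λ _ → α)
          0≤a = ∑-nonneg (suc M) 0≤s
          0≤b = ∑-nonneg (suc M) (λ _ → 0≤α)
          0≤α+δ = +-nonneg 0≤α (<⇒≤ 0<δ)
          below : ∀ {u v w} → 0# ≤ v → 0# ≤ w → u ≤ w → u ≤ v + w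
          below {w = w} 0≤v 0≤w u≤w = ≤-trans u≤w (≤-by _ 0≤v (+-comm _ _))
      in a + b , +-nonneg 0≤a 0≤b ,
        (λ n → [
          (λ n≤1+M → below (∑-nonneg n (λ _ → 0≤α+δ)) (+-nonneg 0≤a 0≤b)
            (≤-trans (∑-mono-range 0≤s n≤1+M) (≤-by b 0≤b ≈-refl))) ,
          (λ { (s≤s {n = n} M≤n) → ≤-trans (<⇒≤ (proj₁ (near n (ℕ.≤-trans (ℕ.n≤1+n M) M≤n))))
            (≤-by (a + b) (+-nonneg 0≤a 0≤b) (+-congʳ (≈-trans (∑-const (suc n) (α + δ)) (*-comm _ _)))) }) ]′
          (ℕ.≤-<-connex n (suc M))) ,
        (λ n → [
          (λ n≤1+M → below (∑-nonneg n (λ k → +-nonneg (0≤s k) (<⇒≤ 0<δ))) (+-nonneg 0≤a 0≤b)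
            (≤-trans (∑-mono-range (λ _ → 0≤α) n≤1+M) (≤-by a 0≤a (+-comm a b)))) ,
          (λ { (s≤s {n = n} M≤n) → ≤-trans (≤-reflexive (≈-trans (∑-const (suc n) α) (*-comm _ α)))
            (≤-trans (<⇒≤ (proj₂ (near n (ℕ.≤-trans (ℕ.n≤1+n M) M≤n))))
            (≤-by (a + b) (+-nonneg 0≤a 0≤b) (+-congʳ (≈-trans (∑-+ (suc n) s (λ _ → δ))
              (+-congˡ (≈-trans (∑-const (suc n) δ) (*-comm _ δ))))))) }) ]′
          (ℕ.≤-<-connex n (suc M)))

    -- Serves twice: the weights xᵏ compare T with 1/(1-x), and the weights xᵏ⁺¹/(k+1) compare E(X)
    -- with log(1/(1-x)).
    weighted-sum-near : ∀ {w : ℕ → Carrier} {δ d V U} → 0# ≤ δ → 0# ≤ d →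
      (∀ n → ∑ n s ≤ ∑ n (λ _ → α + δ) + d) → (∀ n → ∑ n (λ _ → α) ≤ ∑ n (λ k → s k + δ) + d) →
      (∀ k → 0# ≤ w k) → (∀ k → w (suc k) ≤ w k) → w 0 ≤ 1# →
      Sums (λ k → s k * w k) V → Sums w U →
      V ≤ (α + δ) * U + d × α * U ≤ V + δ * U + d
    weighted-sum-near {w} {δ} {d} 0≤δ 0≤d up lo 0≤w w-antitone w₀≤1 p q =
      ≤-trans (Sums-abel {b = λ _ → α + δ} up 0≤w w-antitone (λ _ → 0≤α+δ) p (Sums-*ˡ (α + δ) 0≤α+δ q))
        (+-monoʳ-≤ _ dw₀≤d) ,
      ≤-trans (Sums-abel {a = λ _ → α} lo 0≤w w-antitone (λ k → +-nonneg (0≤s k) 0≤δ) (Sums-*ˡ α 0≤α q)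
          (Sums-cong (λ k → ≈-sym (distribʳ (w k) (s k) δ)) ≈-refl (Sums-+ p (Sums-*ˡ δ 0≤δ q))))
        (+-monoʳ-≤ _ dw₀≤d)
      where
      0≤α+δ : 0# ≤ α + δ
      0≤α+δ = +-nonneg 0≤α 0≤δ
      dw₀≤d : d * w 0 ≤ d
      dw₀≤d = ≤-resp ≈-refl (*-identityʳ d) (*-monoʳ-≤ d 0≤d w₀≤1)

    -- κ = α/8. With tolerance 4κ = α/2 the lower estimate reads T ≥ 4κt - d; absorbing d leaves T ≥
    -- 2κt, and x > ½ gives μ ≥ κt.
    κ : Carrier
    κ = ½ * (½ * (½ * α))

    0<κ : 0# < κ
    0<κ = *-pos 0<½ (*-pos 0<½ (*-pos 0<½ 0<α))

    κ⁻¹ : Carrier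
    κ⁻¹ = κ ⁻¹[ pos⇒#0 0<κ ]

    0<κ⁻¹ : 0# < κ⁻¹
    0<κ⁻¹ = ⁻¹-pos (pos⇒#0 0<κ) 0<κ

    4κ : Carrier
    4κ = κ + κ + (κ + κ)

    α≈8κ : α ≈ 4κ + 4κ
    α≈8κ = begin
      α                ≈⟨ dup α ⟩
      ½ * α + ½ * α    ≈⟨ +-cong (dup (½ * α)) (dup (½ * α)) ⟩
      (β + β) + (β + β)
        ≈⟨ +-cong (+-cong (dup β) (dup β)) (+-cong (dup β) (dup β)) ⟩
      4κ + 4κ          ∎
      where
      open ≈-R
      β : Carrier
      β = ½ * (½ * α)
      dup : ∀ x → x ≈ ½ * x + ½ * x
      dup x = ≈-sym (≈-trans (≈-sym (distribʳ x ½ ½)) (≈-trans (*-congʳ ½+½≈1) (*-identityˡ x)))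

    0<4κ : 0# < 4κ
    0<4κ = +-pos (+-pos 0<κ 0<κ) (+-pos 0<κ 0<κ)

    -- The offset 2 keeps every `x₀ n` at least ½, and beyond `x₀ n` the value of 1/(1-x) exceeds n
    -- + 2.
    x₀ : ℕ → Carrier
    x₀ n = 1# - 1/ (suc (suc n))

    -- Estimates for fixed x close to 1, with t = 1/(1-x), T = Σ σₖ₊₁xᵏ, μ = xT.
    module Near {x t T d : Carrier} {n : ℕ} (x<1 : x < 1#) (x₀<x : x₀ n < x) (ht≈1 : (1# - x) * t ≈ 1#)
      (T≤ : T ≤ (α + 4κ) * t + d) (≤T : α * t ≤ T + 4κ * t + d) (0≤d : 0# ≤ d)
      (E : Carrier) (0≤E : 0# ≤ E) (n-large : 1# + E + d < fromℕ n * κ) where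

      h : Carrier
      h = 1# - x

      0<h : 0# < h
      0<h = <⇒0<- x<1

      n+2<t : fromℕ (suc (suc n)) < t
      n+2<t = *-cancelˡ-< h 0<h (<-resp ≈-refl (≈-sym ht≈1) (<-resp ≈-refl (n*1/n≈1 (suc (suc n)))
        (<-resp (*-comm _ h) ≈-refl (*-monoʳ-< (fromℕ (suc (suc n))) (fromℕ-pos (suc n))
          (<-by _ (<⇒0<- x₀<x) (solve 2 (λ i x → i := 𝟙 :- x :+ (x :- (𝟙 :- i))) ≈-refl (1/ (suc (suc n))) x))))))

      ½<x : ½ < x
      ½<x = ≤-<-trans (≤-by _ (≤⇒0≤- (1/≤½ n))
        (≈-trans (+-congʳ (≈-sym ½+½≈1)) (solve 2 (λ h i → h :+ h :- i := h :+ (h :- i)) ≈-refl ½ (1/ (suc (suc n)))))) x₀<x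
        where
        1/≤½ : ∀ k → 1/ (suc (suc k)) ≤ ½
        1/≤½ zero    = ≤-refl
        1/≤½ (suc k) = ≤-trans (<⇒≤ (1/-antitone (suc k))) (1/≤½ k)

      0≤x : 0# ≤ x
      0≤x = <⇒≤ (<-trans 0<½ ½<x)

      n<t : fromℕ n < t
      n<t = ≤-<-trans (fromℕ-mono-≤ {n} {suc (suc n)} (ℕ.m≤n+m n 2)) n+2<t

      0≤t : 0# ≤ t
      0≤t = <⇒≤ (≤-<-trans (fromℕ-nonneg n) n<t)

      large : 1# + E + d < κ * t
      large = <-trans n-large (<-resp (*-comm κ _) ≈-refl (*-monoʳ-< κ 0<κ n<t))

      2κt≤T : κ * t + κ * t ≤ T
      2κt≤T = ≤-by _
        (+-nonneg (≤⇒0≤- ≤T) (+-nonneg (<⇒≤ (<⇒0<- large)) (+-nonneg 0≤1 (+-nonneg 0≤E (*-nonneg (<⇒≤ 0<κ) 0≤t)))))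
        (≈-trans
          (solve 6 (λ T q t d k e → T := k :* t :+ k :* t :+
              (T :+ q :* t :+ d :- (q :+ q) :* t :+ (k :* t :- (𝟙 :+ e :+ d) :+ (𝟙 :+ (e :+ (q :* t :- k :* t :- k :* t :- k :* t))))))
            ≈-refl T 4κ t d κ E)
          (+-congˡ (+-cong (+-congˡ (-‿cong (*-congʳ (≈-sym α≈8κ)))) (+-congˡ (+-congˡ (+-congˡ
            (solve 2 (λ k t → (k :+ k :+ (k :+ k)) :* t :- k :* t :- k :* t :- k :* t := k :* t) ≈-refl κ t)))))))

      0≤T : 0# ≤ T
      0≤T = ≤-trans (+-nonneg 0≤κt 0≤κt) 2κt≤T
        where
        0≤κt : 0# ≤ κ * t
        0≤κt = *-nonneg (<⇒≤ 0<κ) 0≤t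

      μ : Carrier
      μ = x * T

      κt≤μ : κ * t ≤ μ
      κt≤μ = ≤-trans (≤-resp
        (≈-trans (solve 2 (λ h a → h :* (a :+ a) := (h :+ h) :* a) ≈-refl ½ (κ * t)) (≈-trans (*-congʳ ½+½≈1) (*-identityˡ _))) ≈-refl
        (*-monoʳ-≤ ½ (<⇒≤ 0<½) 2κt≤T)) (*-monoˡ-≤ T 0≤T (<⇒≤ ½<x))

      μ-large : 1# + E + d < μ
      μ-large = <-≤-trans large κt≤μ

      1<μ : 1# < μ
      1<μ = ≤-<-trans (≤-by (E + d) (+-nonneg 0≤E 0≤d) (+-assoc _ _ _)) μ-large

      -- `E` will be exp B, so this is what forces log μ to be at least B.
      E<μ : E < μ
      E<μ = ≤-<-trans (≤-by (1# + d) (+-nonneg 0≤1 0≤d)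
        (solve 2 (λ e d → 𝟙 :+ e :+ d := e :+ (𝟙 :+ d)) ≈-refl E d)) μ-large

      0<μ : 0# < μ
      0<μ = <-trans 0<1 1<μ

      -- Chosen so that 1/(1-y) = μ: the logarithm of μ is then the logarithmic series at `y`, with
      -- 0 ≤ y < 1 because μ > 1.
      ν y : Carrier
      ν = μ ⁻¹[ pos⇒#0 0<μ ]
      y = 1# - ν

      μν≈1 : μ * ν ≈ 1#
      μν≈1 = x*x⁻¹≈1 (pos⇒#0 0<μ)

      0<ν : 0# < ν
      0<ν = ⁻¹-pos (pos⇒#0 0<μ) 0<μ

      y<1 : y < 1#
      y<1 = <-by ν 0<ν (solve 1 (λ n → 𝟙 := 𝟙 :- n :+ n) ≈-refl ν)

      1-y≈ν : 1# - y ≈ ν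
      1-y≈ν = solve 1 (λ n → 𝟙 :- (𝟙 :- n) := n) ≈-refl ν

      [1-y]μ≈1 : (1# - y) * μ ≈ 1#
      [1-y]μ≈1 = ≈-trans (*-congʳ 1-y≈ν) (≈-trans (*-comm ν μ) μν≈1)

      0≤y : 0# ≤ y
      0≤y = ≤⇒0≤- (*-cancelˡ-≤ μ 0<μ (≤-resp (≈-sym μν≈1) (≈-sym (*-identityʳ μ)) (<⇒≤ 1<μ)))

      μh≤ : μ * h ≤ α + 4κ + d
      μh≤ = begin
        x * T * h                ≤⟨ *-monoˡ-≤ h (<⇒≤ 0<h) (≤-resp ≈-refl (*-identityˡ T) (*-monoˡ-≤ T 0≤T (<⇒≤ x<1))) ⟩
        T * h                    ≤⟨ *-monoˡ-≤ h (<⇒≤ 0<h) T≤ ⟩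
        ((α + 4κ) * t + d) * h   ≈⟨ solve 4 (λ a t d h → (a :* t :+ d) :* h := a :* (h :* t) :+ d :* h) ≈-refl (α + 4κ) t d h ⟩
        (α + 4κ) * (h * t) + d * h
          ≤⟨ +-mono-≤ (≤-reflexive (≈-trans (*-congˡ ht≈1) (*-identityʳ _)))
               (≤-resp ≈-refl (*-identityʳ d) (*-monoʳ-≤ d 0≤d (≤-by x 0≤x (solve 1 (λ x → 𝟙 := 𝟙 :- x :+ x) ≈-refl x)))) ⟩
        α + 4κ + d               ∎
        where open ≤-R

      tν≤ : t * ν ≤ κ⁻¹
      tν≤ = *-cancelˡ-≤ κ 0<κ (begin
        κ * (t * ν)   ≈⟨ *-assoc κ t ν ⟨
        κ * t * ν     ≤⟨ *-monoˡ-≤ ν (<⇒≤ 0<ν) κt≤μ ⟩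
        μ * ν         ≈⟨ μν≈1 ⟩
        1#            ≈⟨ x*x⁻¹≈1 (pos⇒#0 0<κ) ⟨
        κ * κ⁻¹       ∎)
        where open ≤-R

      module Logs {u v} (p : Sums (logTerm x) u) (q : Sums (logTerm y) v) where

        drop-1 : ∀ {a b c} → a + 1# ≤ b + c → a ≤ b + c
        drop-1 {a} = ≤-trans (≤-by 1# 0≤1 ≈-refl)

        -- log μ - log t ≤ μ/t - 1, where μ/t = μh is bounded by `μh≤` and the -1 is discarded. `u≤`
        -- exchanges the roles of μ and t.
        v≤ : v ≤ u + (α + 4κ + d)
        v≤ = ≤-trans (drop-1 (log-concave 0≤x 0≤y y<1 [1-y]μ≈1 p q)) (+-monoʳ-≤ u μh≤)

        u≤ : u ≤ v + κ⁻¹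
        u≤ = ≤-trans (drop-1 (log-concave 0≤y 0≤x x<1 ht≈1 q p))
          (+-monoʳ-≤ v (≤-trans (≤-reflexive (*-congˡ 1-y≈ν)) tν≤))

    module _ {x} (0<x : 0# < x) (x<1 : x < 1#) (P : BoltzmannMeasure σ x) where
      private
        open BoltzmannMeasure P using (logZ; logZ-sum; Z-exp; Z#0)
        module M = Moments {σ} {x} {logZ} 0≤s (<⇒≤ 0<x) (logZ-terms {σ} (HasSum⇒Sums logZ-sum)) (HasSum⇒Sums Z-exp) Z#0

      𝔼N-value : ∀ {μ T} → 𝔼[ P ] N ≈ μ → Sums (λ k → s k * x ^ k) T → μ ≈ x * T
      𝔼N-value 𝔼N powers = ⟶-unique 𝔼N (M.𝔼-N powers)

      𝔼X-sum : ∀ {m} → 𝔼[ P ] X ≈ m → Sums (λ k → s k * logTerm x k) m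
      𝔼X-sum 𝔼X = Sums-cong (λ k → *-assoc _ _ _) (⟶-unique M.𝔼-X 𝔼X) (HasSum⇒Sums logZ-sum)

    -- The order of choice matters: δ = εα/2 and the offsets d, d′ come first, then B to outweigh
    -- every bounded error by δB, then E = exp B, and finally n so that μ exceeds E.
    module Constants {ε δ d d′ E : Carrier} {B n : ℕ} (0<δ : 0# < δ) (δ+δ≈εα : δ + δ ≈ ε * α)
      (0≤d : 0# ≤ d) (up : ∀ n → ∑ n s ≤ ∑ n (λ _ → α + δ) + d)
      (lo : ∀ n → ∑ n (λ _ → α) ≤ ∑ n (λ k → s k + δ) + d)
      (0≤d′ : 0# ≤ d′) (up′ : ∀ n → ∑ n s ≤ ∑ n (λ _ → α + 4κ) + d′)
      (lo′ : ∀ n → ∑ n (λ _ → α) ≤ ∑ n (λ k → s k + 4κ) + d′)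
      (B-large : (α + δ) * (α + 4κ + d′ + κ⁻¹) + d < δ * fromℕ B) (expB : Sums (expTerm (fromℕ B)) E)
      (n-large : 1# + E + d′ < fromℕ n * κ) where

      0≤δ : 0# ≤ δ
      0≤δ = <⇒≤ 0<δ

      0≤K : 0# ≤ α + 4κ + d′
      0≤K = +-nonneg (+-nonneg 0≤α (<⇒≤ 0<4κ)) 0≤d′

      0≤E : 0# ≤ E
      0≤E = Sums-nonneg (expTerm-nonneg (fromℕ-nonneg B)) expB

      module _ {x t T} (0<x : 0# < x) (x<1 : x < 1#) (x₀<x : x₀ n < x) (ht≈1 : (1# - x) * t ≈ 1#)
        (powers : Sums (λ k → s k * x ^ k) T) where

        0≤x : 0# ≤ x
        0≤x = <⇒≤ 0<x

        x≤1 : x ≤ 1#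
        x≤1 = <⇒≤ x<1

        T-near : T ≤ (α + 4κ) * t + d′ × α * t ≤ T + 4κ * t + d′
        T-near = weighted-sum-near (<⇒≤ 0<4κ) 0≤d′ up′ lo′ (λ k → ^-nonneg k 0≤x) (^-antitone 0≤x x≤1) ≤-refl
          powers (Sums-geometric 0≤x x<1 ht≈1)

        open Near {n = n} x<1 x₀<x ht≈1 (proj₁ T-near) (proj₂ T-near) 0≤d′ E 0≤E n-large
          using (μ; y; 0≤y; y<1; [1-y]μ≈1; E<μ; module Logs)

        logTerm₀≤1 : logTerm x 0 ≤ 1#
        logTerm₀≤1 = ≤-trans
          (*-mono-≤ (^-nonneg 1 0≤x) 0≤1 (≤-resp (≈-sym (*-identityʳ x)) ≈-refl x≤1) (1/≤1 0))
          (≤-reflexive (*-identityʳ 1#))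

        module _ {m u v} (𝔼X : Sums (λ k → s k * logTerm x k) m)
          (p : Sums (logTerm x) u) (q : Sums (logTerm y) v) where

          expv : Sums (expTerm v) μ
          expv = exp-log 0≤y y<1 [1-y]μ≈1 q

          0≤v : 0# ≤ v
          0≤v = Sums-nonneg (logTerm-nonneg 0≤y) q

          -- If v < B, termwise monotonicity of the exponential would give μ = exp v ≤ exp B = E.
          B≤v : fromℕ B ≤ v
          B≤v v<B = Sums-mono-≤
            (λ k → *-monoˡ-≤ (1/! k) (<⇒≤ (1/!-pos k)) (^-mono-≤ k 0≤v (<⇒≤ v<B))) expv expB E<μ

          big : (α + δ) * (α + 4κ + d′ + κ⁻¹) + d < δ * v
          big = <-≤-trans B-large (*-monoʳ-≤ δ 0≤δ B≤v)

          0<v : 0# < v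
          0<v = *-cancelˡ-< δ 0<δ (<-resp (≈-sym (zeroʳ δ)) ≈-refl (≤-<-trans
            (+-nonneg (*-nonneg (+-nonneg 0≤α 0≤δ) (+-nonneg 0≤K (<⇒≤ 0<κ⁻¹))) 0≤d) big))

          m-near : m ≤ (α + δ) * u + d × α * u ≤ m + δ * u + d
          m-near = weighted-sum-near 0≤δ 0≤d up lo (logTerm-nonneg 0≤x) (logTerm-antitone 0≤x x≤1) logTerm₀≤1 𝔼X p

          rescale : (δ + δ) * v ≈ ε * (α * v)
          rescale = ≈-trans (*-congʳ δ+δ≈εα) (*-assoc ε α v)

          m∼αv : RatioWithin ε m (α * v)
          m∼αv = ratioWithin (*-pos 0<α 0<v)
            (<-resp ≈-refl (+-congˡ rescale) (ratio-upper 0≤α 0≤δ 0≤K (<⇒≤ 0<κ⁻¹)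
              (Logs.v≤ p q) (Logs.u≤ p q) (proj₁ m-near) (proj₂ m-near) big))
            (<-resp ≈-refl (+-congˡ rescale) (ratio-lower 0≤α 0≤δ 0≤K (<⇒≤ 0<κ⁻¹)
              (Logs.v≤ p q) (Logs.u≤ p q) (proj₁ m-near) (proj₂ m-near) big))

        conclusion : ∀ {μ′ m} → μ′ ≈ μ → Sums (λ k → s k * logTerm x k) m →
                     ∃ λ ℓ → IsLog μ′ ℓ × RatioWithin ε m (α * ℓ)
        conclusion μ′≈μ 𝔼X = conclude (log-converges 0≤x x<1) (log-converges 0≤y y<1)
          where
          conclude : ∃ (Sums (logTerm x)) → ∃ (Sums (logTerm y)) → _
          conclude (u , p) (v , q) = v ,
            Sums⇒HasSum (Sums-cong (λ _ → ≈-refl) (≈-sym μ′≈μ) (expv 𝔼X p q)) , m∼αv 𝔼X p q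

    -- Choice of the thresholds for x and for μ.

    larger-multiple : ∀ r {k} → 0# < k → ∃ λ n → r < k * fromℕ n
    larger-multiple r {k} 0<k =
      let n , rk⁻¹<n = archimedean (r * k ⁻¹[ pos⇒#0 0<k ]) in
      n , <-resp
        (≈-trans (solve 3 (λ k r i → k :* (r :* i) := r :* (k :* i)) ≈-refl k r (k ⁻¹[ pos⇒#0 0<k ]))
          (≈-trans (*-congˡ (x*x⁻¹≈1 (pos⇒#0 0<k))) (*-identityʳ r)))
        ≈-refl (*-monoʳ-< k 0<k rk⁻¹<n)

    AsymptoticAbove : Carrier → ℕ → Set _
    AsymptoticAbove ε n = ∀ x → 0# < x → x < 1# → x₀ n < x →
      (P : BoltzmannMeasure σ x) → ∀ μ m → 𝔼[ P ] N ≈ μ → 𝔼[ P ] X ≈ m →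
      ∃ λ ℓ → IsLog μ ℓ × RatioWithin ε m (α * ℓ)

    asymptotic : ∀ ε → 0# < ε → ∃ (AsymptoticAbove ε)
    asymptotic ε 0<ε =
      case halve (ε * α) (*-pos 0<ε 0<α) of λ (δ , 0<δ , δ+δ≈εα) →
      case partialSums-offset δ 0<δ of λ (d , 0≤d , up , lo) →
      case partialSums-offset 4κ 0<4κ of λ (d′ , 0≤d′ , up′ , lo′) →
      case larger-multiple ((α + δ) * (α + 4κ + d′ + κ⁻¹) + d) 0<δ of λ (B , B-large) →
      case exp-converges (fromℕ-nonneg B) of λ (E , expB) →
      case larger-multiple (1# + E + d′) 0<κ of λ (n , n-large) →
      n , λ x 0<x x<1 x₀<x P μ m 𝔼N 𝔼X →
        let powers = proj₂ (Sums-powers (<⇒≤ 0<x) x<1) in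
        Constants.conclusion {B = B} {n} 0<δ δ+δ≈εα 0≤d up lo 0≤d′ up′ lo′ B-large expB
          (<-resp ≈-refl (*-comm κ _) n-large)
          0<x x<1 x₀<x (x*x⁻¹≈1 (pos⇒#0 (<⇒0<- x<1))) powers
          (𝔼N-value 0<x x<1 P 𝔼N powers) (𝔼X-sum 0<x x<1 P 𝔼X)

    x₀<1 : ∀ n → x₀ n < 1#
    x₀<1 n = <-by (1/ (suc (suc n))) (1/-pos (suc (suc n)))
      (solve 1 (λ i → 𝟙 := 𝟙 :- i :+ i) ≈-refl (1/ (suc (suc n))))

    0<x₀ : ∀ n → 0# < x₀ n
    0<x₀ n = <⇒0<- (<-≤-trans (1/-antitone n) (1/≤1 n))

    x₀-increasing : ∀ n → x₀ n < x₀ (suc n)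
    x₀-increasing n = <-by _ (<⇒0<- (1/-antitone (suc n)))
      (solve 2 (λ i j → 𝟙 :- i := 𝟙 :- j :+ (j :- i)) ≈-refl (1/ (suc (suc (suc n)))) (1/ (suc (suc n))))

    𝔼N-monotone : ∀ {x y T T′} → 0# ≤ x → 0# ≤ y → x ≤ y →
      Sums (λ k → s k * x ^ k) T → Sums (λ k → s k * y ^ k) T′ → x * T ≤ y * T′
    𝔼N-monotone 0≤x 0≤y x≤y p q = *-mono-≤ 0≤x (Sums-nonneg (λ k → *-nonneg (0≤s k) (^-nonneg k 0≤y)) q) x≤y
      (Sums-mono-≤ (λ k → *-monoʳ-≤ (s k) (0≤s k) (^-mono-≤ k 0≤x x≤y)) p q)

    -- E(N) increases with x, so it exceeds its value at x₀ (n + 1) only for x > x₀ n.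
    large-μ : ∀ n → ∃ λ μ₀ → ∀ x → 0# < x → x < 1# →
      (P : BoltzmannMeasure σ x) → ∀ μ → μ₀ < μ → 𝔼[ P ] N ≈ μ → x₀ n < x
    large-μ n =
      case Sums-powers (<⇒≤ (0<x₀ (suc n))) (x₀<1 (suc n)) of λ (T₁ , powers₁) →
      x₀ (suc n) * T₁ , λ x 0<x x<1 P μ μ₀<μ 𝔼N →
        let powers = proj₂ (Sums-powers (<⇒≤ 0<x) x<1) in
        [ (λ x₀<x → x₀<x)
        , (λ x<x₁ → ⊥-elim (𝔼N-monotone (<⇒≤ 0<x) (<⇒≤ (0<x₀ (suc n))) (<⇒≤ x<x₁) powers powers₁
            (<-resp ≈-refl (𝔼N-value 0<x x<1 P 𝔼N powers) μ₀<μ)))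
        ]′ (<-cotrans (x₀-increasing n) x)

theorem4p3 : ∀ {c ℓ₁ ℓ₂} (ℝ : CompleteOrderedField c ℓ₁ ℓ₂) →
    let open Boltzmann ℝ in
    (σ : ℕ → Carrier) (α : Carrier) → IsWeighting σ → HasMean σ α →
    (∀ x → 0# < x → x < 1# →
    Σ (BoltzmannMeasure σ x) λ P → ∃ λ μ → ∃ λ m →
    𝔼[ P ] N ≈ μ × 𝔼[ P ] X ≈ m × 𝕍[ P ] X ≈ m)
    ×
    (0# < α →
    (∀ ε → 0# < ε → ∃ λ x₀ → x₀ < 1# ×
    (∀ x → 0# < x → x < 1# → x₀ < x →
    (P : BoltzmannMeasure σ x) → ∀ μ m → 𝔼[ P ] N ≈ μ → 𝔼[ P ] X ≈ m →
    ∃ λ ℓ → IsLog μ ℓ × RatioWithin ε m (α * ℓ)))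
    ×
    (∀ ε → 0# < ε → ∃ λ μ₀ →
    (∀ x → 0# < x → x < 1# →
    (P : BoltzmannMeasure σ x) → ∀ μ m → μ₀ < μ → 𝔼[ P ] N ≈ μ → 𝔼[ P ] X ≈ m →
    ∃ λ ℓ → IsLog μ ℓ × RatioWithin ε m (α * ℓ))))
theorem4p3 ℝ σ α 0≤s mean = Mean.moments {σ} {α} 0≤s mean , λ 0<α →
  let open Asymptotics {σ} {α} 0≤s mean 0<α in
  (λ ε 0<ε → case asymptotic ε 0<ε of λ (n , near) → x₀ n , x₀<1 n , near) ,
  (λ ε 0<ε →
    -- A value of E(N) beyond `μ₀` forces x beyond `x₀ n`, which reduces the limit μ → ∞ to the
    -- limit x → 1.
    case asymptotic ε 0<ε of λ (n , near) →
    case large-μ n of λ (μ₀ , beyond) →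
    μ₀ , λ x 0<x x<1 P μ m μ₀<μ 𝔼N 𝔼X →
      near x 0<x x<1 (beyond x 0<x x<1 P μ μ₀<μ 𝔼N) P μ m 𝔼N 𝔼X)
  where open Analysis ℝ
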